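{- There is a polynomial-time $12$-approximation algorithm for Round-UFP under the no-bottleneck-assumption (NBA).
   Context: Round-UFP instance: a path $G=(V,E)$ with vertices $v_0,\dots,v_m$ and edges $e_i=\{v_{i-1},v_i\}$ for $1\le i\le m$, an integral capacity $c_e\in\mathbb{N}$ for each edge $e$, and a set $J$ of $n$ jobs. Each job $j\in J$ has a positive integral demand $d_j$, a source $v_{s_j}$ and a sink $v_{t_j}$ with $s_j<t_j$; $P_j$ denotes the subpath (set of edges) between them. Goal: partition $J$ into a minimum number of sets (rounds) $J_1,\dots,J_k$ such that for every round $J_i$ and every edge $e$, $\sum_{j\in J_i:\, e\in P_j} d_j\le c_e$. NBA: $\max_{j\in J} d_j\le\min_{e\in E}c_e$. An algorithm is an (absolute) $\alpha$-approximation if on every instance $I$ it returns a feasible solution with at most $\alpha\cdot OPT(I)$ rounds, where $OPT(I)$ is the minimum number of rounds. -}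

module Defs where

open import Data.Bool using (Bool; true; false)
open import Data.Fin as Fin using (Fin; toℕ; inject₁)
import Data.Fin.Properties as Fin
open import Data.List using (List; []; _∷_; allFin; filter; map; tabulate)
open import Data.List.Membership.Propositional using (_∈_)
open import Data.List.Relation.Unary.All as All using (All; []; _∷_)
open import Data.Nat using (ℕ; zero; suc; _+_; _*_; _∸_; _/_; _^_; _≤_; _≤ᵇ_; NonZero)
open import Data.Nat.ListAction using (sum)
open import Data.Nat.Logarithm using (⌈log₂_⌉)
open import Data.Product using (Σ; ∃; ∃₂; _×_; _,_)
open import Relation.Binary.PropositionalEquality using (_≡_; refl)
open import Relation.Nullary using (Dec)
open import Relation.Nullary.Decidable using (_×-dec_)

------------------------------------------------------------------------
-- Round-UFP

-- The path has vertices v₀ , … , vₘ, given by Fin (suc m).  Its edges are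
-- given by Fin m: the edge e joins the vertices inject₁ e and suc e.

record Job (m : ℕ) : Set where
  field
    demand          : ℕ
    demand-positive : NonZero demand
    source sink     : Fin (suc m)
    source<sink     : source Fin.< sink

open Job public

_∈P_ : ∀ {m} → Fin m → Job m → Set
e ∈P j = source j Fin.≤ inject₁ e × Fin.suc e Fin.≤ sink j

_∈P?_ : ∀ {m} (e : Fin m) (j : Job m) → Dec (e ∈P j)
e ∈P? j = (source j Fin.≤? inject₁ e) ×-dec (Fin.suc e Fin.≤? sink j)

record Instance : Set where
  field
    m n      : ℕ
    capacity : Fin m → ℕ
    job      : Fin n → Job m

open Instance public

NBA : Instance → Set
NBA I = ∀ (j : Fin (n I)) (e : Fin (m I)) → demand (job I j) ≤ capacity I e

-- A partition of the jobs into k rounds is given by the round of each job.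
-- The load of e in round i is the total demand of the jobs of that round
-- whose path contains e.
load : ∀ I {k} → (Fin (n I) → Fin k) → Fin k → Fin (m I) → ℕ
load I round i e =
  sum (map (λ j → demand (job I j))
           (filter (λ j → (round j Fin.≟ i) ×-dec (e ∈P? job I j))
                   (allFin (n I))))

record Solution (I : Instance) (k : ℕ) : Set where
  field
    round    : Fin (n I) → Fin k
    feasible : ∀ i e → load I round i e ≤ capacity I e

open Solution public

IsOPT : Instance → ℕ → Set
IsOPT I k = Solution I k × (∀ k′ → Solution I k′ → k ≤ k′)

------------------------------------------------------------------------
-- The model of computation: a Turing-complete typed while language with
-- logarithmic (bit-length) cost.

data Ty : Set where
  nat bool : Ty
  _⊗_      : Ty → Ty → Ty
  list     : Ty → Ty

infixr 5 _⊗_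

⟦_⟧ : Ty → Set
⟦ nat ⟧    = ℕ
⟦ bool ⟧   = Bool
⟦ a ⊗ b ⟧  = ⟦ a ⟧ × ⟦ b ⟧
⟦ list a ⟧ = List ⟦ a ⟧

-- Numbers are stored in binary; ⌈log₂ (suc x) ⌉ is the number of bits of x.
-- Every constructor adds one more symbol, so sizes are positive.
size : ∀ a → ⟦ a ⟧ → ℕ
size nat      x        = suc ⌈log₂ suc x ⌉
size bool     x        = 1
size (a ⊗ b)  (x , y)  = suc (size a x + size b y)
size (list a) []       = 1
size (list a) (x ∷ xs) = suc (size a x + size (list a) xs)

data Op : Set where
  plus monus times quot : Op

apply : Op → ℕ → ℕ → ℕ
apply plus  x y       = x + y
apply monus x y       = x ∸ y
apply times x y       = x * y
apply quot  x zero    = 0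
apply quot  x (suc y) = x / suc y

Ctx : Set
Ctx = List Ty

Env : Ctx → Set
Env = All ⟦_⟧

-- In `while c b e` the state is initially e; as long as c holds of it, it is
-- replaced by the value of b.
data Tm (Γ : Ctx) : Ty → Set where
  var   : ∀ {a} → a ∈ Γ → Tm Γ a
  let′  : ∀ {a b} → Tm Γ a → Tm (a ∷ Γ) b → Tm Γ b
  lit   : ℕ → Tm Γ nat
  op    : Op → Tm Γ nat → Tm Γ nat → Tm Γ nat
  leq   : Tm Γ nat → Tm Γ nat → Tm Γ bool
  if′   : ∀ {a} → Tm Γ bool → Tm Γ a → Tm Γ a → Tm Γ a
  pair  : ∀ {a b} → Tm Γ a → Tm Γ b → Tm Γ (a ⊗ b)
  fst   : ∀ {a b} → Tm Γ (a ⊗ b) → Tm Γ a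
  snd   : ∀ {a b} → Tm Γ (a ⊗ b) → Tm Γ b
  nil   : ∀ {a} → Tm Γ (list a)
  cons  : ∀ {a} → Tm Γ a → Tm Γ (list a) → Tm Γ (list a)
  case′ : ∀ {a b} → Tm Γ (list a) → Tm Γ b → Tm (a ∷ list a ∷ Γ) b → Tm Γ b
  while : ∀ {a} → Tm (a ∷ Γ) bool → Tm (a ∷ Γ) a → Tm Γ a → Tm Γ a

infix 4 _⊢_⇓_[_] _⊢while_do′_from_⇓_[_]

-- ρ ⊢ e ⇓ v [ t ] : in the environment ρ, e evaluates to v in time t.
-- A step that produces a value is charged the size of that value, as if the
-- value were copied in full (so data cannot be shared for free); its operands
-- have already been charged where they were produced.  Hence, for a fixed e, a
-- Turing machine can perform the evaluation in time polynomial in t and the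
-- size of ρ.  Conversely, the language simulates Turing machines with
-- polynomial overhead (the tape being a pair of lists).
mutual

  data _⊢_⇓_[_] {Γ : Ctx} (ρ : Env Γ) : ∀ {a} → Tm Γ a → ⟦ a ⟧ → ℕ → Set where

    ⇓var : ∀ {a} {x : a ∈ Γ} →
           ρ ⊢ var x ⇓ All.lookup ρ x [ size a (All.lookup ρ x) ]

    ⇓let : ∀ {a b} {e : Tm Γ a} {f : Tm (a ∷ Γ) b} {u v s t} →
           ρ ⊢ e ⇓ u [ s ] → (u ∷ ρ) ⊢ f ⇓ v [ t ] →
           ρ ⊢ let′ e f ⇓ v [ suc (s + t) ]

    ⇓lit : ∀ {x} → ρ ⊢ lit x ⇓ x [ size nat x ]

    ⇓op : ∀ {o} {e f : Tm Γ nat} {x y s t} →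
          ρ ⊢ e ⇓ x [ s ] → ρ ⊢ f ⇓ y [ t ] →
          ρ ⊢ op o e f ⇓ apply o x y [ size nat (apply o x y) + (s + t) ]

    ⇓leq : ∀ {e f : Tm Γ nat} {x y s t} →
           ρ ⊢ e ⇓ x [ s ] → ρ ⊢ f ⇓ y [ t ] →
           ρ ⊢ leq e f ⇓ (x ≤ᵇ y) [ suc (s + t) ]

    ⇓if-true : ∀ {a c} {e f : Tm Γ a} {v s t} →
               ρ ⊢ c ⇓ true [ s ] → ρ ⊢ e ⇓ v [ t ] →
               ρ ⊢ if′ c e f ⇓ v [ suc (s + t) ]

    ⇓if-false : ∀ {a c} {e f : Tm Γ a} {v s t} →
                ρ ⊢ c ⇓ false [ s ] → ρ ⊢ f ⇓ v [ t ] →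
                ρ ⊢ if′ c e f ⇓ v [ suc (s + t) ]

    ⇓pair : ∀ {a b} {e : Tm Γ a} {f : Tm Γ b} {u v s t} →
            ρ ⊢ e ⇓ u [ s ] → ρ ⊢ f ⇓ v [ t ] →
            ρ ⊢ pair e f ⇓ (u , v) [ size (a ⊗ b) (u , v) + (s + t) ]

    ⇓fst : ∀ {a b} {e : Tm Γ (a ⊗ b)} {u v t} →
           ρ ⊢ e ⇓ (u , v) [ t ] → ρ ⊢ fst e ⇓ u [ size a u + t ]

    ⇓snd : ∀ {a b} {e : Tm Γ (a ⊗ b)} {u v t} →
           ρ ⊢ e ⇓ (u , v) [ t ] → ρ ⊢ snd e ⇓ v [ size b v + t ]

    ⇓nil : ∀ {a} → ρ ⊢ nil {a = a} ⇓ [] [ 1 ]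

    ⇓cons : ∀ {a} {e : Tm Γ a} {f : Tm Γ (list a)} {u us s t} →
            ρ ⊢ e ⇓ u [ s ] → ρ ⊢ f ⇓ us [ t ] →
            ρ ⊢ cons e f ⇓ (u ∷ us) [ size (list a) (u ∷ us) + (s + t) ]

    ⇓case-nil : ∀ {a b} {e : Tm Γ (list a)} {f : Tm Γ b} {g v s t} →
                ρ ⊢ e ⇓ [] [ s ] → ρ ⊢ f ⇓ v [ t ] →
                ρ ⊢ case′ e f g ⇓ v [ suc (s + t) ]

    ⇓case-cons : ∀ {a b} {e : Tm Γ (list a)} {f : Tm Γ b} {g u us v s t} →
                 ρ ⊢ e ⇓ (u ∷ us) [ s ] → (u ∷ us ∷ ρ) ⊢ g ⇓ v [ t ] →
                 ρ ⊢ case′ e f g ⇓ v [ suc (s + t) ]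

    ⇓while : ∀ {a c b} {e : Tm Γ a} {u v s t} →
             ρ ⊢ e ⇓ u [ s ] → ρ ⊢while c do′ b from u ⇓ v [ t ] →
             ρ ⊢ while c b e ⇓ v [ suc (s + t) ]

  data _⊢while_do′_from_⇓_[_] {Γ : Ctx} (ρ : Env Γ) {a : Ty}
         (c : Tm (a ∷ Γ) bool) (b : Tm (a ∷ Γ) a) : ⟦ a ⟧ → ⟦ a ⟧ → ℕ → Set where

    stop : ∀ {u t} → (u ∷ ρ) ⊢ c ⇓ false [ t ] →
           ρ ⊢while c do′ b from u ⇓ u [ suc t ]

    step : ∀ {u v w r s t} →
           (u ∷ ρ) ⊢ c ⇓ true [ r ] → (u ∷ ρ) ⊢ b ⇓ v [ s ] →
           ρ ⊢while c do′ b from v ⇓ w [ t ] →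
           ρ ⊢while c do′ b from u ⇓ w [ suc (r + s + t) ]

mutual

  ⇓-deterministic : ∀ {Γ} {ρ : Env Γ} {a} {e : Tm Γ a} {v v′ t t′} →
                    ρ ⊢ e ⇓ v [ t ] → ρ ⊢ e ⇓ v′ [ t′ ] → v ≡ v′ × t ≡ t′
  ⇓-deterministic ⇓var ⇓var = refl , refl
  ⇓-deterministic (⇓let p q) (⇓let p′ q′)
    with refl , refl ← ⇓-deterministic p p′
    with refl , refl ← ⇓-deterministic q q′ = refl , refl
  ⇓-deterministic ⇓lit ⇓lit = refl , refl
  ⇓-deterministic (⇓op p q) (⇓op p′ q′)
    with refl , refl ← ⇓-deterministic p p′
    with refl , refl ← ⇓-deterministic q q′ = refl , refl
  ⇓-deterministic (⇓leq p q) (⇓leq p′ q′)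
    with refl , refl ← ⇓-deterministic p p′
    with refl , refl ← ⇓-deterministic q q′ = refl , refl
  ⇓-deterministic (⇓if-true p q) (⇓if-true p′ q′)
    with refl , refl ← ⇓-deterministic p p′
    with refl , refl ← ⇓-deterministic q q′ = refl , refl
  ⇓-deterministic (⇓if-true p _) (⇓if-false p′ _)
    with () , _ ← ⇓-deterministic p p′
  ⇓-deterministic (⇓if-false p _) (⇓if-true p′ _)
    with () , _ ← ⇓-deterministic p p′
  ⇓-deterministic (⇓if-false p q) (⇓if-false p′ q′)
    with refl , refl ← ⇓-deterministic p p′
    with refl , refl ← ⇓-deterministic q q′ = refl , refl
  ⇓-deterministic (⇓pair p q) (⇓pair p′ q′)
    with refl , refl ← ⇓-deterministic p p′
    with refl , refl ← ⇓-deterministic q q′ = refl , refl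
  ⇓-deterministic (⇓fst p) (⇓fst p′)
    with refl , refl ← ⇓-deterministic p p′ = refl , refl
  ⇓-deterministic (⇓snd p) (⇓snd p′)
    with refl , refl ← ⇓-deterministic p p′ = refl , refl
  ⇓-deterministic ⇓nil ⇓nil = refl , refl
  ⇓-deterministic (⇓cons p q) (⇓cons p′ q′)
    with refl , refl ← ⇓-deterministic p p′
    with refl , refl ← ⇓-deterministic q q′ = refl , refl
  ⇓-deterministic (⇓case-nil p q) (⇓case-nil p′ q′)
    with refl , refl ← ⇓-deterministic p p′
    with refl , refl ← ⇓-deterministic q q′ = refl , refl
  ⇓-deterministic (⇓case-nil p _) (⇓case-cons p′ _)
    with () , _ ← ⇓-deterministic p p′
  ⇓-deterministic (⇓case-cons p _) (⇓case-nil p′ _)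
    with () , _ ← ⇓-deterministic p p′
  ⇓-deterministic (⇓case-cons p q) (⇓case-cons p′ q′)
    with refl , refl ← ⇓-deterministic p p′
    with refl , refl ← ⇓-deterministic q q′ = refl , refl
  ⇓-deterministic (⇓while p q) (⇓while p′ q′)
    with refl , refl ← ⇓-deterministic p p′
    with refl , refl ← while-deterministic q q′ = refl , refl

  while-deterministic : ∀ {Γ} {ρ : Env Γ} {a c b} {u v v′ : ⟦ a ⟧} {t t′} →
                        ρ ⊢while c do′ b from u ⇓ v [ t ] →
                        ρ ⊢while c do′ b from u ⇓ v′ [ t′ ] → v ≡ v′ × t ≡ t′
  while-deterministic (stop p) (stop p′)
    with refl , refl ← ⇓-deterministic p p′ = refl , refl
  while-deterministic (stop p) (step p′ _ _)
    with () , _ ← ⇓-deterministic p p′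
  while-deterministic (step p _ _) (stop p′)
    with () , _ ← ⇓-deterministic p p′
  while-deterministic (step p q r) (step p′ q′ r′)
    with refl , refl ← ⇓-deterministic p p′
    with refl , refl ← ⇓-deterministic q q′
    with refl , refl ← while-deterministic r r′ = refl , refl

------------------------------------------------------------------------
-- Algorithms for Round-UFP

-- The capacities, and for each job its demand, source and sink.
Input : Ty
Input = list nat ⊗ list (nat ⊗ nat ⊗ nat)

encode : Instance → ⟦ Input ⟧
encode I =
  tabulate (capacity I) ,
  tabulate λ j → demand (job I j) , toℕ (source (job I j)) , toℕ (sink (job I j))

-- The number of rounds, and for each job the index of its round.
Output : Ty
Output = nat ⊗ list nat

encodeSolution : ∀ {I k} → Solution I k → ⟦ Output ⟧
encodeSolution {k = k} σ = k , tabulate λ j → toℕ (round σ j)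

Algorithm : Set
Algorithm = Tm (Input ∷ []) Output

_on_⇓_[_] : Algorithm → Instance → ⟦ Output ⟧ → ℕ → Set
A on I ⇓ v [ t ] = (encode I ∷ []) ⊢ A ⇓ v [ t ]

PolynomialTimeUnder : (Instance → Set) → Algorithm → Set
PolynomialTimeUnder C A =
  ∃₂ λ c d → ∀ I → C I →
  ∃₂ λ v t → A on I ⇓ v [ t ] × t ≤ c * size Input (encode I) ^ d

ApproximationUnder : (Instance → Set) → ℕ → Algorithm → Set
ApproximationUnder C α A =
  ∀ I → C I →
  ∃ λ k → Σ (Solution I k) λ σ →
    (∃ λ t → A on I ⇓ encodeSolution σ [ t ]) ×
    (∀ opt → IsOPT I opt → k ≤ α * opt)

{-# OPTIONS --safe #-}
module Submission where

-- Let D be the largest demand and r the maximum of ⌈load e / capacity e⌉ over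
-- the edges e; every solution has at least r rounds.  Jobs of demand more than
-- D / 4 share 8r rounds, all other jobs share 4r further ones.  The jobs whose
-- demands lie in one of the classes (D/4 , D], (D/8 , D/4], (D/16 , D/8], …
-- are coloured with the R available rounds in such a way that, on every edge,
-- any two colours occur equally often up to one.  On an edge with N jobs of
-- the class a colour then occurs fewer than N/R + 1 times.  For the first class,
-- N D ≤ 4 load ≤ 4 r c on an edge of capacity c ≥ D, so with R = 8r these jobs fit
-- even if each demand is rounded up to D.  For the other classes together,
-- rounding demands up costs a factor 2, hence c/2 with R = 4r, and rounding up the
-- counts costs D/4 + D/8 + … ≤ D/2 ≤ c/2.
--
-- The colouring is found by sweeping over the path.  Starts and ends of jobs
-- are events; if an event makes the counts of two colours a and b differ by
-- two, the past events of jobs coloured a or b are paired off in order of time,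
-- and these jobs are recoloured with a and b such that the two events of each
-- pair cancel in the difference of the counts of a and b.  This amounts to a
-- two-colouring of a union of two matchings of the events: one matches the start
-- and the end of each job, the other consists of the pairs.

open import Defs
open import Data.Bool using (Bool; true; false; if_then_else_; T; not; _∧_; _∨_; _xor_)
import Data.Bool.Properties as Bool
open import Data.Fin as Fin using (Fin; toℕ)
import Data.Fin.Properties as Fin
open import Data.List using (List; []; _∷_; _++_; _ʳ++_; _∷ʳ_; length; map; foldl; concatMap; filter; reverse; tabulate; take; allFin; applyUpTo; upTo)
open import Data.List.Membership.Propositional using (_∈_)
open import Data.List.Membership.Propositional.Properties
  using (∈-concat⁺′; ∈-map⁺; ∈-upTo⁺; ∈-upTo⁻; ∈-allFin; ∈-tabulate⁺; ∈-tabulate⁻; ∈-∃++)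
import Data.List.Properties as List
open import Data.List.Relation.Unary.All as All using (All; []; _∷_)
import Data.List.Relation.Unary.All.Properties as All
open import Data.List.Relation.Unary.AllPairs as AllPairs using (AllPairs; []; _∷_)
import Data.List.Relation.Unary.AllPairs.Properties as AllPairs
open import Data.List.Relation.Unary.Any using (here; there)
open import Data.List.Relation.Unary.Unique.Propositional.Properties using (upTo⁺; allFin⁺)
open import Data.Nat
open import Data.Nat.DivMod
open import Data.Nat.Induction using (<-rec)
open import Data.Nat.ListAction using (sum)
open import Data.Nat.ListAction.Properties using (sum-++)
open import Data.Nat.Logarithm
open import Data.Nat.Properties
open import Data.Nat.Tactic.RingSolver using (solve-∀)
open import Data.Product using (∃; ∃₂; _×_; _,_; proj₁; proj₂)
open import Data.Sum using (_⊎_; inj₁; inj₂)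
open import Function using (_∘_)
open import Relation.Binary.PropositionalEquality hiding (J)
open import Relation.Nullary using (Dec; does; yes; no; contradiction; _×-dec_)
open import Relation.Nullary.Decidable using (dec-true)

-- Recolouring touches jobs that started long ago, so the invariant of the sweep is balance in every
-- prefix of the events, not only at the current point. One recolouring per event is enough: an
-- event changes the counts of all colours but its own alike, so only its own colour `a` can be off
-- by two. Afterwards `a` and `b` share an unchanged sum evenly in every prefix, because a prefix
-- cuts at most one pair. A union of two matchings has only paths and even cycles, so the
-- two-colouring exists; it is computed by union-find with parities, and closing a cycle needs no
-- test, since the two loose ends of a path always carry opposite values.
--
-- All small classes pass through a single run, one class after the other. A finished job counts
-- once for every colour, so a completed class leaves all counts level and the next class starts as
-- if from nothing.
--
-- The running time is proved together with the program: each fragment carries its term, a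
-- polynomial and the function it computes. The obstacle is the loops, where the sizes of all
-- intermediate states must be bounded as well as the number of rounds.

infixl 6 _⊞_
infixl 7 _⊠_

-- Bounds stay syntactic until `pol-bound` turns the final one into `c * n ^ d`. With natural
-- coefficients they are monotone, so an upper bound may replace the argument. Composition is a
-- constructor because the body of a binding runs in an environment already enlarged by a value of
-- polynomial size.
data Pol : Set where
  X           : Pol
  K           : ℕ → Pol
  _⊞_ _⊠_ _⊚_ : Pol → Pol → Pol

⟪_⟫ : Pol → ℕ → ℕ
⟪ X ⟫     n = n
⟪ K c ⟫   n = c
⟪ p ⊞ q ⟫ n = ⟪ p ⟫ n + ⟪ q ⟫ n
⟪ p ⊠ q ⟫ n = ⟪ p ⟫ n * ⟪ q ⟫ n
⟪ p ⊚ q ⟫ n = ⟪ p ⟫ (⟪ q ⟫ n)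

⟪⟫-mono : ∀ p {m n} → m ≤ n → ⟪ p ⟫ m ≤ ⟪ p ⟫ n
⟪⟫-mono X       m≤n = m≤n
⟪⟫-mono (K _)   m≤n = ≤-refl
⟪⟫-mono (p ⊞ q) m≤n = +-mono-≤ (⟪⟫-mono p m≤n) (⟪⟫-mono q m≤n)
⟪⟫-mono (p ⊠ q) m≤n = *-mono-≤ (⟪⟫-mono p m≤n) (⟪⟫-mono q m≤n)
⟪⟫-mono (p ⊚ q) m≤n = ⟪⟫-mono p (⟪⟫-mono q m≤n)

^-distribʳ-* : ∀ a b d → (a * b) ^ d ≡ a ^ d * b ^ d
^-distribʳ-* a b zero    = refl
^-distribʳ-* a b (suc d) rewrite ^-distribʳ-* a b d = interchange a b (a ^ d) (b ^ d)
  where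
  interchange : ∀ a b x y → a * b * (x * y) ≡ a * x * (b * y)
  interchange = solve-∀

pol-bound : ∀ p → ∃₂ λ c d → ∀ n → 1 ≤ n → ⟪ p ⟫ n ≤ c * n ^ d
pol-bound X     = 1 , 1 , λ n _ → ≤-reflexive (sym (trans (+-identityʳ _) (*-identityʳ n)))
pol-bound (K c) = c , 0 , λ n _ → ≤-reflexive (sym (*-identityʳ c))
pol-bound (p ⊞ q) with pol-bound p | pol-bound q
... | c , d , bp | c′ , d′ , bq = c + c′ , d + d′ , bound
  where
  bound : ∀ n → 1 ≤ n → ⟪ p ⟫ n + ⟪ q ⟫ n ≤ (c + c′) * n ^ (d + d′)
  bound n@(suc _) 1≤n = begin
    ⟪ p ⟫ n + ⟪ q ⟫ n                          ≤⟨ +-mono-≤ (bp n 1≤n) (bq n 1≤n) ⟩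
    c * n ^ d + c′ * n ^ d′                    ≤⟨ +-mono-≤ (*-monoʳ-≤ c (^-monoʳ-≤ n (m≤m+n d d′)))
                                                           (*-monoʳ-≤ c′ (^-monoʳ-≤ n (m≤n+m d′ d))) ⟩
    c * n ^ (d + d′) + c′ * n ^ (d + d′)       ≡⟨ *-distribʳ-+ _ c c′ ⟨
    (c + c′) * n ^ (d + d′)                    ∎
    where open ≤-Reasoning
pol-bound (p ⊠ q) with pol-bound p | pol-bound q
... | c , d , bp | c′ , d′ , bq = c * c′ , d + d′ , bound
  where
  interchange : ∀ a b x y → a * x * (b * y) ≡ a * b * (x * y)
  interchange = solve-∀
  bound : ∀ n → 1 ≤ n → ⟪ p ⟫ n * ⟪ q ⟫ n ≤ c * c′ * n ^ (d + d′)
  bound n 1≤n = begin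
    ⟪ p ⟫ n * ⟪ q ⟫ n             ≤⟨ *-mono-≤ (bp n 1≤n) (bq n 1≤n) ⟩
    c * n ^ d * (c′ * n ^ d′)     ≡⟨ interchange c c′ (n ^ d) (n ^ d′) ⟩
    c * c′ * (n ^ d * n ^ d′)     ≡⟨ cong (c * c′ *_) (^-distribˡ-+-* n d d′) ⟨
    c * c′ * n ^ (d + d′)         ∎
    where open ≤-Reasoning
pol-bound (p ⊚ q) with pol-bound p | pol-bound q
... | c , d , bp | c′ , d′ , bq = c * suc c′ ^ d , d′ * d , bound
  where
  bound : ∀ n → 1 ≤ n → ⟪ p ⟫ (⟪ q ⟫ n) ≤ c * suc c′ ^ d * n ^ (d′ * d)
  bound n@(suc _) 1≤n = begin
    -- `c′` is raised to `suc c′` because `bp` holds only from argument 1 on, and `c′` may be 0.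
    ⟪ p ⟫ (⟪ q ⟫ n)                     ≤⟨ ⟪⟫-mono p (≤-trans (bq n 1≤n) (*-monoˡ-≤ (n ^ d′) (n≤1+n c′))) ⟩
    ⟪ p ⟫ (suc c′ * n ^ d′)             ≤⟨ bp _ (*-mono-≤ {1} {suc c′} {1} (s≤s z≤n) (m^n>0 n d′)) ⟩
    c * (suc c′ * n ^ d′) ^ d           ≡⟨ cong (c *_) (^-distribʳ-* (suc c′) (n ^ d′) d) ⟩
    c * (suc c′ ^ d * (n ^ d′) ^ d)     ≡⟨ *-assoc c (suc c′ ^ d) ((n ^ d′) ^ d) ⟨
    c * suc c′ ^ d * (n ^ d′) ^ d       ≡⟨ cong (c * suc c′ ^ d *_) (^-*-assoc n d′ d) ⟩
    c * suc c′ ^ d * n ^ (d′ * d)       ∎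
    where open ≤-Reasoning

-- Sizes of values and their relation to running time.

1≤size : ∀ a (v : ⟦ a ⟧) → 1 ≤ size a v
1≤size nat      v        = s≤s z≤n
1≤size bool     v        = ≤-refl
1≤size (a ⊗ b)  (u , v)  = s≤s z≤n
1≤size (list a) []       = ≤-refl
1≤size (list a) (x ∷ xs) = s≤s z≤n

n≤2*⌈n/2⌉ : ∀ n → n ≤ 2 * ⌈ n /2⌉
n≤2*⌈n/2⌉ n = begin
  n                        ≡⟨ ⌊n/2⌋+⌈n/2⌉≡n n ⟨
  ⌊ n /2⌋ + ⌈ n /2⌉        ≤⟨ +-monoˡ-≤ ⌈ n /2⌉ (⌊n/2⌋≤⌈n/2⌉ n) ⟩
  ⌈ n /2⌉ + ⌈ n /2⌉        ≡⟨ cong (⌈ n /2⌉ +_) (sym (+-identityʳ _)) ⟩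
  2 * ⌈ n /2⌉              ∎
  where open ≤-Reasoning

n≤2^⌈log₂n⌉ : ∀ n → n ≤ 2 ^ ⌈log₂ n ⌉
n≤2^⌈log₂n⌉ = <-rec _ go
  where
  open ≤-Reasoning
  go : ∀ n → (∀ {m} → m < n → m ≤ 2 ^ ⌈log₂ m ⌉) → n ≤ 2 ^ ⌈log₂ n ⌉
  go 0 _ = z≤n
  go 1 _ = ≤-refl
  go n@(suc (suc m)) rec = begin
    n                              ≤⟨ n≤2*⌈n/2⌉ n ⟩
    2 * ⌈ n /2⌉                    ≤⟨ *-monoʳ-≤ 2 (rec (⌈n/2⌉<n m)) ⟩
    2 * 2 ^ ⌈log₂ ⌈ n /2⌉ ⌉        ≡⟨ cong (λ k → 2 * 2 ^ k) (⌈log₂⌈n/2⌉⌉≡⌈log₂n⌉∸1 n) ⟩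
    2 ^ suc (⌈log₂ n ⌉ ∸ 1)        ≡⟨ cong (2 ^_) (m+[n∸m]≡n {1} (⌈log₂⌉-mono-≤ {2} {n} (s≤s (s≤s z≤n)))) ⟩
    2 ^ ⌈log₂ n ⌉                  ∎

size-nat-mono : ∀ {m n} → m ≤ n → size nat m ≤ size nat n
size-nat-mono m≤n = s≤s (⌈log₂⌉-mono-≤ (s≤s m≤n))

size-nat-≤ : ∀ n → size nat n ≤ suc n
size-nat-≤ n = s≤s (≤-trans (⌈log₂⌉-mono-≤ (n<2^n n)) (≤-reflexive (⌈log₂2^n⌉≡n n)))
  where
  n<2^n : ∀ n → n < 2 ^ n
  n<2^n zero    = ≤-refl
  n<2^n (suc n) = begin-strict
    suc n                    ≤⟨ n<2^n n ⟩
    2 ^ n                    <⟨ m<m+n (2 ^ n) (m^n>0 2 n) ⟩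
    2 ^ n + 2 ^ n            ≡⟨ cong (2 ^ n +_) (+-identityʳ _) ⟨
    2 ^ suc n                ∎
    where open ≤-Reasoning

-- Covers sums and products at once: both `suc (x + y)` and `suc (x * y)` are at most
-- `suc x * suc y`, and the logarithm turns this product into a sum of bit lengths.
size-nat-* : ∀ {x y z} → suc z ≤ suc x * suc y → size nat z ≤ size nat x + size nat y
size-nat-* {x} {y} {z} h = s≤s (begin
  ⌈log₂ suc z ⌉                                      ≤⟨ ⌈log₂⌉-mono-≤ h ⟩
  ⌈log₂ (suc x * suc y) ⌉                            ≤⟨ ⌈log₂⌉-mono-≤ (*-mono-≤ (n≤2^⌈log₂n⌉ (suc x)) (n≤2^⌈log₂n⌉ (suc y))) ⟩
  ⌈log₂ (2 ^ ⌈log₂ suc x ⌉ * 2 ^ ⌈log₂ suc y ⌉) ⌉    ≡⟨ cong ⌈log₂_⌉ (^-distribˡ-+-* 2 ⌈log₂ suc x ⌉ _) ⟨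
  ⌈log₂ (2 ^ (⌈log₂ suc x ⌉ + ⌈log₂ suc y ⌉)) ⌉      ≡⟨ ⌈log₂2^n⌉≡n _ ⟩
  ⌈log₂ suc x ⌉ + ⌈log₂ suc y ⌉                      ≤⟨ +-monoʳ-≤ ⌈log₂ suc x ⌉ (n≤1+n _) ⟩
  ⌈log₂ suc x ⌉ + size nat y                         ∎)
  where open ≤-Reasoning

size-op : ∀ o x y → size nat (apply o x y) ≤ size nat x + size nat y
size-op plus  x y       = size-nat-* {x} {y} (≤-trans (m≤m+n (suc (x + y)) (x * y)) (≤-reflexive (eq x y)))
  where
  eq : ∀ x y → suc (x + y) + x * y ≡ suc x * suc y
  eq = solve-∀
size-op monus x y       = ≤-trans (size-nat-mono (m∸n≤m x y)) (m≤m+n _ _)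
size-op times x y       = size-nat-* {x} {y} (≤-trans (m≤m+n (suc (x * y)) (x + y)) (≤-reflexive (eq x y)))
  where
  eq : ∀ x y → suc (x * y) + (x + y) ≡ suc x * suc y
  eq = solve-∀
size-op quot  x zero    = m≤n+m 1 (size nat x)
size-op quot  x (suc y) = ≤-trans (size-nat-mono (m/n≤m x (suc y))) (m≤m+n _ _)

size-∈ : ∀ {a} {x : ⟦ a ⟧} {xs} → x ∈ xs → size a x ≤ size (list a) xs
size-∈ {a} {x} {_ ∷ xs} (here refl) = ≤-trans (m≤m+n _ (size (list a) xs)) (n≤1+n _)
size-∈ {a} {x} {y ∷ xs} (there i)   = ≤-trans (size-∈ i) (≤-trans (m≤n+m _ (size a y)) (n≤1+n _))

length≤size : ∀ {a} (xs : List ⟦ a ⟧) → length xs ≤ size (list a) xs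
length≤size []           = z≤n
length≤size {a} (x ∷ xs) = s≤s (≤-trans (length≤size xs) (m≤n+m _ (size a x)))

size-++ : ∀ {a} (xs ys : List ⟦ a ⟧) → size (list a) (xs ++ ys) ≤ size (list a) xs + size (list a) ys
size-++ []           ys = n≤1+n _
size-++ {a} (x ∷ xs) ys = s≤s (begin
  size a x + size (list a) (xs ++ ys)                   ≤⟨ +-monoʳ-≤ (size a x) (size-++ xs ys) ⟩
  size a x + (size (list a) xs + size (list a) ys)      ≡⟨ +-assoc (size a x) _ _ ⟨
  size a x + size (list a) xs + size (list a) ys        ∎)
  where open ≤-Reasoning

size-All : ∀ {a B} {xs : List ⟦ a ⟧} → All (λ x → size a x ≤ B) xs → size (list a) xs ≤ suc (length xs * suc B)
size-All []           = ≤-refl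
size-All (b≤ ∷ bs)    = s≤s (≤-trans (+-mono-≤ b≤ (size-All bs)) (≤-reflexive (+-suc _ _)))

esize : ∀ {Γ} → Env Γ → ℕ
esize []              = 1
esize (_∷_ {a} v ρ)   = size a v + esize ρ

size-lookup : ∀ {Γ a} (ρ : Env Γ) (x : a ∈ Γ) → size a (All.lookup ρ x) ≤ esize ρ
size-lookup (v ∷ ρ) (here refl) = m≤m+n _ _
size-lookup (v ∷ ρ) (there x)   = ≤-trans (size-lookup ρ x) (m≤n+m _ _)

mutual

  -- Every rule charges the size of its result or passes on a result charged in a subderivation. A
  -- time bound therefore doubles as a size bound, and `Ex` needs no separate one.
  size≤time : ∀ {Γ a v t} {ρ : Env Γ} {e : Tm Γ a} → ρ ⊢ e ⇓ v [ t ] → size a v ≤ t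
  size≤time ⇓var              = ≤-refl
  size≤time (⇓let {s = s} _ q) = ≤-trans (size≤time q) (m≤n+m _ (suc s))
  size≤time ⇓lit              = ≤-refl
  size≤time (⇓op _ _)         = m≤m+n _ _
  size≤time (⇓leq _ _)        = s≤s z≤n
  size≤time (⇓if-true {s = s} _ q)  = ≤-trans (size≤time q) (m≤n+m _ (suc s))
  size≤time (⇓if-false {s = s} _ q) = ≤-trans (size≤time q) (m≤n+m _ (suc s))
  size≤time (⇓pair _ _)       = m≤m+n _ _
  size≤time (⇓fst _)          = m≤m+n _ _
  size≤time (⇓snd _)          = m≤m+n _ _
  size≤time ⇓nil              = ≤-refl
  size≤time (⇓cons _ _)       = m≤m+n _ _
  size≤time (⇓case-nil {s = s} _ q)  = ≤-trans (size≤time q) (m≤n+m _ (suc s))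
  size≤time (⇓case-cons {s = s} _ q) = ≤-trans (size≤time q) (m≤n+m _ (suc s))
  size≤time (⇓while p q)      = ≤-trans (while-size≤time q) (≤-trans (+-monoˡ-≤ _ (size≤time p)) (n≤1+n _))

  -- A loop that stops at once returns its initial state, which was charged outside the loop; hence
  -- the summand `size a u`.
  while-size≤time : ∀ {Γ a c b} {u v : ⟦ a ⟧} {t} {ρ : Env Γ} → ρ ⊢while c do′ b from u ⇓ v [ t ] →
                    size a v ≤ size a u + t
  while-size≤time (stop _) = m≤m+n _ _
  while-size≤time {a = a} {u = u} (step {r = r} {s} {t} _ q w) = begin
    _                            ≤⟨ while-size≤time w ⟩
    size a _ + t                 ≤⟨ +-monoˡ-≤ t (size≤time q) ⟩
    s + t                        ≤⟨ m≤n+m _ (suc r) ⟩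
    suc r + (s + t)              ≡⟨ cong suc (+-assoc r s t) ⟨
    suc (r + s + t)              ≤⟨ m≤n+m _ (size a u) ⟩
    size a u + suc (r + s + t)   ∎
    where open ≤-Reasoning

-- Renaming of variables.

Ren : Ctx → Ctx → Set
Ren Γ Δ = ∀ {a} → a ∈ Γ → a ∈ Δ

ext : ∀ {Γ Δ b} → Ren Γ Δ → Ren (b ∷ Γ) (b ∷ Δ)
ext r (here p)  = here p
ext r (there x) = there (r x)

rename : ∀ {Γ Δ a} → Ren Γ Δ → Tm Γ a → Tm Δ a
rename r (var x)       = var (r x)
rename r (let′ e f)    = let′ (rename r e) (rename (ext r) f)
rename r (lit n)       = lit n
rename r (op o e f)    = op o (rename r e) (rename r f)
rename r (leq e f)     = leq (rename r e) (rename r f)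
rename r (if′ c e f)   = if′ (rename r c) (rename r e) (rename r f)
rename r (pair e f)    = pair (rename r e) (rename r f)
rename r (fst e)       = fst (rename r e)
rename r (snd e)       = snd (rename r e)
rename r nil           = nil
rename r (cons e f)    = cons (rename r e) (rename r f)
rename r (case′ e f g) = case′ (rename r e) (rename r f) (rename (ext (ext r)) g)
rename r (while c b e) = while (rename (ext r) c) (rename (ext r) b) (rename r e)

Agree : ∀ {Γ Δ} → Ren Γ Δ → Env Γ → Env Δ → Set
Agree {Γ} r ρ σ = ∀ {a} (x : a ∈ Γ) → All.lookup σ (r x) ≡ All.lookup ρ x

agree-ext : ∀ {Γ Δ b} {r : Ren Γ Δ} {ρ σ} {v : ⟦ b ⟧} → Agree r ρ σ → Agree (ext r) (v ∷ ρ) (v ∷ σ)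
agree-ext h (here refl) = refl
agree-ext h (there x)   = h x

mutual

  -- Costs depend on values and not on the position of variables, so even the time is the same.
  rename-⇓ : ∀ {Γ Δ a v t} {r : Ren Γ Δ} {ρ : Env Γ} {σ : Env Δ} {e : Tm Γ a} →
             Agree r ρ σ → ρ ⊢ e ⇓ v [ t ] → σ ⊢ rename r e ⇓ v [ t ]
  rename-⇓ {a = a} {σ = σ} h (⇓var {x = x}) = subst (λ v → σ ⊢ _ ⇓ v [ size a v ]) (h x) ⇓var
  rename-⇓ h (⇓let p q)       = ⇓let (rename-⇓ h p) (rename-⇓ (agree-ext h) q)
  rename-⇓ h ⇓lit             = ⇓lit
  rename-⇓ h (⇓op p q)        = ⇓op (rename-⇓ h p) (rename-⇓ h q)
  rename-⇓ h (⇓leq p q)       = ⇓leq (rename-⇓ h p) (rename-⇓ h q)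
  rename-⇓ h (⇓if-true p q)   = ⇓if-true (rename-⇓ h p) (rename-⇓ h q)
  rename-⇓ h (⇓if-false p q)  = ⇓if-false (rename-⇓ h p) (rename-⇓ h q)
  rename-⇓ h (⇓pair p q)      = ⇓pair (rename-⇓ h p) (rename-⇓ h q)
  rename-⇓ h (⇓fst p)         = ⇓fst (rename-⇓ h p)
  rename-⇓ h (⇓snd p)         = ⇓snd (rename-⇓ h p)
  rename-⇓ h ⇓nil             = ⇓nil
  rename-⇓ h (⇓cons p q)      = ⇓cons (rename-⇓ h p) (rename-⇓ h q)
  rename-⇓ h (⇓case-nil p q)  = ⇓case-nil (rename-⇓ h p) (rename-⇓ h q)
  rename-⇓ h (⇓case-cons p q) = ⇓case-cons (rename-⇓ h p) (rename-⇓ (agree-ext (agree-ext h)) q)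
  rename-⇓ h (⇓while p q)     = ⇓while (rename-⇓ h p) (rename-while h q)

  rename-while : ∀ {Γ Δ a c b} {u v : ⟦ a ⟧} {t} {r : Ren Γ Δ} {ρ : Env Γ} {σ : Env Δ} →
                 Agree r ρ σ → ρ ⊢while c do′ b from u ⇓ v [ t ] →
                 σ ⊢while rename (ext r) c do′ rename (ext r) b from u ⇓ v [ t ]
  rename-while h (stop p)     = stop (rename-⇓ (agree-ext h) p)
  rename-while h (step p q w) = step (rename-⇓ (agree-ext h) p) (rename-⇓ (agree-ext h) q) (rename-while h w)

-- Polynomial-time expressions

-- The index `f` lets correctness be argued about an ordinary Agda function, while the term is
-- assembled alongside. Term and polynomial are fixed before the environment, which makes the bound
-- uniform.
record Ex (Γ : Ctx) (a : Ty) (f : Env Γ → ⟦ a ⟧) : Set where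
  constructor ex
  field
    tm  : Tm Γ a
    pol : Pol
    run : ∀ ρ → ∃ λ t → ρ ⊢ tm ⇓ f ρ [ t ] × t ≤ ⟪ pol ⟫ (esize ρ)

open Ex

size≤pol : ∀ {Γ a f} (e : Ex Γ a f) ρ → size a (f ρ) ≤ ⟪ pol e ⟫ (esize ρ)
size≤pol e ρ = let _ , d , t≤ = run e ρ in ≤-trans (size≤time d) t≤

extE : ∀ {Γ a} {f g : Env Γ → ⟦ a ⟧} → (∀ ρ → f ρ ≡ g ρ) → Ex Γ a f → Ex Γ a g
extE eq (ex e p r) = ex e p λ ρ → subst (λ v → ∃ λ t → ρ ⊢ e ⇓ v [ t ] × t ≤ ⟪ p ⟫ (esize ρ)) (eq ρ) (r ρ)

renE : ∀ {Γ Δ a f} (r : Ren Γ Δ) (π : Env Δ → Env Γ) → (∀ σ → Agree r (π σ) σ) → (∀ σ → esize (π σ) ≤ esize σ) →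
       Ex Γ a f → Ex Δ a (f ∘ π)
renE r π agree small (ex e p run) = ex (rename r e) p λ σ →
  let t , d , t≤ = run (π σ) in t , rename-⇓ (agree σ) d , ≤-trans t≤ (⟪⟫-mono p (small σ))

agree-tail : ∀ {Γ b} (ρ : Env (b ∷ Γ)) → Agree there (All.tail ρ) ρ
agree-tail (v ∷ ρ) x = refl

esize-tail : ∀ {Γ b} (ρ : Env (b ∷ Γ)) → esize (All.tail ρ) ≤ esize ρ
esize-tail (v ∷ ρ) = m≤n+m _ _

wk : ∀ {Γ a b f} → Ex Γ a f → Ex (b ∷ Γ) a (f ∘ All.tail)
wk = renE there All.tail agree-tail esize-tail

wk₂ : ∀ {Γ a b c f} → Ex Γ a f → Ex (b ∷ c ∷ Γ) a (f ∘ All.tail ∘ All.tail)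
wk₂ e = wk (wk e)

under : ∀ {Γ b c} → Env (b ∷ c ∷ Γ) → Env (b ∷ Γ)
under (x ∷ s ∷ ρ) = x ∷ ρ

wk₁ : ∀ {Γ a b c f} → Ex (b ∷ Γ) a f → Ex (b ∷ c ∷ Γ) a (f ∘ under)
wk₁ = renE (ext there) under (λ where (x ∷ s ∷ ρ) (here refl) → refl
                                      (x ∷ s ∷ ρ) (there i)   → refl)
                             (λ where (_∷_ {a} x (s ∷ ρ)) → +-monoʳ-≤ (size a x) (m≤n+m _ _))

varE : ∀ {Γ a} (x : a ∈ Γ) → Ex Γ a (λ ρ → All.lookup ρ x)
varE x = ex (var x) X λ ρ → _ , ⇓var , size-lookup ρ x

v₀ : ∀ {Γ a} → Ex (a ∷ Γ) a (λ ρ → All.lookup ρ (here refl))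
v₀ = varE (here refl)

v₁ : ∀ {Γ a b} → Ex (b ∷ a ∷ Γ) a (λ ρ → All.lookup ρ (there (here refl)))
v₁ = varE (there (here refl))

-- The bound value is no larger than the time spent on it, so the body runs in an environment of
-- size at most `p ⊞ X`.
letE : ∀ {Γ a b f g} → Ex Γ a f → Ex (a ∷ Γ) b g → Ex Γ b (λ ρ → g (f ρ ∷ ρ))
letE {f = f} e@(ex e₁ p r) (ex e₂ q r′) = ex (let′ e₁ e₂) (K 1 ⊞ (p ⊞ (q ⊚ (p ⊞ X)))) λ ρ →
  let s , d , s≤ = r ρ ; t , d′ , t≤ = r′ (f ρ ∷ ρ) in
  _ , ⇓let d d′ , s≤s (+-mono-≤ s≤ (≤-trans t≤ (⟪⟫-mono q (+-monoˡ-≤ (esize ρ) (size≤pol e ρ)))))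

litE : ∀ {Γ} n → Ex Γ nat (λ _ → n)
litE n = ex (lit n) (K (size nat n)) λ ρ → _ , ⇓lit , ≤-refl

opE : ∀ {Γ f g} o → Ex Γ nat f → Ex Γ nat g → Ex Γ nat (λ ρ → apply o (f ρ) (g ρ))
opE {f = f} {g} o (ex e p r) (ex e′ p′ r′) = ex (op o e e′) ((p ⊞ p′) ⊞ (p ⊞ p′)) λ ρ →
  let s , d , s≤ = r ρ ; t , d′ , t≤ = r′ ρ
      small = ≤-trans (size-op o (f ρ) (g ρ)) (+-mono-≤ (≤-trans (size≤time d) s≤) (≤-trans (size≤time d′) t≤))
  in _ , ⇓op d d′ , +-mono-≤ small (+-mono-≤ s≤ t≤)

leqE : ∀ {Γ f g} → Ex Γ nat f → Ex Γ nat g → Ex Γ bool (λ ρ → f ρ ≤ᵇ g ρ)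
leqE (ex e p r) (ex e′ p′ r′) = ex (leq e e′) (K 1 ⊞ (p ⊞ p′)) λ ρ →
  let s , d , s≤ = r ρ ; t , d′ , t≤ = r′ ρ in _ , ⇓leq d d′ , s≤s (+-mono-≤ s≤ t≤)

trueE falseE : ∀ {Γ} → Ex Γ bool _
trueE  {Γ} = leqE {Γ} (litE 0) (litE 0)
falseE {Γ} = leqE {Γ} (litE 1) (litE 0)

ifE : ∀ {Γ a c f g} → Ex Γ bool c → Ex Γ a f → Ex Γ a g → Ex Γ a (λ ρ → if c ρ then f ρ else g ρ)
ifE {Γ} {a} {c} {f} {g} (ex e p r) (ex e₁ p₁ r₁) (ex e₂ p₂ r₂) = ex (if′ e e₁ e₂) (K 1 ⊞ (p ⊞ (p₁ ⊞ p₂))) λ ρ → branch ρ (c ρ) (r ρ)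
  where
  branch : ∀ ρ b → (∃ λ s → ρ ⊢ e ⇓ b [ s ] × s ≤ ⟪ p ⟫ (esize ρ)) →
           ∃ λ t → ρ ⊢ if′ e e₁ e₂ ⇓ if b then f ρ else g ρ [ t ] × t ≤ suc (⟪ p ⟫ (esize ρ) + (⟪ p₁ ⟫ (esize ρ) + ⟪ p₂ ⟫ (esize ρ)))
  branch ρ true  (s , d , s≤) = let t , d′ , t≤ = r₁ ρ in
    _ , ⇓if-true d d′ , s≤s (+-mono-≤ s≤ (≤-trans t≤ (m≤m+n _ _)))
  branch ρ false (s , d , s≤) = let t , d′ , t≤ = r₂ ρ in
    _ , ⇓if-false d d′ , s≤s (+-mono-≤ s≤ (≤-trans t≤ (m≤n+m _ _)))

pairE : ∀ {Γ a b f g} → Ex Γ a f → Ex Γ b g → Ex Γ (a ⊗ b) (λ ρ → f ρ , g ρ)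
pairE (ex e p r) (ex e′ p′ r′) = ex (pair e e′) (K 1 ⊞ (p ⊞ p′) ⊞ (p ⊞ p′)) λ ρ →
  let s , d , s≤ = r ρ ; t , d′ , t≤ = r′ ρ in
  _ , ⇓pair d d′ , +-mono-≤ (s≤s (+-mono-≤ (≤-trans (size≤time d) s≤) (≤-trans (size≤time d′) t≤))) (+-mono-≤ s≤ t≤)

fstE : ∀ {Γ a b f} → Ex Γ (a ⊗ b) f → Ex Γ a (proj₁ ∘ f)
fstE (ex e p r) = ex (fst e) (p ⊞ p) λ ρ →
  let s , d , s≤ = r ρ in
  _ , ⇓fst d , +-mono-≤ (≤-trans (≤-trans (m≤m+n _ _) (n≤1+n _)) (≤-trans (size≤time d) s≤)) s≤

sndE : ∀ {Γ a b f} → Ex Γ (a ⊗ b) f → Ex Γ b (proj₂ ∘ f)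
sndE {a = a} (ex e p r) = ex (snd e) (p ⊞ p) λ ρ →
  let s , d , s≤ = r ρ in
  _ , ⇓snd d , +-mono-≤ (≤-trans (≤-trans (m≤n+m _ (size a _)) (n≤1+n _)) (≤-trans (size≤time d) s≤)) s≤

nilE : ∀ {Γ a} → Ex Γ (list a) (λ _ → [])
nilE = ex nil (K 1) λ ρ → _ , ⇓nil , ≤-refl

consE : ∀ {Γ a f g} → Ex Γ a f → Ex Γ (list a) g → Ex Γ (list a) (λ ρ → f ρ ∷ g ρ)
consE (ex e p r) (ex e′ p′ r′) = ex (cons e e′) (K 1 ⊞ (p ⊞ p′) ⊞ (p ⊞ p′)) λ ρ →
  let s , d , s≤ = r ρ ; t , d′ , t≤ = r′ ρ in
  _ , ⇓cons d d′ , +-mono-≤ (s≤s (+-mono-≤ (≤-trans (size≤time d) s≤) (≤-trans (size≤time d′) t≤))) (+-mono-≤ s≤ t≤)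

caseL : ∀ {A B : Set} → List A → B → (A → List A → B) → B
caseL []       n c = n
caseL (x ∷ xs) n c = c x xs

caseE : ∀ {Γ a b f g h} → Ex Γ (list a) f → Ex Γ b g → Ex (a ∷ list a ∷ Γ) b h →
        Ex Γ b (λ ρ → caseL (f ρ) (g ρ) (λ x xs → h (x ∷ xs ∷ ρ)))
caseE {Γ} {a} {b} {f} {g} {h} (ex e p r) (ex e₁ p₁ r₁) (ex e₂ p₂ r₂) = ex (case′ e e₁ e₂) q λ ρ → branch ρ (f ρ) (r ρ)
  where
  q = K 1 ⊞ (p ⊞ (p₁ ⊞ (p₂ ⊚ (p ⊞ X))))
  branch : ∀ ρ us → (∃ λ s → ρ ⊢ e ⇓ us [ s ] × s ≤ ⟪ p ⟫ (esize ρ)) →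
           ∃ λ t → ρ ⊢ case′ e e₁ e₂ ⇓ caseL us (g ρ) (λ x xs → h (x ∷ xs ∷ ρ)) [ t ] × t ≤ ⟪ q ⟫ (esize ρ)
  branch ρ []       (s , d , s≤) = let t , d′ , t≤ = r₁ ρ in
    _ , ⇓case-nil d d′ , s≤s (+-mono-≤ s≤ (≤-trans t≤ (m≤m+n _ _)))
  branch ρ (x ∷ xs) (s , d , s≤) = let t , d′ , t≤ = r₂ (x ∷ xs ∷ ρ) in
    _ , ⇓case-cons d d′ , s≤s (+-mono-≤ s≤ (≤-trans t≤ (≤-trans (⟪⟫-mono p₂ small) (m≤n+m _ (⟪ p₁ ⟫ (esize ρ))))))
    where
    small : size a x + (size (list a) xs + esize ρ) ≤ ⟪ p ⟫ (esize ρ) + esize ρ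
    small = ≤-trans (≤-reflexive (sym (+-assoc (size a x) _ _)))
                    (+-monoˡ-≤ (esize ρ) (≤-trans (n≤1+n _) (≤-trans (size≤time d) s≤)))

loop : ∀ {A : Set} → (A → Bool) → (A → A) → ℕ → A → A
loop c b zero    u = u
loop c b (suc k) u = if c u then loop c b k (b u) else u

-- Few rounds alone would not give polynomial time: a body that squares a number doubles its length
-- in every round. Hence the bound `sp` on all intermediate states. The last hypothesis makes `loop`
-- with `k` rounds a terminated run and not one that is cut off.
whileE : ∀ {Γ a c b f} → Ex (a ∷ Γ) bool c → Ex (a ∷ Γ) a b → Ex Γ a f →
         (k : Env Γ → ℕ) (kp : Pol) → (∀ ρ → k ρ ≤ ⟪ kp ⟫ (esize ρ)) →
         (sp : Pol) → (∀ ρ i → i ≤ k ρ → size a (loop (λ u → c (u ∷ ρ)) (λ u → b (u ∷ ρ)) i (f ρ)) ≤ ⟪ sp ⟫ (esize ρ)) →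
         (∀ ρ → c (loop (λ u → c (u ∷ ρ)) (λ u → b (u ∷ ρ)) (k ρ) (f ρ) ∷ ρ) ≡ false) →
         Ex Γ a (λ ρ → loop (λ u → c (u ∷ ρ)) (λ u → b (u ∷ ρ)) (k ρ) (f ρ))
whileE {Γ} {a} {c} {b} {f} (ex ec pc rc) (ex eb pb rb) (ex ei pi ri) k kp k≤ sp s≤ stops =
  ex (while ec eb ei) (K 1 ⊞ (pi ⊞ ((K 1 ⊞ kp) ⊠ q))) λ ρ →
    let s , d , s≤′ = ri ρ ; t , w , t≤ = iterate ρ (k ρ) (f ρ) (s≤ ρ) (stops ρ) in
    _ , ⇓while d w , s≤s (+-mono-≤ s≤′ (≤-trans t≤ (*-monoˡ-≤ (⟪ q ⟫ (esize ρ)) (s≤s (k≤ ρ)))))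
  where
  q = K 1 ⊞ (pc ⊚ (sp ⊞ X) ⊞ pb ⊚ (sp ⊞ X))
  iterate : ∀ ρ k u → let L = λ i → loop (λ u → c (u ∷ ρ)) (λ u → b (u ∷ ρ)) i u in
            (∀ i → i ≤ k → size a (L i) ≤ ⟪ sp ⟫ (esize ρ)) → c (L k ∷ ρ) ≡ false →
            ∃ λ t → ρ ⊢while ec do′ eb from u ⇓ L k [ t ] × t ≤ suc k * ⟪ q ⟫ (esize ρ)
  charge : ∀ ρ {t} u → size a u ≤ ⟪ sp ⟫ (esize ρ) → t ≤ ⟪ pc ⟫ (esize (u ∷ ρ)) →
           t ≤ ⟪ pc ⟫ (⟪ sp ⟫ (esize ρ) + esize ρ)
  charge ρ u small t≤ = ≤-trans t≤ (⟪⟫-mono pc (+-monoˡ-≤ (esize ρ) small))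
  iterate ρ zero u small stop-k =
    let t , d , t≤ = rc (u ∷ ρ) in
    _ , stop (subst (λ x → _ ⊢ ec ⇓ x [ t ]) stop-k d) ,
    s≤s (≤-trans (charge ρ u (small 0 z≤n) t≤) (≤-trans (m≤m+n _ _) (m≤m+n _ 0)))
  iterate ρ (suc k) u small stop-k with c (u ∷ ρ) in eq | rc (u ∷ ρ)
  ... | false | t , d , t≤ =
    _ , stop d , s≤s (≤-trans (charge ρ u (small 0 z≤n) t≤) (≤-trans (m≤m+n _ _) (m≤m+n _ _)))
  ... | true  | t , d , t≤ =
    let t′ , d′ , t′≤ = rb (u ∷ ρ)
        t″ , w , t″≤  = iterate ρ k (b (u ∷ ρ)) (λ i i≤k → subst (λ x → size a (if x then loop (λ u → c (u ∷ ρ)) (λ u → b (u ∷ ρ)) i (b (u ∷ ρ)) else u) ≤ ⟪ sp ⟫ (esize ρ)) eq (small (suc i) (s≤s i≤k))) stop-k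
    in _ , step d d′ w , s≤s (+-mono-≤ (+-mono-≤ (charge ρ u (small 0 z≤n) t≤)
                                                 (≤-trans t′≤ (⟪⟫-mono pb (+-monoˡ-≤ (esize ρ) (small 0 z≤n))))) t″≤)

-- The invariant I is indexed by the number of elements already processed.
foldE : ∀ {Γ a s f i xs} → Ex (a ∷ s ∷ Γ) s f → Ex Γ s i → Ex Γ (list a) xs →
        (I : Env Γ → ℕ → ⟦ s ⟧ → Set) → (∀ ρ → I ρ 0 (i ρ)) →
        (∀ ρ k u x → x ∈ xs ρ → I ρ k u → I ρ (suc k) (f (x ∷ u ∷ ρ))) →
        (sp : Pol) → (∀ ρ k u → k ≤ length (xs ρ) → I ρ k u → size s u ≤ ⟪ sp ⟫ (esize ρ)) →
        Ex Γ s (λ ρ → foldl (λ u x → f (x ∷ u ∷ ρ)) (i ρ) (xs ρ))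
foldE {Γ} {a} {s} {f} {i} {xs} body init items I I-init I-step sp I-small =
  extE (λ ρ → cong proj₁ (loop-foldl ρ (xs ρ) (i ρ)))
    (fstE (whileE {a = s ⊗ list a} cond step′ (pairE init items) (length ∘ xs) (pol items)
       (λ ρ → ≤-trans (length≤size (xs ρ)) (size≤pol items ρ))
       (K 1 ⊞ (sp ⊞ pol items)) small
       (λ ρ → cong (λ st → nonempty (st ∷ ρ)) (loop-foldl ρ (xs ρ) (i ρ)))))
  where
  St = s ⊗ list a
  nonempty : Env (St ∷ Γ) → Bool
  nonempty = λ ρ → caseL (proj₂ (All.lookup ρ (here refl))) false (λ _ _ → true)
  cond : Ex (St ∷ Γ) bool nonempty
  cond = caseE (sndE v₀) falseE trueE
  next : Env (St ∷ Γ) → ⟦ St ⟧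
  next (st ∷ ρ) = caseL (proj₂ st) st (λ x ys → f (x ∷ proj₁ st ∷ ρ) , ys)
  π : Env (s ∷ a ∷ list a ∷ St ∷ Γ) → Env (a ∷ s ∷ Γ)
  π (u ∷ x ∷ ys ∷ st ∷ ρ) = x ∷ u ∷ ρ
  r : Ren (a ∷ s ∷ Γ) (s ∷ a ∷ list a ∷ St ∷ Γ)
  r (here p)          = there (here p)
  r (there (here p))  = here p
  r (there (there x)) = there (there (there (there x)))
  r-agree : ∀ σ → Agree r (π σ) σ
  r-agree (u ∷ x ∷ ys ∷ st ∷ ρ) (here refl)         = refl
  r-agree (u ∷ x ∷ ys ∷ st ∷ ρ) (there (here refl)) = refl
  r-agree (u ∷ x ∷ ys ∷ st ∷ ρ) (there (there y))   = refl
  r-small : ∀ σ → esize (π σ) ≤ esize σ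
  r-small (u ∷ x ∷ ys ∷ st ∷ ρ) = begin
    size a x + (size s u + esize ρ)          ≡⟨ swap (size a x) (size s u) (esize ρ) ⟩
    size s u + (size a x + esize ρ)          ≤⟨ +-monoʳ-≤ (size s u) (+-monoʳ-≤ (size a x)
                                                  (≤-trans (m≤n+m _ (size St st)) (m≤n+m _ (size (list a) ys)))) ⟩
    esize (u ∷ x ∷ ys ∷ st ∷ ρ)              ∎
    where
    open ≤-Reasoning
    swap : ∀ m n o → m + (n + o) ≡ n + (m + o)
    swap = solve-∀
  step′ : Ex (St ∷ Γ) St next
  step′ = extE (λ where (st ∷ ρ) → refl)
    (caseE (sndE v₀) v₀ (pairE (letE (fstE (varE (there (there (here refl))))) (renE r π r-agree r-small body)) v₁))
  L : ∀ ρ → ℕ → ⟦ St ⟧ → ⟦ St ⟧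
  L ρ = loop (λ st → nonempty (st ∷ ρ)) (λ st → next (st ∷ ρ))
  loop-foldl : ∀ ρ ys u → L ρ (length ys) (u , ys) ≡ (foldl (λ u x → f (x ∷ u ∷ ρ)) u ys , [])
  loop-foldl ρ []       u = refl
  loop-foldl ρ (y ∷ ys) u = loop-foldl ρ ys (f (y ∷ u ∷ ρ))
  invariant : ∀ ρ j k ys u → j ≤ length ys → (∀ {x} → x ∈ ys → x ∈ xs ρ) → I ρ k u → size (list a) ys ≤ size (list a) (xs ρ) →
              let u′ , ys′ = L ρ j (u , ys) in I ρ (j + k) u′ × size (list a) ys′ ≤ size (list a) (xs ρ)
  invariant ρ zero    k ys       u _ _  Iu sz = Iu , sz
  invariant ρ (suc j) k (y ∷ ys) u (s≤s j≤) ys⊆ Iu sz =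
    subst (λ z → I ρ z (L ρ j (f (y ∷ u ∷ ρ) , ys) .proj₁) × size (list a) (L ρ j (f (y ∷ u ∷ ρ) , ys) .proj₂) ≤ size (list a) (xs ρ)) (+-suc j k)
      (invariant ρ j (suc k) ys (f (y ∷ u ∷ ρ)) j≤ (ys⊆ ∘ there) (I-step ρ k u y (ys⊆ (here refl)) Iu)
        (≤-trans (≤-trans (m≤n+m _ (size a y)) (n≤1+n _)) sz))
  small : ∀ ρ j → j ≤ length (xs ρ) → size St (L ρ j (i ρ , xs ρ)) ≤ suc (⟪ sp ⟫ (esize ρ) + ⟪ pol items ⟫ (esize ρ))
  small ρ j j≤ with Iu , sz ← invariant ρ j 0 (xs ρ) (i ρ) j≤ (λ x∈ → x∈) (I-init ρ) ≤-refl =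
    s≤s (+-mono-≤ (I-small ρ (j + 0) _ (≤-trans (≤-reflexive (+-identityʳ j)) j≤) Iu) (≤-trans sz (size≤pol items ρ)))

-- A step that adds an amount independent of the state keeps it of polynomial size.
foldE⁺ : ∀ {Γ a s f i xs} → Ex (a ∷ s ∷ Γ) s f → Ex Γ s i → Ex Γ (list a) xs →
         (gp : Pol) → (∀ ρ u x → size s (f (x ∷ u ∷ ρ)) ≤ size s u + ⟪ gp ⟫ (size a x + esize ρ)) →
         Ex Γ s (λ ρ → foldl (λ u x → f (x ∷ u ∷ ρ)) (i ρ) (xs ρ))
foldE⁺ {Γ} {a} {s} {f} {i} {xs} body init items gp grow =
  foldE body init items
    (λ ρ k u → size s u ≤ size s (i ρ) + k * G ρ)
    (λ ρ → m≤m+n _ _)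
    (λ ρ k u x x∈ Iu → begin
      size s (f (x ∷ u ∷ ρ))                            ≤⟨ grow ρ u x ⟩
      size s u + ⟪ gp ⟫ (size a x + esize ρ)             ≤⟨ +-mono-≤ Iu (⟪⟫-mono gp (+-monoˡ-≤ (esize ρ)
                                                             (≤-trans (size-∈ x∈) (size≤pol items ρ)))) ⟩
      size s (i ρ) + k * G ρ + G ρ                       ≡⟨ assoc (size s (i ρ)) (k * G ρ) (G ρ) ⟩
      size s (i ρ) + suc k * G ρ                         ∎)
    (pol init ⊞ pol items ⊠ (gp ⊚ (pol items ⊞ X)))
    (λ ρ k u k≤ Iu → ≤-trans Iu (+-mono-≤ (size≤pol init ρ)
       (*-monoˡ-≤ (G ρ) (≤-trans k≤ (≤-trans (length≤size (xs ρ)) (size≤pol items ρ))))))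
  where
  open ≤-Reasoning
  G : Env Γ → ℕ
  G ρ = ⟪ gp ⟫ (⟪ pol items ⟫ (esize ρ) + esize ρ)
  assoc : ∀ x y z → x + y + z ≡ x + (z + y)
  assoc = solve-∀

∑ : ∀ {A : Set} → List A → (A → ℕ) → ℕ
∑ xs f = sum (map f xs)

maxi : ∀ {A : Set} → List A → (A → ℕ) → ℕ
maxi xs f = foldl (λ m x → if m ≤ᵇ f x then f x else m) 0 xs

-- The whole list is scanned and the last match wins. Which match is returned never matters, only
-- that one is returned if there is any.
select : ∀ {A : Set} → (A → Bool) → A → List A → A
select c = foldl (λ u x → if c x then x else u)

-- The default value is returned for a key that does not occur.
look : ∀ {A : Set} → A → List (ℕ × A) → ℕ → A
look d T i = proj₂ (select (λ x → proj₁ x ≡ᵇ i) (0 , d) T)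

idx : ∀ {A : Set} → ℕ → List A → List (ℕ × A)
idx k []       = []
idx k (x ∷ xs) = (k , x) ∷ idx (suc k) xs

notE : ∀ {Γ f} → Ex Γ bool f → Ex Γ bool (not ∘ f)
notE {f = f} e = extE (λ ρ → eq (f ρ)) (ifE e falseE trueE)
  where
  eq : ∀ b → (if b then false else true) ≡ not b
  eq true  = refl
  eq false = refl

andE orE xorE : ∀ {Γ f g} → Ex Γ bool f → Ex Γ bool g → Ex Γ bool _
andE {f = f} {g} e e′ = extE {g = λ ρ → f ρ ∧ g ρ} (λ ρ → eq (f ρ)) (ifE e e′ falseE)
  where
  eq : ∀ b {c} → (if b then c else false) ≡ b ∧ c
  eq true  = refl
  eq false = refl
orE {f = f} {g} e e′ = extE {g = λ ρ → f ρ ∨ g ρ} (λ ρ → eq (f ρ)) (ifE e trueE e′)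
  where
  eq : ∀ b {c} → (if b then true else c) ≡ b ∨ c
  eq true  = refl
  eq false = refl
xorE {f = f} {g} e e′ = extE {g = λ ρ → f ρ xor g ρ} (λ ρ → eq (f ρ)) (ifE e (notE e′) e′)
  where
  eq : ∀ b {c} → (if b then not c else c) ≡ b xor c
  eq true  = refl
  eq false = refl

≤ᵇ-∧-≡ᵇ : ∀ m n → (m ≤ᵇ n) ∧ (n ≤ᵇ m) ≡ (m ≡ᵇ n)
≤ᵇ-∧-≡ᵇ zero          zero          = refl
≤ᵇ-∧-≡ᵇ zero          (suc n)       = refl
≤ᵇ-∧-≡ᵇ (suc m)       zero          = refl
≤ᵇ-∧-≡ᵇ (suc zero)    (suc zero)    = refl
≤ᵇ-∧-≡ᵇ (suc zero)    (suc (suc n)) = refl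
≤ᵇ-∧-≡ᵇ (suc (suc m)) (suc zero)    = refl
≤ᵇ-∧-≡ᵇ (suc (suc m)) (suc (suc n)) = ≤ᵇ-∧-≡ᵇ (suc m) (suc n)

eqE : ∀ {Γ f g} → Ex Γ nat f → Ex Γ nat g → Ex Γ bool (λ ρ → f ρ ≡ᵇ g ρ)
eqE {f = f} {g} e e′ = extE (λ ρ → ≤ᵇ-∧-≡ᵇ (f ρ) (g ρ)) (andE (leqE e e′) (leqE e′ e))

if-size : ∀ {a} c {u v : ⟦ a ⟧} {m} → size a u ≤ m → size a v ≤ m → size a (if c then u else v) ≤ m
if-size true  u≤ v≤ = u≤
if-size false u≤ v≤ = v≤

ʳ++E : ∀ {Γ a f g} → Ex Γ (list a) f → Ex Γ (list a) g → Ex Γ (list a) (λ ρ → f ρ ʳ++ g ρ)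
ʳ++E {a = a} xs ys = foldE⁺ (consE v₀ v₁) ys xs (K 1 ⊞ X) λ ρ u x → begin
  suc (size a x + size (list a) u)                 ≡⟨ eq (size a x) _ ⟩
  size (list a) u + suc (size a x)                 ≤⟨ +-monoʳ-≤ (size (list a) u) (s≤s (m≤m+n _ _)) ⟩
  size (list a) u + suc (size a x + esize ρ)       ∎
  where
  open ≤-Reasoning
  eq : ∀ m n → suc (m + n) ≡ n + suc m
  eq = solve-∀

reverseE : ∀ {Γ a f} → Ex Γ (list a) f → Ex Γ (list a) (reverse ∘ f)
reverseE xs = ʳ++E xs nilE

++E : ∀ {Γ a f g} → Ex Γ (list a) f → Ex Γ (list a) g → Ex Γ (list a) (λ ρ → f ρ ++ g ρ)
++E {f = f} {g} xs ys = extE (λ ρ → trans (List.ʳ++-defn (reverse (f ρ))) (cong (_++ g ρ) (List.reverse-involutive (f ρ))))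
                             (ʳ++E (reverseE xs) ys)

selectE : ∀ {Γ a c d xs} → Ex (a ∷ Γ) bool c → Ex Γ a d → Ex Γ (list a) xs →
          Ex Γ a (λ ρ → select (λ x → c (x ∷ ρ)) (d ρ) (xs ρ))
selectE {a = a} {c} e d xs = foldE⁺ (ifE (wk₁ e) v₀ v₁) d xs X λ ρ u x →
  if-size (c (x ∷ ρ)) (≤-trans (m≤m+n _ (esize ρ)) (m≤n+m _ (size a u))) (m≤m+n _ _)

lookE : ∀ {Γ a d T i} → Ex Γ a d → Ex Γ (list (nat ⊗ a)) T → Ex Γ nat i →
        Ex Γ a (λ ρ → look (d ρ) (T ρ) (i ρ))
lookE d T i = sndE (selectE (eqE (fstE v₀) (wk i)) (pairE (litE 0) d) T)

foldl-concatMap : ∀ {A B : Set} (f : A → List B) xs ys →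
                  foldl (λ u x → u ++ f x) ys xs ≡ ys ++ concatMap f xs
foldl-concatMap f []       ys = sym (List.++-identityʳ ys)
foldl-concatMap f (x ∷ xs) ys = trans (foldl-concatMap f xs (ys ++ f x)) (List.++-assoc ys (f x) _)

concatMapE : ∀ {Γ a b f xs} → Ex (a ∷ Γ) (list b) f → Ex Γ (list a) xs →
             Ex Γ (list b) (λ ρ → concatMap (λ x → f (x ∷ ρ)) (xs ρ))
concatMapE {xs = xs} e es = extE (λ ρ → foldl-concatMap _ (xs ρ) [])
  (foldE⁺ (++E v₁ (wk₁ e)) nilE es (pol e) λ ρ u x → ≤-trans (size-++ u _) (+-monoʳ-≤ _ (size≤pol e (x ∷ ρ))))

mapE : ∀ {Γ a b f xs} → Ex (a ∷ Γ) b f → Ex Γ (list a) xs → Ex Γ (list b) (λ ρ → map (λ x → f (x ∷ ρ)) (xs ρ))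
mapE {f = f} {xs} e es = extE (λ ρ → eq (λ x → f (x ∷ ρ)) (xs ρ)) (concatMapE (consE e nilE) es)
  where
  eq : ∀ {A B : Set} (g : A → B) xs → concatMap (λ x → g x ∷ []) xs ≡ map g xs
  eq g []       = refl
  eq g (x ∷ xs) = cong (g x ∷_) (eq g xs)

sumE : ∀ {Γ a f xs} → Ex (a ∷ Γ) nat f → Ex Γ (list a) xs → Ex Γ nat (λ ρ → ∑ (xs ρ) (λ x → f (x ∷ ρ)))
sumE {f = f} {xs} e es = extE (λ ρ → eq (λ x → f (x ∷ ρ)) (xs ρ) 0)
  (foldE⁺ (opE plus v₁ (wk₁ e)) (litE 0) es (pol e) λ ρ u x →
    ≤-trans (size-op plus u _) (+-monoʳ-≤ (size nat u) (size≤pol e (x ∷ ρ))))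
  where
  eq : ∀ {A : Set} (g : A → ℕ) xs n → foldl (λ u x → u + g x) n xs ≡ n + ∑ xs g
  eq g []       n = sym (+-identityʳ n)
  eq g (x ∷ xs) n = trans (eq g xs (n + g x)) (+-assoc n (g x) _)

maxE : ∀ {Γ a f xs} → Ex (a ∷ Γ) nat f → Ex Γ (list a) xs → Ex Γ nat (λ ρ → maxi (xs ρ) (λ x → f (x ∷ ρ)))
maxE {f = f} e es = foldE⁺ (ifE (leqE v₁ (wk₁ e)) (wk₁ e) v₁) (litE 0) es (pol e) λ ρ u x →
  if-size {nat} (u ≤ᵇ f (x ∷ ρ)) (≤-trans (size≤pol e (x ∷ ρ)) (m≤n+m _ (size nat u))) (m≤m+n _ _)

-- The added entry contains the counter, which is part of the state, so growth per step is not
-- independent of the state as `foldE⁺` demands. The invariant ties the counter to the number of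
-- steps and thereby bounds each entry.
idxE : ∀ {Γ a xs} → Ex Γ (list a) xs → Ex Γ (list (nat ⊗ a)) (λ ρ → idx 0 (xs ρ))
idxE {Γ} {a} {xs} e = extE (λ ρ → trans (cong reverse (eq (xs ρ) 0 [])) (List.reverse-involutive (idx 0 (xs ρ))))
  (reverseE (sndE
    (foldE {s = nat ⊗ list (nat ⊗ a)} (pairE (opE plus (litE 1) (fstE v₁)) (consE (pairE (fstE v₁) v₀) (sndE v₁)))
       (pairE (litE 0) nilE) e
       (λ ρ k u → proj₁ u ≡ k × size _ (proj₂ u) ≤ 1 + k * (k + 3 + B ρ))
       (λ ρ → refl , ≤-refl)
       step′
       (K 3 ⊞ pol e ⊞ pol e ⊠ (pol e ⊞ K 3 ⊞ pol e))
       small)))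
  where
  open ≤-Reasoning
  B : Env Γ → ℕ
  B ρ = size (list a) (xs ρ)
  eq : ∀ ys k zs → proj₂ (foldl (λ u x → 1 + proj₁ u , (proj₁ u , x) ∷ proj₂ u) (k , zs) ys) ≡ idx k ys ʳ++ zs
  eq []       k zs = refl
  eq (y ∷ ys) k zs = eq ys (suc k) ((k , y) ∷ zs)
  arith : ∀ k b → suc (suc (suc k + b) + (1 + k * (suc k + 3 + b))) ≡ suc k * (suc k + 3 + b)
  arith = solve-∀
  step′ : ∀ ρ k (u : ⟦ nat ⊗ list (nat ⊗ a) ⟧) x → x ∈ xs ρ → proj₁ u ≡ k × size _ (proj₂ u) ≤ 1 + k * (k + 3 + B ρ) →
          1 + proj₁ u ≡ suc k × size (list (nat ⊗ a)) ((proj₁ u , x) ∷ proj₂ u) ≤ 1 + suc k * (suc k + 3 + B ρ)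
  step′ ρ k (.k , zs) x x∈ (refl , zs≤) = refl , (begin
    suc (suc (size nat k + size a x) + size _ zs)          ≤⟨ s≤s (+-mono-≤ (s≤s (+-mono-≤ (size-nat-≤ k) (size-∈ x∈)))
                                                               (≤-trans zs≤ (s≤s (*-monoʳ-≤ k (n≤1+n (k + 3 + B ρ)))))) ⟩
    suc (suc (suc k + B ρ) + (1 + k * (suc k + 3 + B ρ)))   ≡⟨ arith k (B ρ) ⟩
    suc k * (suc k + 3 + B ρ)                              ≤⟨ n≤1+n _ ⟩
    1 + suc k * (suc k + 3 + B ρ)                          ∎)
  small : ∀ ρ k u → k ≤ length (xs ρ) → proj₁ u ≡ k × size _ (proj₂ u) ≤ 1 + k * (k + 3 + B ρ) →
          size (nat ⊗ list (nat ⊗ a)) u ≤ ⟪ K 3 ⊞ pol e ⊞ pol e ⊠ (pol e ⊞ K 3 ⊞ pol e) ⟫ (esize ρ)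
  small ρ k (.k , zs) k≤ (refl , zs≤) = begin
    suc (size nat k + size _ zs)                    ≤⟨ s≤s (+-mono-≤ (size-nat-≤ k) zs≤) ⟩
    suc (suc k + (1 + k * (k + 3 + B ρ)))           ≤⟨ s≤s (+-mono-≤ (s≤s k≤P) (s≤s (*-mono-≤ k≤P (+-mono-≤ (+-monoˡ-≤ 3 k≤P) (size≤pol e ρ))))) ⟩
    suc (suc P + (1 + P * (P + 3 + P)))             ≡⟨ ar P (P * (P + 3 + P)) ⟩
    3 + P + P * (P + 3 + P)                         ∎
    where
    P = ⟪ pol e ⟫ (esize ρ)
    k≤P : k ≤ P
    k≤P = ≤-trans k≤ (≤-trans (length≤size (xs ρ)) (size≤pol e ρ))
    ar : ∀ p q → suc (suc p + (1 + q)) ≡ 3 + p + q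
    ar = solve-∀

-- Repeated halving, which produces the upper ends of the size classes.

levels : ℕ → ℕ → List ℕ
levels zero    x = []
levels (suc k) x = if 1 ≤ᵇ x then x ∷ levels k (x / 2) else []

halve : ℕ × List ℕ → ℕ × List ℕ
halve (x , acc) = x / 2 , x ∷ acc

halving : ℕ → ℕ × List ℕ → ℕ × List ℕ
halving = loop (λ u → 1 ≤ᵇ proj₁ u) halve

x/2<2^k : ∀ k x → x < 2 ^ suc k → x / 2 < 2 ^ k
x/2<2^k k x x< = m<n*o⇒m/o<n (subst (x <_) (*-comm 2 (2 ^ k)) x<)

x<2^size : ∀ x → x < 2 ^ size nat x
x<2^size x = ≤-trans (n≤2^⌈log₂n⌉ (suc x)) (^-monoʳ-≤ 2 (n≤1+n ⌈log₂ suc x ⌉))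

halving-levels : ∀ k x acc → proj₂ (halving k (x , acc)) ≡ levels k x ʳ++ acc
halving-levels zero    x acc = refl
halving-levels (suc k) x acc with 1 ≤ᵇ x
... | true  = halving-levels k (x / 2) (x ∷ acc)
... | false = refl

halving-stops : ∀ k x acc → x < 2 ^ k → (1 ≤ᵇ proj₁ (halving k (x , acc))) ≡ false
halving-stops zero    zero    acc x< = refl
halving-stops zero    (suc x) acc (s≤s ())
halving-stops (suc k) zero    acc x< = refl
halving-stops (suc k) (suc x) acc x< = halving-stops k (suc x / 2) (suc x ∷ acc) (x/2<2^k k (suc x) x<)

halving-small : ∀ k x acc → size nat (proj₁ (halving k (x , acc))) ≤ size nat x ×
                size (list nat) (proj₂ (halving k (x , acc))) ≤ size (list nat) acc + k * suc (size nat x)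
halving-small zero    x acc = ≤-refl , m≤m+n _ _
halving-small (suc k) zero acc = ≤-refl , m≤m+n _ _
halving-small (suc k) x@(suc _) acc =
  let h = size-nat-mono (m/n≤m x 2) ; s≤ , l≤ = halving-small k (x / 2) (x ∷ acc) in
  ≤-trans s≤ h , (begin
    _                                                              ≤⟨ l≤ ⟩
    suc (size nat x + size (list nat) acc) + k * suc (size nat (x / 2))   ≤⟨ +-monoʳ-≤ (suc (size nat x + size (list nat) acc)) (*-monoʳ-≤ k (s≤s h)) ⟩
    suc (size nat x + size (list nat) acc) + k * suc (size nat x)  ≡⟨ ar (size nat x) (size (list nat) acc) (k * suc (size nat x)) ⟩
    size (list nat) acc + suc k * suc (size nat x)                 ∎)
  where
  open ≤-Reasoning
  ar : ∀ x a m → suc (x + a) + m ≡ a + (suc x + m)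
  ar = solve-∀

-- A demand may be exponential in the input size, so the number of rounds is bounded by its bit
-- length and not by its value; by `x<2^size` the halving has reached 0 by then.
levelsE : ∀ {Γ f} → Ex Γ nat f → Ex Γ (list nat) (λ ρ → levels (size nat (f ρ)) (f ρ))
levelsE {Γ} {f} e = extE (λ ρ → trans (cong reverse (halving-levels (size nat (f ρ)) (f ρ) [])) (List.reverse-involutive (levels (size nat (f ρ)) (f ρ))))
  (reverseE (sndE (whileE {a = nat ⊗ list nat} (leqE (litE 1) (fstE v₀)) (pairE (opE quot (fstE v₀) (litE 2)) (consE (fstE v₀) (sndE v₀)))
     (pairE e nilE) (size nat ∘ f) (pol e) (size≤pol e) (K 1 ⊞ (pol e ⊞ (K 1 ⊞ pol e ⊠ (K 1 ⊞ pol e)))) small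
     (λ ρ → halving-stops (size nat (f ρ)) (f ρ) [] (x<2^size (f ρ))))))
  where
  small : ∀ ρ i → i ≤ size nat (f ρ) → size (nat ⊗ list nat) (halving i (f ρ , [])) ≤ _
  small ρ i i≤ =
    let s≤ , l≤ = halving-small i (f ρ) [] in
    s≤s (+-mono-≤ (≤-trans s≤ (size≤pol e ρ))
      (≤-trans l≤ (s≤s (*-mono-≤ (≤-trans i≤ (size≤pol e ρ)) (s≤s (size≤pol e ρ))))))

-- The balancing algorithm

-- A job, and true for its start or false for its end.
Event : Ty
Event = nat ⊗ bool

Label : Set
Label = ℕ × Bool

is : ℕ → ℕ → ℕ → Bool
is a b k = (k ≡ᵇ a) ∨ (k ≡ᵇ b)

-- The union step of union-find with parities. An event `(i , s)` has the value `parity of i xor s`,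
-- so the two events of a job are opposite whatever the parity. The component of `j` takes the name
-- of that of `i`, and its parities flip exactly if the two given events would otherwise have equal
-- values. If both already lie in one component with opposite values, nothing changes.
merge : (ℕ → Label) → ⟦ Event ⟧ → ⟦ Event ⟧ → Label → Label
merge lab (i , s) (j , t) (k , β) =
  if proj₁ (lab j) ≡ᵇ k
  then (proj₁ (lab i) , β xor not ((proj₂ (lab i) xor s) xor (proj₂ (lab j) xor t)))
  else (k , β)

label : List (ℕ × Label) → ℕ → Label
label = look (0 , false)

mergeT : ⟦ Event ⟧ → ⟦ Event ⟧ → List (ℕ × Label) → List (ℕ × Label)
mergeT p e L = map (λ z → proj₁ z , merge (label L) p e (proj₂ z)) L

passT : ℕ → ℕ → List (ℕ × ℕ) → List ⟦ Event ⟧ × List (ℕ × Label) → ⟦ Event ⟧ → List ⟦ Event ⟧ × List (ℕ × Label)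
passT a b C u e =
  if is a b (look 0 C (proj₁ e))
  then caseL (proj₁ u) (e ∷ [] , proj₂ u) (λ p _ → [] , mergeT p e (proj₂ u))
  else u

labelsT : ℕ → ℕ → List ⟦ Event ⟧ → List (ℕ × ℕ) → List (ℕ × Label)
labelsT a b h C = proj₂ (foldl (passT a b C) ([] , map (λ z → proj₁ z , (proj₁ z , false)) C) h)

splitT : ℕ → ℕ → List ⟦ Event ⟧ → List (ℕ × ℕ) → List (ℕ × ℕ)
splitT a b h C =
  map (λ z → proj₁ z ,
             (if is a b (proj₂ z)
              then (if proj₂ (label (labelsT a b h C) (proj₁ z)) then b else a)
              else proj₂ z)) C

-- The end of a job counts for all other colours instead of against its own; this
-- raises all counts alike and avoids subtraction.
hit : (ℕ → ℕ) → ℕ → ⟦ Event ⟧ → Bool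
hit col c (i , s) = if col i ≡ᵇ c then s else not s

bit : Bool → ℕ
bit b = if b then 1 else 0

hits : (ℕ → ℕ) → ℕ → List ⟦ Event ⟧ → ℕ
hits col c h = ∑ h (λ e → bit (hit col c e))

far : ℕ → ℕ → Bool
far m n = (2 + m ≤ᵇ n) ∨ (2 + n ≤ᵇ m)

-- The default is `a` itself: recolouring `a` with `a` changes nothing, so the step needs no case
-- for a history that is still balanced.
partner : List ℕ → (ℕ → ℕ) → List ⟦ Event ⟧ → ℕ → ℕ
partner pal col h a = select (λ c → far (hits col c h) (hits col a h)) a pal

-- All colours other than that of the event's job gain the same number of hits, so only pairs
-- involving this colour `a` can violate balance, and a single partner is looked for.
stepT : List ℕ → List ⟦ Event ⟧ × List (ℕ × ℕ) → ⟦ Event ⟧ → List ⟦ Event ⟧ × List (ℕ × ℕ)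
stepT pal u e = let h = reverse (e ∷ proj₁ u) ; a = look 0 (proj₂ u) (proj₁ e) in
  e ∷ proj₁ u , splitT a (partner pal (look 0 (proj₂ u)) h a) h (proj₂ u)

balanceT : List ℕ → List ⟦ Event ⟧ → List (ℕ × ℕ) → List (ℕ × ℕ)
balanceT pal E C = proj₂ (foldl (stepT pal) ([] , C) E)

-- The balancing algorithm as polynomial-time expressions.

isE : ∀ {Γ fa fb fk} → Ex Γ nat fa → Ex Γ nat fb → Ex Γ nat fk → Ex Γ bool (λ ρ → is (fa ρ) (fb ρ) (fk ρ))
isE a b k = orE (eqE k a) (eqE k b)

labelE : ∀ {Γ fL fi} → Ex Γ (list (nat ⊗ nat ⊗ bool)) fL → Ex Γ nat fi → Ex Γ (nat ⊗ bool) (λ ρ → label (fL ρ) (fi ρ))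
labelE L i = lookE (pairE (litE 0) falseE) L i

mergeTE : ∀ {Γ fp fe fL} → Ex Γ Event fp → Ex Γ Event fe → Ex Γ (list (nat ⊗ nat ⊗ bool)) fL →
          Ex Γ (list (nat ⊗ nat ⊗ bool)) (λ ρ → mergeT (fp ρ) (fe ρ) (fL ρ))
mergeTE p e L = mapE
  (pairE (fstE v₀)
    (ifE (eqE (fstE lj) (fstE (sndE v₀)))
         (pairE (fstE li) (xorE (sndE (sndE v₀)) (notE (xorE (xorE (sndE li) (sndE (wk p))) (xorE (sndE lj) (sndE (wk e)))))))
         (sndE v₀))) L
  where
  li = labelE (wk L) (fstE (wk p))
  lj = labelE (wk L) (fstE (wk e))

select-All : ∀ {A : Set} {P : A → Set} c {d : A} {xs} → P d → All P xs → P (select c d xs)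
select-All c pd []                   = pd
select-All c pd (_∷_ {x} px pxs) with c x
... | true  = select-All c px pxs
... | false = select-All c pd pxs

look-All : ∀ {A : Set} {P : A → Set} {d : A} {T} i → P d → All (λ z → P (proj₂ z)) T → P (look d T i)
look-All {P = P} i pd ps = select-All {P = λ z → P (proj₂ z)} (λ z → proj₁ z ≡ᵇ i) pd ps

-- Merging only copies names that are already in the table, so a common bound on all entries is
-- preserved. The total size is no such invariant, since a short name may be replaced by a long one
-- in many entries.
SmallLabels : ℕ → List (ℕ × Label) → Set
SmallLabels W L = All (λ z → size nat (proj₁ z) ≤ W × size nat (proj₁ (proj₂ z)) ≤ W) L × length L ≤ W

SmallColours : ℕ → List (ℕ × ℕ) → Set
SmallColours W C = All (λ z → size nat (proj₁ z) ≤ W × size nat (proj₂ z) ≤ W) C × length C ≤ W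

mergeT-small : ∀ {W L} p e → 1 ≤ W → SmallLabels W L → SmallLabels W (mergeT p e L)
mergeT-small {W} {L} p e 1≤W (all , len) =
  All.map⁺ (All.map (λ {z} → small z) all) , ≤-trans (≤-reflexive (List.length-map _ L)) len
  where
  small : ∀ z → size nat (proj₁ z) ≤ W × size nat (proj₁ (proj₂ z)) ≤ W →
          size nat (proj₁ z) ≤ W × size nat (proj₁ (merge (label L) p e (proj₂ z))) ≤ W
  small (i , k , β) (i≤ , k≤) with proj₁ (label L (proj₁ e)) ≡ᵇ k
  ... | true  = i≤ , look-All {P = λ l → size nat (proj₁ l) ≤ W} (proj₁ p) 1≤W (All.map proj₂ all)
  ... | false = i≤ , k≤

entries-small : ∀ {W} {C : List (ℕ × ℕ)} → size (list (nat ⊗ nat)) C ≤ W → SmallColours W C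
entries-small {W} {C} C≤ = All.tabulate small , ≤-trans (length≤size {nat ⊗ nat} C) C≤
  where
  small : ∀ {z} → z ∈ C → size nat (proj₁ z) ≤ W × size nat (proj₂ z) ≤ W
  small {i , c} z∈ = let z≤ = ≤-trans (size-∈ {nat ⊗ nat} z∈) C≤ in
    ≤-trans (≤-trans (m≤m+n _ _) (n≤1+n _)) z≤ , ≤-trans (≤-trans (m≤n+m _ (size nat i)) (n≤1+n _)) z≤

labelsTE : ∀ {Γ fa fb fh fC} → Ex Γ nat fa → Ex Γ nat fb → Ex Γ (list Event) fh → Ex Γ (list (nat ⊗ nat)) fC →
           Ex Γ (list (nat ⊗ nat ⊗ bool)) (λ ρ → labelsT (fa ρ) (fb ρ) (fh ρ) (fC ρ))
labelsTE {Γ} {fa} {fb} {fh} {fC} a b h C = sndE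
  (foldE {s = list Event ⊗ list (nat ⊗ nat ⊗ bool)}
    (ifE (isE (wk₂ a) (wk₂ b) (lookE (litE 0) (wk₂ C) (fstE v₀)))
         (caseE (fstE v₁) (pairE (consE v₀ nilE) (sndE v₁))
                (pairE nilE (mergeTE v₀ (varE (there (there (here refl)))) (sndE (varE (there (there (there (here refl)))))))))
         v₁)
    (pairE nilE (mapE (pairE (fstE v₀) (pairE (fstE v₀) falseE)) C))
    h
    Inv
    (λ ρ → let all , len = entries-small (C≤ ρ) in
           ([] , z≤n) , (All.map⁺ (All.map (λ p → proj₁ p , proj₁ p) all) , ≤-trans (≤-reflexive (List.length-map _ (fC ρ))) len))
    step′
    sp
    small)
  where
  W : Env Γ → ℕ
  W ρ = ⟪ pol h ⊞ pol C ⟫ (esize ρ)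
  sp = K 1 ⊞ ((K 1 ⊞ K 1 ⊠ (K 1 ⊞ (pol h ⊞ pol C))) ⊞
              (K 1 ⊞ (pol h ⊞ pol C) ⊠ (K 1 ⊞ (K 1 ⊞ ((pol h ⊞ pol C) ⊞ (K 1 ⊞ ((pol h ⊞ pol C) ⊞ K 1)))))))
  h≤ : ∀ ρ → size (list Event) (fh ρ) ≤ W ρ
  h≤ ρ = ≤-trans (size≤pol h ρ) (m≤m+n _ _)
  C≤ : ∀ ρ → size (list (nat ⊗ nat)) (fC ρ) ≤ W ρ
  C≤ ρ = ≤-trans (size≤pol C ρ) (m≤n+m _ (⟪ pol h ⟫ (esize ρ)))
  Inv : ∀ ρ → ℕ → List ⟦ Event ⟧ × List (ℕ × Label) → Set
  Inv ρ k u = (All (λ e → size Event e ≤ W ρ) (proj₁ u) × length (proj₁ u) ≤ 1) × SmallLabels (W ρ) (proj₂ u)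
  step′ : ∀ ρ k u x → x ∈ fh ρ → Inv ρ k u → Inv ρ (suc k) (passT (fa ρ) (fb ρ) (fC ρ) u x)
  step′ ρ k u x x∈ I with is (fa ρ) (fb ρ) (look 0 (fC ρ) (proj₁ x))
  ... | false = I
  step′ ρ k ([]      , L) x x∈ (_ , sl) | true = ((≤-trans (size-∈ x∈) (h≤ ρ) ∷ []) , ≤-refl) , sl
  step′ ρ k (p ∷ ps , L) x x∈ (_ , sl) | true =
    ([] , z≤n) , mergeT-small p x (≤-trans (1≤size (list Event) (fh ρ)) (h≤ ρ)) sl
  small : ∀ ρ k u → k ≤ length (fh ρ) → Inv ρ k u → size (list Event ⊗ list (nat ⊗ nat ⊗ bool)) u ≤ ⟪ sp ⟫ (esize ρ)
  small ρ k u _ ((ps , ps≤) , (all , len)) = s≤s (+-mono-≤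
    (≤-trans (size-All ps) (s≤s (*-monoˡ-≤ (suc (W ρ)) ps≤)))
    (≤-trans (size-All {a = nat ⊗ nat ⊗ bool} (All.map (λ p → s≤s (+-mono-≤ (proj₁ p) (s≤s (+-monoˡ-≤ 1 (proj₂ p))))) all)) (s≤s (*-monoˡ-≤ _ len))))

splitTE : ∀ {Γ fa fb fh fC} → Ex Γ nat fa → Ex Γ nat fb → Ex Γ (list Event) fh → Ex Γ (list (nat ⊗ nat)) fC →
          Ex Γ (list (nat ⊗ nat)) (λ ρ → splitT (fa ρ) (fb ρ) (fh ρ) (fC ρ))
splitTE a b h C = letE (labelsTE a b h C) (mapE
  (pairE (fstE v₀)
    (ifE (isE (wk₂ a) (wk₂ b) (sndE v₀)) (ifE (sndE (labelE v₁ (fstE v₀))) (wk₂ b) (wk₂ a)) (sndE v₀)))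
  (wk C))

hitsE : ∀ {Γ fC fc fh} → Ex Γ (list (nat ⊗ nat)) fC → Ex Γ nat fc → Ex Γ (list Event) fh →
        Ex Γ nat (λ ρ → hits (look 0 (fC ρ)) (fc ρ) (fh ρ))
hitsE C c h = sumE (ifE (ifE (eqE (lookE (litE 0) (wk C) (fstE v₀)) (wk c)) (sndE v₀) (notE (sndE v₀))) (litE 1) (litE 0)) h

farE : ∀ {Γ f g} → Ex Γ nat f → Ex Γ nat g → Ex Γ bool (λ ρ → far (f ρ) (g ρ))
farE m n = orE (leqE (opE plus (litE 2) m) n) (leqE (opE plus (litE 2) n) m)

partnerE : ∀ {Γ fp fC fh fa} → Ex Γ (list nat) fp → Ex Γ (list (nat ⊗ nat)) fC → Ex Γ (list Event) fh → Ex Γ nat fa →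
           Ex Γ nat (λ ρ → partner (fp ρ) (look 0 (fC ρ)) (fh ρ) (fa ρ))
partnerE pal C h a = selectE (farE (hitsE (wk C) v₀ (wk h)) (hitsE (wk C) (wk a) (wk h))) a pal

stepTE : ∀ {Γ fp} → Ex Γ (list nat) fp → Ex (Event ∷ (list Event ⊗ list (nat ⊗ nat)) ∷ Γ) (list Event ⊗ list (nat ⊗ nat))
         (λ ρ → stepT (fp (All.tail (All.tail ρ))) (All.lookup ρ (there (here refl))) (All.lookup ρ (here refl)))
stepTE pal = pairE H (splitTE a (partnerE (wk₂ pal) C h a) h C)
  where
  H = consE v₀ (fstE v₁)
  h = reverseE H
  C = sndE v₁
  a = lookE (litE 0) C (fstE v₀)

splitT-small : ∀ {W C} a b h → size nat a ≤ W → size nat b ≤ W → SmallColours W C → SmallColours W (splitT a b h C)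
splitT-small {W} {C} a b h a≤ b≤ (all , len) =
  All.map⁺ (All.map (λ {z} → small z) all) , ≤-trans (≤-reflexive (List.length-map _ C)) len
  where
  small : ∀ z → size nat (proj₁ z) ≤ W × size nat (proj₂ z) ≤ W → _
  small z (i≤ , c≤) = i≤ , if-size {nat} (is a b (proj₂ z)) (if-size {nat} (proj₂ (label (labelsT a b h C) (proj₁ z))) b≤ a≤) c≤

balanceTE : ∀ {Γ fp fE fC} → Ex Γ (list nat) fp → Ex Γ (list Event) fE → Ex Γ (list (nat ⊗ nat)) fC →
            Ex Γ (list (nat ⊗ nat)) (λ ρ → balanceT (fp ρ) (fE ρ) (fC ρ))
balanceTE {Γ} {fp} {fE} {fC} pal E C = sndE
  (foldE {s = list Event ⊗ list (nat ⊗ nat)} (stepTE pal) (pairE nilE C) E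
    Inv (λ ρ → (z≤n , []) , entries-small (C≤ ρ)) step′ sp small)
  where
  w = pol pal ⊞ pol E ⊞ pol C
  W : Env Γ → ℕ
  W ρ = ⟪ w ⟫ (esize ρ)
  sp = K 1 ⊞ ((K 1 ⊞ w ⊠ (K 1 ⊞ w)) ⊞ (K 1 ⊞ w ⊠ (K 1 ⊞ (K 1 ⊞ (w ⊞ w)))))
  pal≤ : ∀ ρ → size (list nat) (fp ρ) ≤ W ρ
  pal≤ ρ = ≤-trans (size≤pol pal ρ) (≤-trans (m≤m+n _ (⟪ pol E ⟫ (esize ρ))) (m≤m+n _ _))
  E≤ : ∀ ρ → size (list Event) (fE ρ) ≤ W ρ
  E≤ ρ = ≤-trans (size≤pol E ρ) (≤-trans (m≤n+m _ (⟪ pol pal ⟫ (esize ρ))) (m≤m+n _ _))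
  C≤ : ∀ ρ → size (list (nat ⊗ nat)) (fC ρ) ≤ W ρ
  C≤ ρ = ≤-trans (size≤pol C ρ) (m≤n+m _ _)
  Inv : ∀ ρ → ℕ → List ⟦ Event ⟧ × List (ℕ × ℕ) → Set
  Inv ρ k u = (length (proj₁ u) ≤ k × All (λ e → size Event e ≤ W ρ) (proj₁ u)) × SmallColours (W ρ) (proj₂ u)
  step′ : ∀ ρ k u x → x ∈ fE ρ → Inv ρ k u → Inv ρ (suc k) (stepT (fp ρ) u x)
  step′ ρ k (H , T) x x∈ ((len , all) , sc) =
    (s≤s len , ≤-trans (size-∈ x∈) (E≤ ρ) ∷ all) , splitT-small a b h a≤ b≤ sc
    where
    h = reverse (x ∷ H)
    a = look 0 T (proj₁ x)
    b = partner (fp ρ) (look 0 T) h a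
    a≤ : size nat a ≤ W ρ
    a≤ = look-All {P = λ c → size nat c ≤ W ρ} {T = T} (proj₁ x) (≤-trans (1≤size (list nat) (fp ρ)) (pal≤ ρ)) (All.map proj₂ (proj₁ sc))
    b≤ : size nat b ≤ W ρ
    b≤ = select-All {P = λ c → size nat c ≤ W ρ} _ {xs = fp ρ} a≤ (All.tabulate (λ c∈ → ≤-trans (size-∈ c∈) (pal≤ ρ)))
  small : ∀ ρ k u → k ≤ length (fE ρ) → Inv ρ k u → size (list Event ⊗ list (nat ⊗ nat)) u ≤ ⟪ sp ⟫ (esize ρ)
  small ρ k u k≤ ((len , all) , (all′ , len′)) = s≤s (+-mono-≤
    (≤-trans (size-All all) (s≤s (*-monoˡ-≤ (suc (W ρ)) (≤-trans len (≤-trans k≤ (≤-trans (length≤size (fE ρ)) (E≤ ρ)))))))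
    (≤-trans (size-All {a = nat ⊗ nat} (All.map (λ p → s≤s (+-mono-≤ (proj₁ p) (proj₂ p))) all′)) (s≤s (*-monoˡ-≤ _ len′))))

-- The algorithm

Jobs : Set
Jobs = List (ℕ × ℕ × ℕ × ℕ)

loadAt : ℕ → List (ℕ × ℕ × ℕ) → ℕ
loadAt e jobs = ∑ jobs (λ j → if (proj₁ (proj₂ j) ≤ᵇ e) ∧ (1 + e ≤ᵇ proj₂ (proj₂ j)) then proj₁ j else 0)

-- Division by 0 yields 0. Under the NBA this is the right value: jobs have positive demand, so an
-- edge of capacity 0 leaves no jobs at all.
ceil : ℕ → ℕ → ℕ
ceil l c = apply quot (l + (c ∸ 1)) c

lower : ⟦ Input ⟧ → ℕ
lower x = maxi (idx 0 (proj₁ x)) (λ ec → ceil (loadAt (proj₁ ec) (proj₂ x)) (proj₂ ec))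

-- The extra `0` makes the list one longer than the list of edges; its indices are the vertices.
vertices : List ℕ → List ℕ
vertices caps = map proj₁ (idx 0 (0 ∷ caps))

inClass : ℕ → ℕ → ℕ × ℕ × ℕ × ℕ → Bool
inClass lo hi j = (1 + lo ≤ᵇ proj₁ (proj₂ j)) ∧ (proj₁ (proj₂ j) ≤ᵇ hi)

eventsAt : ℕ → ℕ → Jobs → ℕ → List ⟦ Event ⟧
eventsAt lo hi js v =
  concatMap (λ j → if inClass lo hi j ∧ (proj₂ (proj₂ (proj₂ j)) ≡ᵇ v) then (proj₁ j , false) ∷ [] else []) js ++
  concatMap (λ j → if inClass lo hi j ∧ (proj₁ (proj₂ (proj₂ j)) ≡ᵇ v) then (proj₁ j , true) ∷ [] else []) js

classEvents : List ℕ → ℕ → ℕ → Jobs → List ⟦ Event ⟧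
classEvents vs lo hi js = concatMap (eventsAt lo hi js) vs

smallEvents : List ℕ → List ℕ → Jobs → List ⟦ Event ⟧
smallEvents vs xs js = concatMap (λ x → classEvents vs (x / 2) x js) xs

-- The colours below `R`, taken from the indices of a list so that the number of rounds is bounded
-- by a length. In the algorithm this list has length 8n, and the NBA gives r ≤ n, so no colour is
-- cut off.
palette : ∀ {A : Set} → List A → ℕ → List ℕ
palette fuel R = concatMap (λ c → if 1 + c ≤ᵇ R then c ∷ [] else []) (map proj₁ (idx 0 fuel))

double : ∀ {A : Set} → List A → List A
double xs = xs ++ xs

algorithm : ⟦ Input ⟧ → ⟦ Output ⟧
algorithm x =
  let caps  = proj₁ x ; jobs = proj₂ x ; js = idx 0 jobs
      D     = maxi jobs proj₁ ; q = D / 4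
      r     = lower x ; r₄ = 4 * r ; r₈ = 8 * r
      vs    = vertices caps
      fuel  = double (double (double jobs))
      start = map (λ j → proj₁ j , 0) js
      large = balanceT (palette fuel r₈) (classEvents vs q D js) start
      small = balanceT (palette fuel r₄) (smallEvents vs (levels (size nat q) q) js) start
  in r₈ + r₄ , map (λ j → if 1 + q ≤ᵇ proj₁ (proj₂ j) then look 0 large (proj₁ j) else r₈ + look 0 small (proj₁ j)) js

loadAtE : ∀ {Γ fe fj} → Ex Γ nat fe → Ex Γ (list (nat ⊗ nat ⊗ nat)) fj → Ex Γ nat (λ ρ → loadAt (fe ρ) (fj ρ))
loadAtE e jobs = sumE (ifE (andE (leqE (fstE (sndE v₀)) (wk e)) (leqE (opE plus (litE 1) (wk e)) (sndE (sndE v₀)))) (fstE v₀) (litE 0)) jobs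

ceilE : ∀ {Γ f g} → Ex Γ nat f → Ex Γ nat g → Ex Γ nat (λ ρ → ceil (f ρ) (g ρ))
ceilE l c = opE quot (opE plus l (opE monus c (litE 1))) c

classEventsE : ∀ {Γ fv fl fh fj} → Ex Γ (list nat) fv → Ex Γ nat fl → Ex Γ nat fh → Ex Γ (list (nat ⊗ nat ⊗ nat ⊗ nat)) fj →
               Ex Γ (list Event) (λ ρ → classEvents (fv ρ) (fl ρ) (fh ρ) (fj ρ))
classEventsE vs lo hi js = concatMapE
  (++E (concatMapE (ifE (andE inC (eqE (sndE (sndE (sndE v₀))) v₁)) (consE (pairE (fstE v₀) falseE) nilE) nilE) (wk js))
       (concatMapE (ifE (andE inC (eqE (fstE (sndE (sndE v₀))) v₁)) (consE (pairE (fstE v₀) trueE) nilE) nilE) (wk js))) vs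
  where
  inC = andE (leqE (opE plus (litE 1) (wk₂ lo)) (fstE (sndE v₀))) (leqE (fstE (sndE v₀)) (wk₂ hi))

paletteE : ∀ {Γ a ff fR} → Ex Γ (list a) ff → Ex Γ nat fR → Ex Γ (list nat) (λ ρ → palette (ff ρ) (fR ρ))
paletteE fuel R = concatMapE (ifE (leqE (opE plus (litE 1) v₀) (wk R)) (consE v₀ nilE) nilE) (mapE (fstE v₀) (idxE fuel))

algorithmE : Ex (Input ∷ []) Output (λ ρ → algorithm (All.lookup ρ (here refl)))
algorithmE = pairE (opE plus r₈ r₄)
  (mapE (ifE (leqE (opE plus (litE 1) (wk q)) (fstE (sndE v₀)))
             (lookE (litE 0) (wk large) (fstE v₀))
             (opE plus (wk r₈) (lookE (litE 0) (wk small) (fstE v₀)))) js)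
  where
  caps = fstE v₀
  jobs = sndE v₀
  js   = idxE jobs
  D    = maxE (fstE v₀) jobs
  q    = opE quot D (litE 4)
  r    = maxE (ceilE (loadAtE (fstE v₀) (wk jobs)) (sndE v₀)) (idxE caps)
  r₄   = opE times (litE 4) r
  r₈   = opE times (litE 8) r
  vs   = mapE (fstE v₀) (idxE (consE (litE 0) caps))
  fuel = let d = ++E jobs jobs ; d′ = ++E d d in ++E d′ d′
  start = mapE (pairE (fstE v₀) (litE 0)) js
  large = balanceTE (paletteE fuel r₈) (classEventsE vs q D js) start
  small = balanceTE (paletteE fuel r₄)
    (concatMapE (classEventsE (wk vs) (opE quot v₀ (litE 2)) v₀ (wk js)) (levelsE q)) start

-- Correctness of the balancing algorithm

≡ᵇ-view : ∀ m n → (m ≡ n × (m ≡ᵇ n) ≡ true) ⊎ (m ≢ n × (m ≡ᵇ n) ≡ false)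
≡ᵇ-view m n with m ≡ᵇ n in eq
... | true  = inj₁ (≡ᵇ⇒≡ m n (subst T (sym eq) _) , refl)
... | false = inj₂ ((λ m≡n → subst T eq (≡⇒≡ᵇ m n m≡n)) , refl)

≡ᵇ-refl : ∀ n → (n ≡ᵇ n) ≡ true
≡ᵇ-refl n with ≡ᵇ-view n n
... | inj₁ (_ , eq)  = eq
... | inj₂ (n≢n , _) = contradiction refl n≢n

≢⇒≡ᵇ : ∀ {m n} → m ≢ n → (m ≡ᵇ n) ≡ false
≢⇒≡ᵇ {m} {n} m≢n with ≡ᵇ-view m n
... | inj₁ (m≡n , _) = contradiction m≡n m≢n
... | inj₂ (_ , eq)  = eq

is-true : ∀ a b k → is a b k ≡ true → k ≡ a ⊎ k ≡ b
is-true a b k eq with ≡ᵇ-view k a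
... | inj₁ (k≡a , _) = inj₁ k≡a
... | inj₂ (_ , e) rewrite e with ≡ᵇ-view k b
...   | inj₁ (k≡b , _) = inj₂ k≡b
...   | inj₂ (_ , e′) rewrite e′ with () ← eq

is-false : ∀ a b k → is a b k ≡ false → k ≢ a × k ≢ b
is-false a b k eq with ≡ᵇ-view k a
... | inj₁ (_ , e) rewrite e with () ← eq
is-false a b k eq | inj₂ (k≢a , e) rewrite e with ≡ᵇ-view k b
...   | inj₁ (_ , e′) rewrite e′ with () ← eq
is-false a b k eq | inj₂ (k≢a , e) | inj₂ (k≢b , _) = k≢a , k≢b

∑-++ : ∀ {A : Set} (xs ys : List A) f → ∑ (xs ++ ys) f ≡ ∑ xs f + ∑ ys f
∑-++ xs ys f = trans (cong sum (List.map-++ f xs ys)) (sum-++ (map f xs) (map f ys))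

-- Correctness is argued about colourings and labellings as functions on all numbers; the tables of
-- the program are their restrictions to the job indices.
tab : ∀ {A : Set} → List ℕ → (ℕ → A) → List (ℕ × A)
tab ids f = map (λ i → i , f i) ids

look-tab : ∀ {A : Set} (d : A) ids f {i} → i ∈ ids → look d (tab ids f) i ≡ f i
look-tab d ids f {i} i∈ = go ids (0 , d) (inj₂ i∈)
  where
  go : ∀ ids u → proj₂ u ≡ f i ⊎ i ∈ ids → proj₂ (select (λ x → proj₁ x ≡ᵇ i) u (tab ids f)) ≡ f i
  go []        u (inj₁ eq) = eq
  go (j ∷ ids) u h with ≡ᵇ-view j i
  ... | inj₁ (refl , e) rewrite e = go ids (j , f j) (inj₁ refl)
  ... | inj₂ (j≢i , e) rewrite e with h
  ...   | inj₁ eq          = go ids u (inj₁ eq)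
  ...   | inj₂ (here i≡j)  = contradiction (sym i≡j) j≢i
  ...   | inj₂ (there i∈′) = go ids u (inj₂ i∈′)

-- A label is a component together with a value relative to it.  The invariant of
-- the pairing is that unpaired events of the same component have opposite values;
-- in particular there are at most two of them.

Opposite Joined : Label → Label → Set
Opposite (k , v) (k′ , v′) = k ≡ k′ → v ≡ not v′
Joined   (k , v) (k′ , v′) = k ≡ k′ × v ≡ not v′

-- `merge` as it acts on the labels of events, where parity and sign are fused into one value;
-- `signed-merged` states the correspondence.
join : Label → Label → Label → Label
join (kp , vp) (ke , ve) (k , v) = if ke ≡ᵇ k then (kp , v xor not (vp xor ve)) else (k , v)

not-xor : ∀ u v d → u ≡ not v → u xor d ≡ not (v xor d)
not-xor _ true  true  refl = refl
not-xor _ true  false refl = refl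
not-xor _ false true  refl = refl
not-xor _ false false refl = refl

-- Here x shares the component of e, and y that of p. After the flip e is opposite to p, hence equal
-- to y; and x, opposite to e, is opposite to y.
join-left : ∀ vx vy vp ve → ve ≡ not vx → vp ≡ not vy → vx xor not (vp xor ve) ≡ not vy
join-left true  true  _ _ refl refl = refl
join-left true  false _ _ refl refl = refl
join-left false true  _ _ refl refl = refl
join-left false false _ _ refl refl = refl

join-right : ∀ vx vy vp ve → vp ≡ not vx → ve ≡ not vy → vx ≡ not (vy xor not (vp xor ve))
join-right true  true  _ _ refl refl = refl
join-right true  false _ _ refl refl = refl
join-right false true  _ _ refl refl = refl
join-right false false _ _ refl refl = refl

join-new : ∀ vp ve → vp ≡ not (ve xor not (vp xor ve))
join-new true  true  = refl
join-new true  false = refl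
join-new false true  = refl
join-new false false = refl

-- Pairing p with e removes one loose end from each of two paths and links the paths. The remaining
-- ends x and y become the ends of the new path; if both lie in the component of e, they flip
-- together.
join-opposite : ∀ p e x y → Opposite p x → Opposite p y → Opposite e x → Opposite e y → Opposite x y →
                Opposite (join p e x) (join p e y)
join-opposite (kp , vp) (ke , ve) (kx , vx) (ky , vy) px py qx qy xy with ≡ᵇ-view ke kx | ≡ᵇ-view ke ky
... | inj₁ (refl , e₁) | inj₁ (refl , e₂) rewrite e₁ = λ _ → not-xor vx vy _ (xy refl)
... | inj₁ (refl , e₁) | inj₂ (_ , e₂) rewrite e₁ | e₂ = λ kp≡ky → join-left vx vy vp ve (qx refl) (py kp≡ky)
... | inj₂ (_ , e₁) | inj₁ (refl , e₂) rewrite e₁ | e₂ = λ kx≡kp → join-right vx vy vp ve (px (sym kx≡kp)) (qy refl)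
... | inj₂ (_ , e₁) | inj₂ (_ , e₂) rewrite e₁ | e₂ = xy

join-joined : ∀ p e x y → Joined x y → Joined (join p e x) (join p e y)
join-joined (kp , vp) (ke , ve) (k , vx) (.k , vy) (refl , eq) with ke ≡ᵇ k
... | true  = refl , not-xor vx vy _ eq
... | false = refl , eq

join-joins : ∀ p e → Opposite p e → Joined (join p e p) (join p e e)
join-joins (kp , vp) (ke , ve) pe rewrite ≡ᵇ-refl ke with ≡ᵇ-view ke kp
... | inj₁ (refl , eq) rewrite eq = refl , not-xor vp ve _ (pe refl)
... | inj₂ (_ , eq) rewrite eq = refl , join-new vp ve

signed : (ℕ → Label) → ⟦ Event ⟧ → Label
signed lab (i , s) = proj₁ (lab i) , proj₂ (lab i) xor s

merged : (ℕ → Label) → ⟦ Event ⟧ → ⟦ Event ⟧ → ℕ → Label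
merged lab p e i = merge lab p e (lab i)

xor-swap : ∀ u v w → (u xor v) xor w ≡ (u xor w) xor v
xor-swap true  true  true  = refl
xor-swap true  true  false = refl
xor-swap true  false true  = refl
xor-swap true  false false = refl
xor-swap false true  true  = refl
xor-swap false true  false = refl
xor-swap false false true  = refl
xor-swap false false false = refl

signed-merged : ∀ lab p e x → signed (merged lab p e) x ≡ join (signed lab p) (signed lab e) (signed lab x)
signed-merged lab p e x with proj₁ (lab (proj₁ e)) ≡ᵇ proj₁ (lab (proj₁ x))
... | true  = cong (_ ,_) (xor-swap (proj₂ (lab (proj₁ x))) _ (proj₂ x))
... | false = refl

Opp Rel : (ℕ → Label) → ⟦ Event ⟧ → ⟦ Event ⟧ → Set
Opp lab x y = Opposite (signed lab x) (signed lab y)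
Rel lab x y = Joined (signed lab x) (signed lab y)

merged-opp : ∀ lab p e {xs} → All (Opp lab p) xs → All (Opp lab e) xs → AllPairs (Opp lab) xs →
             AllPairs (Opp (merged lab p e)) xs
merged-opp lab p e []         []         []         = []
merged-opp lab p e (px ∷ pxs) (qx ∷ qxs) (xs ∷ rest) =
  All.zipWith (λ { (xy , py , qy) → subst₂ Opposite (sym (signed-merged lab p e _)) (sym (signed-merged lab p e _))
                                     (join-opposite _ _ _ _ px py qx qy xy) })
              (xs , All.zip (pxs , qxs))
  ∷ merged-opp lab p e pxs qxs rest

merged-rel : ∀ lab p e x y → Rel lab x y → Rel (merged lab p e) x y
merged-rel lab p e x y r = subst₂ Joined (sym (signed-merged lab p e x)) (sym (signed-merged lab p e y)) (join-joined (signed lab p) (signed lab e) _ _ r)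

merged-new : ∀ lab p e → Opp lab p e → Rel (merged lab p e) p e
merged-new lab p e o = subst₂ Joined (sym (signed-merged lab p e p)) (sym (signed-merged lab p e e)) (join-joins _ _ o)

-- The pairing pass over the history.

pass : (⟦ Event ⟧ → Bool) → (ℕ → Label) → List ⟦ Event ⟧ → List ⟦ Event ⟧ → ℕ → Label
pass ab lab pend []      = lab
pass ab lab pend (e ∷ h) =
  if ab e then caseL pend (pass ab lab (e ∷ []) h) (λ p _ → pass ab (merged lab p e) [] h)
          else pass ab lab pend h

-- The first list holds the event that waits for a partner, if any.
data Paired (ab v : ⟦ Event ⟧ → Bool) : List ⟦ Event ⟧ → List ⟦ Event ⟧ → Set where
  done  : ∀ {ps} → Paired ab v ps []
  skip  : ∀ {ps e h} → ab e ≡ false → Paired ab v ps h → Paired ab v ps (e ∷ h)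
  open′ : ∀ {e h} → ab e ≡ true → Paired ab v (e ∷ []) h → Paired ab v [] (e ∷ h)
  close : ∀ {p e h} → ab e ≡ true → v p ≡ not (v e) → Paired ab v [] h → Paired ab v (p ∷ []) (e ∷ h)

value : (ℕ → Label) → ⟦ Event ⟧ → Bool
value lab x = proj₂ (signed lab x)

-- Pairs have to be opposite under the final labelling, whereas each is made under an intermediate
-- one. The second component bridges this: events once joined as opposites stay so.
Good : (⟦ Event ⟧ → Bool) → (ℕ → Label) → List ⟦ Event ⟧ → List ⟦ Event ⟧ → Set
Good ab lab ps h = let lab′ = pass ab lab ps h in
  Paired ab (value lab′) ps h × (∀ x y → Rel lab x y → Rel lab′ x y)

pass-good  : ∀ ab lab h → AllPairs (Opp lab) h → Good ab lab [] h
pass-good₁ : ∀ ab lab p h → AllPairs (Opp lab) (p ∷ h) → Good ab lab (p ∷ []) h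

pass-good ab lab []      _ = done , λ _ _ r → r
pass-good ab lab (e ∷ h) o with ab e in eq
... | true  = let P , R = pass-good₁ ab lab e h o in open′ eq P , R
... | false = let P , R = pass-good ab lab h (AllPairs.tail o) in skip eq P , R

pass-good₁ ab lab p []      _ = done , λ _ _ r → r
pass-good₁ ab lab p (e ∷ h) ((pe ∷ ph) ∷ eh ∷ hh) with ab e in eq
-- This merge joins `p` and `e`, and `R` carries the relation to the end of the pass.
... | true  = let P , R = pass-good ab (merged lab p e) h (merged-opp lab p e ph eh hh) in
              close eq (proj₂ (R p e (merged-new lab p e pe))) P , λ x y r → R x y (merged-rel lab p e x y r)
... | false = let P , R = pass-good₁ ab lab p h (ph ∷ hh) in skip eq P , R

Keys : List ℕ → List ⟦ Event ⟧ → Set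
Keys ids = All (λ e → proj₁ e ∈ ids)

mergeT-tab : ∀ ids lab p e → proj₁ p ∈ ids → proj₁ e ∈ ids → mergeT p e (tab ids lab) ≡ tab ids (merged lab p e)
mergeT-tab ids lab p e p∈ e∈ rewrite look-tab (0 , false) ids lab p∈ | look-tab (0 , false) ids lab e∈ =
  sym (List.map-∘ ids)

passT-tab : ∀ ids col lab a b ps h → Keys ids ps → Keys ids h →
            proj₂ (foldl (passT a b (tab ids col)) (ps , tab ids lab) h) ≡
            tab ids (pass (λ e → is a b (col (proj₁ e))) lab ps h)
passT-tab ids col lab a b ps []      _  _  = refl
passT-tab ids col lab a b ps (e ∷ h) kp (e∈ ∷ kh)
  rewrite look-tab 0 ids col e∈ with is a b (col (proj₁ e))
passT-tab ids col lab a b ps       (e ∷ h) kp        (e∈ ∷ kh) | false = passT-tab ids col lab a b ps h kp kh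
passT-tab ids col lab a b []       (e ∷ h) kp        (e∈ ∷ kh) | true  = passT-tab ids col lab a b (e ∷ []) h (e∈ ∷ []) kh
passT-tab ids col lab a b (p ∷ ps) (e ∷ h) (p∈ ∷ _) (e∈ ∷ kh) | true
  rewrite mergeT-tab ids lab p e p∈ e∈ = passT-tab ids col (merged lab p e) a b [] h [] kh

-- Each job is a component of its own, so the matching of starts with ends is built in, and
-- `Opp fresh` unfolds to the relation used in `Distinct`.
fresh : ℕ → Label
fresh i = i , false

recolour : ℕ → ℕ → (ℕ → ℕ) → (ℕ → Label) → ℕ → ℕ
recolour a b col lab i = if is a b (col i) then (if proj₂ (lab i) then b else a) else col i

split : ℕ → ℕ → List ⟦ Event ⟧ → (ℕ → ℕ) → ℕ → ℕ
split a b h col = recolour a b col (pass (λ e → is a b (col (proj₁ e))) fresh [] h)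

splitT-tab : ∀ ids col a b h → Keys ids h → splitT a b h (tab ids col) ≡ tab ids (split a b h col)
splitT-tab ids col a b h kh = trans (sym (List.map-∘ ids)) (map-∈ ids λ {i} i∈ → cong (λ z → i , (if is a b (col i) then (if proj₂ z then b else a) else col i)) (begin
  label (labelsT a b h (tab ids col)) i    ≡⟨ cong (λ L → label (proj₂ (foldl (passT a b (tab ids col)) ([] , L) h)) i) (sym (List.map-∘ ids)) ⟩
  label (proj₂ (foldl (passT a b (tab ids col)) ([] , tab ids fresh) h)) i
                                           ≡⟨ cong (λ L → label L i) (passT-tab ids col fresh a b [] h [] kh) ⟩
  label (tab ids final) i                  ≡⟨ look-tab _ ids final i∈ ⟩
  final i                                  ∎))
  where
  open ≡-Reasoning
  final = pass (λ e → is a b (col (proj₁ e))) fresh [] h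
  map-∈ : ∀ {A B : Set} {f g : A → B} xs → (∀ {x} → x ∈ xs → f x ≡ g x) → map f xs ≡ map g xs
  map-∈ []       eq = refl
  map-∈ (x ∷ xs) eq = cong₂ _∷_ (eq (here refl)) (map-∈ xs (eq ∘ there))

-- Counts of the two colours after recolouring.

bit≤1 : ∀ b → bit b ≤ 1
bit≤1 true  = ≤-refl
bit≤1 false = z≤n

bit-+-not : ∀ b → bit b + bit (not b) ≡ 1
bit-+-not true  = refl
bit-+-not false = refl

-- The events of a complete pair contribute one hit to each side, and an unselected event
-- contributes the same to both. Only the pair cut by the end of the prefix is left over, which
-- costs the 1. An event in `ps` waits for its partner and is counted in advance.
paired-balance : ∀ {ab v f g : ⟦ Event ⟧ → Bool} →
                 (∀ e → ab e ≡ true → f e ≡ v e × g e ≡ not (v e)) → (∀ e → ab e ≡ false → f e ≡ g e) →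
                 ∀ {ps h} → length ps ≤ 1 → Paired ab v ps h → ∀ n →
                 ∑ ps (bit ∘ v) + ∑ (take n h) (bit ∘ f) ≤ suc (∑ ps (bit ∘ not ∘ v) + ∑ (take n h) (bit ∘ g))
paired-balance {ab} {v} {f} {g} sel unsel = go
  where
  open ≤-Reasoning
  swap : ∀ x d y → x + (d + y) ≡ d + (x + y)
  swap = solve-∀
  short : ∀ ps → length ps ≤ 1 → ∑ ps (bit ∘ v) + 0 ≤ suc (∑ ps (bit ∘ not ∘ v) + 0)
  short []          _        = z≤n
  short (p ∷ [])    _        = ≤-trans (≤-reflexive (trans (+-identityʳ _) (+-identityʳ _))) (≤-trans (bit≤1 (v p)) (s≤s z≤n))
  short (_ ∷ _ ∷ _) (s≤s ())
  go : ∀ {ps h} → length ps ≤ 1 → Paired ab v ps h → ∀ n →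
       ∑ ps (bit ∘ v) + ∑ (take n h) (bit ∘ f) ≤ suc (∑ ps (bit ∘ not ∘ v) + ∑ (take n h) (bit ∘ g))
  go {ps} l _    zero    = short ps l
  go {ps} l done (suc n) = short ps l
  go {ps} {e ∷ h} l (skip eq P) (suc n) rewrite unsel e eq = begin
    ∑ ps (bit ∘ v) + (bit (g e) + ∑ (take n h) (bit ∘ f))              ≡⟨ swap (∑ ps (bit ∘ v)) (bit (g e)) _ ⟩
    bit (g e) + (∑ ps (bit ∘ v) + ∑ (take n h) (bit ∘ f))              ≤⟨ +-monoʳ-≤ (bit (g e)) (go l P n) ⟩
    bit (g e) + suc (∑ ps (bit ∘ not ∘ v) + ∑ (take n h) (bit ∘ g))    ≡⟨ +-suc (bit (g e)) _ ⟩
    suc (bit (g e) + (∑ ps (bit ∘ not ∘ v) + ∑ (take n h) (bit ∘ g)))  ≡⟨ cong suc (swap (bit (g e)) (∑ ps (bit ∘ not ∘ v)) _) ⟩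
    suc (∑ ps (bit ∘ not ∘ v) + (bit (g e) + ∑ (take n h) (bit ∘ g)))  ∎
  go {_} {e ∷ h} l (open′ eq P) (suc n) with go (s≤s z≤n) P n
  ... | ih rewrite proj₁ (sel e eq) | proj₂ (sel e eq) | +-identityʳ (bit (v e)) | +-identityʳ (bit (not (v e))) = ih
  go {p ∷ []} {e ∷ h} l (close eq vp P) (suc n)
    rewrite vp | proj₁ (sel e eq) | proj₂ (sel e eq) with v e
  ... | true  = s≤s (go z≤n P n)
  ... | false = s≤s (go z≤n P n)

paired-not : ∀ {ab v ps h} → Paired ab v ps h → Paired ab (not ∘ v) ps h
paired-not done            = done
paired-not (skip eq P)     = skip eq (paired-not P)
paired-not (open′ eq P)    = open′ eq (paired-not P)
paired-not (close eq vp P) = close eq (cong not vp) (paired-not P)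

hits-cong : ∀ col col′ c c′ h → (∀ e → hit col c e ≡ hit col′ c′ e) → hits col c h ≡ hits col′ c′ h
hits-cong col col′ c c′ h eq = cong sum (List.map-cong (λ e → cong bit (eq e)) h)

hit-= : ∀ {col c i s} → col i ≡ c → hit col c (i , s) ≡ s
hit-= {col} {c} {i} refl rewrite ≡ᵇ-refl (col i) = refl

hit-≢ : ∀ {col c i s} → col i ≢ c → hit col c (i , s) ≡ not s
hit-≢ col≢c rewrite ≢⇒≡ᵇ col≢c = refl

module Recolour (a b : ℕ) (a≢b : a ≢ b) (col : ℕ → ℕ) (lab : ℕ → Label) where

  col′ : ℕ → ℕ
  col′ = recolour a b col lab

  ab : ⟦ Event ⟧ → Bool
  ab e = is a b (col (proj₁ e))

  -- Parity `false` means colour `a` and parity `true` colour `b`, so whether an event hits `a` is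
  -- its sign xor the parity, which is its value.
  hit-a : ∀ e → ab e ≡ true → hit col′ a e ≡ value lab e
  hit-a (i , s) eq rewrite eq with proj₂ (lab i)
  ... | true  rewrite ≢⇒≡ᵇ (a≢b ∘ sym) = refl
  ... | false rewrite ≡ᵇ-refl a = refl

  hit-b : ∀ e → ab e ≡ true → hit col′ b e ≡ not (value lab e)
  hit-b (i , s) eq rewrite eq with proj₂ (lab i)
  ... | true  rewrite ≡ᵇ-refl b = sym (Bool.not-involutive s)
  ... | false rewrite ≢⇒≡ᵇ a≢b = refl

  hit-unselected : ∀ e → ab e ≡ false → hit col′ a e ≡ hit col′ b e
  hit-unselected (i , s) eq rewrite eq =
    let ≢a , ≢b = is-false a b (col i) eq in trans (hit-≢ {col} ≢a) (sym (hit-≢ {col} ≢b))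

  hit-other : ∀ {c} → c ≢ a → c ≢ b → ∀ e → hit col′ c e ≡ hit col c e
  hit-other c≢a c≢b (i , s) with is a b (col i) in eq
  ... | false = refl
  ... | true with is-true a b (col i) eq | proj₂ (lab i)
  ...   | inj₁ ca | true  rewrite ca | ≢⇒≡ᵇ (c≢a ∘ sym) | ≢⇒≡ᵇ (c≢b ∘ sym) = refl
  ...   | inj₁ ca | false rewrite ca = refl
  ...   | inj₂ cb | true  rewrite cb = refl
  ...   | inj₂ cb | false rewrite cb | ≢⇒≡ᵇ (c≢a ∘ sym) | ≢⇒≡ᵇ (c≢b ∘ sym) = refl

  -- An event of a job coloured `a` or `b` hits exactly one of the two, before and after the
  -- exchange.
  hit-sum : ∀ e → bit (hit col′ a e) + bit (hit col′ b e) ≡ bit (hit col a e) + bit (hit col b e)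
  hit-sum e@(i , s) = by (ab e) refl
    where
    by : ∀ x → ab e ≡ x → bit (hit col′ a e) + bit (hit col′ b e) ≡ bit (hit col a e) + bit (hit col b e)
    by true  eq with is-true a b (col i) eq
    ... | inj₁ ca rewrite hit-a e eq | hit-b e eq | hit-= {col} {a} {i} {s} ca | hit-≢ {col} {b} {i} {s} (a≢b ∘ trans (sym ca)) =
      trans (bit-+-not (value lab e)) (sym (bit-+-not s))
    ... | inj₂ cb rewrite hit-a e eq | hit-b e eq | hit-= {col} {b} {i} {s} cb | hit-≢ {col} {a} {i} {s} (a≢b ∘ sym ∘ trans (sym cb)) =
      trans (bit-+-not (value lab e)) (trans (sym (bit-+-not s)) (+-comm (bit s) _))
    by false eq rewrite eq = refl

  hits-other : ∀ {c} → c ≢ a → c ≢ b → ∀ h → hits col′ c h ≡ hits col c h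
  hits-other {c} c≢a c≢b h = hits-cong col′ col c c h (hit-other c≢a c≢b)

  hits-sum : ∀ h → hits col′ a h + hits col′ b h ≡ hits col a h + hits col b h
  hits-sum []      = refl
  hits-sum (e ∷ h) = begin
    (bit (hit col′ a e) + hits col′ a h) + (bit (hit col′ b e) + hits col′ b h)   ≡⟨ interchange (bit (hit col′ a e)) _ _ _ ⟩
    (bit (hit col′ a e) + bit (hit col′ b e)) + (hits col′ a h + hits col′ b h)   ≡⟨ cong₂ _+_ (hit-sum e) (hits-sum h) ⟩
    (bit (hit col a e) + bit (hit col b e)) + (hits col a h + hits col b h)       ≡⟨ interchange (bit (hit col a e)) _ _ _ ⟨
    (bit (hit col a e) + hits col a h) + (bit (hit col b e) + hits col b h)       ∎
    where
    open ≡-Reasoning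
    interchange : ∀ w x y z → (w + x) + (y + z) ≡ (w + y) + (x + z)
    interchange = solve-∀

-- Balance in all prefixes and its repair after one event.

Distinct : List ⟦ Event ⟧ → Set
Distinct = AllPairs (λ x y → proj₁ x ≡ proj₁ y → proj₂ x ≡ not (proj₂ y))

split-balances : ∀ {a b} h col → a ≢ b → Distinct h → ∀ n →
                 hits (split a b h col) a (take n h) ≤ suc (hits (split a b h col) b (take n h)) ×
                 hits (split a b h col) b (take n h) ≤ suc (hits (split a b h col) a (take n h))
split-balances {a} {b} h col a≢b distinct n =
    paired-balance (λ e eq → hit-a e eq , hit-b e eq) hit-unselected z≤n P n
  , paired-balance (λ e eq → hit-b e eq , trans (hit-a e eq) (sym (Bool.not-involutive _))) (λ e eq → sym (hit-unselected e eq))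
                   z≤n (paired-not P) n
  where
  final = pass (λ e → is a b (col (proj₁ e))) fresh [] h
  open Recolour a b a≢b col final
  P = proj₁ (pass-good ab fresh h distinct)

Balanced : List ℕ → (ℕ → ℕ) → List ⟦ Event ⟧ → Set
Balanced pal col h = ∀ n {c c′} → c ∈ pal → c′ ∈ pal → hits col c (take n h) ≤ suc (hits col c′ (take n h))

select-view : ∀ {A : Set} (c : A → Bool) d xs →
              (select c d xs ≡ d × (∀ {x} → x ∈ xs → c x ≡ false)) ⊎
              (select c d xs ∈ xs × c (select c d xs) ≡ true)
select-view c d []       = inj₁ (refl , λ ())
select-view c d (x ∷ xs) with c x in eq
... | false with select-view c d xs
...   | inj₁ (r≡ , none)  = inj₁ (r≡ , λ { (here refl) → eq ; (there i) → none i })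
...   | inj₂ (r∈ , found) = inj₂ (there r∈ , found)
select-view c d (x ∷ xs) | true with select-view c x xs
...   | inj₁ (r≡ , none)  = inj₂ (here r≡ , subst (λ z → c z ≡ true) (sym r≡) eq)
...   | inj₂ (r∈ , found) = inj₂ (there r∈ , found)

far-true : ∀ m n → far m n ≡ true → 2 + m ≤ n ⊎ 2 + n ≤ m
far-true m n eq with 2 + m ≤ᵇ n in e
... | true  = inj₁ (≤ᵇ⇒≤ (2 + m) n (subst T (sym e) _))
... | false = inj₂ (≤ᵇ⇒≤ (2 + n) m (subst T (sym eq) _))

far-false : ∀ m n → far m n ≡ false → m ≤ suc n × n ≤ suc m
far-false m n eq with 2 + m ≤ᵇ n in e | 2 + n ≤ᵇ m in e′
... | false | false = ≮⇒≥ (λ lt → subst T e′ (≤⇒≤ᵇ lt)) , ≮⇒≥ (λ lt → subst T e (≤⇒≤ᵇ lt))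

-- If A were at least y + 2, then B would be at least y + 1 and their sum at least 2y + 3.
close-above : ∀ {A B S y} → A + B ≡ S → A ≤ suc B → S ≤ 2 + (y + y) → A ≤ suc y
close-above {A} {B} {y = y} refl A≤ S≤ = ≮⇒≥ λ y< → <-irrefl refl (begin-strict
  2 + (y + y)          <⟨ ≤-reflexive (ar y) ⟩
  (2 + y) + suc y      ≤⟨ +-mono-≤ y< (≤-pred (≤-trans y< A≤)) ⟩
  A + B                ≤⟨ S≤ ⟩
  2 + (y + y)          ∎)
  where
  open ≤-Reasoning
  ar : ∀ y → suc (2 + (y + y)) ≡ (2 + y) + suc y
  ar = solve-∀

close-below : ∀ {A B S y} → A + B ≡ S → B ≤ suc A → y + y ≤ 2 + S → y ≤ suc A
close-below {A} {B} {y = y} refl B≤ S≥ = ≮⇒≥ λ A< → <-irrefl refl (begin-strict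
  2 + (A + B)          <⟨ ≤-reflexive (ar A B) ⟩
  (2 + A) + suc B      ≤⟨ +-mono-≤ A< (≤-trans (s≤s B≤) A<) ⟩
  y + y                ≤⟨ S≥ ⟩
  2 + (A + B)          ∎)
  where
  open ≤-Reasoning
  ar : ∀ A B → suc (2 + (A + B)) ≡ (2 + A) + suc B
  ar = solve-∀

-- After the split `a` and `b` are nearly equal halves of their old sum. For a third colour c it
-- therefore suffices that this sum is within 2 of twice the count of c.
level : ∀ {pal : List ℕ} {a b} {x x′ : ℕ → ℕ} →
        (∀ {c} → c ≢ a → c ≢ b → x′ c ≡ x c) → x′ a + x′ b ≡ x a + x b →
        x′ a ≤ suc (x′ b) → x′ b ≤ suc (x′ a) →
        (∀ {c} → c ∈ pal → c ≢ a → c ≢ b → x a + x b ≤ 2 + (x c + x c) × x c + x c ≤ 2 + (x a + x b)) →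
        (∀ {c c′} → c ∈ pal → c′ ∈ pal → c ≢ a → c ≢ b → c′ ≢ a → c′ ≢ b → x c ≤ suc (x c′)) →
        ∀ {c c′} → c ∈ pal → c′ ∈ pal → x′ c ≤ suc (x′ c′)
level {pal} {a} {b} {x} {x′} same total a≤b b≤a near others {c} {c′} c∈ c′∈ with c ≟ a | c ≟ b | c′ ≟ a | c′ ≟ b
... | yes refl | _        | yes refl | _        = n≤1+n _
... | yes refl | _        | no _     | yes refl = a≤b
... | yes refl | _        | no ≢a    | no ≢b    rewrite same ≢a ≢b = close-above total a≤b (proj₁ (near c′∈ ≢a ≢b))
... | no _     | yes refl | yes refl | _        = b≤a
... | no _     | yes refl | no _     | yes refl = n≤1+n _
... | no _     | yes refl | no ≢a    | no ≢b    rewrite same ≢a ≢b =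
  close-above (trans (+-comm (x′ b) _) total) b≤a (proj₁ (near c′∈ ≢a ≢b))
... | no ≢a    | no ≢b    | yes refl | _        rewrite same ≢a ≢b = close-below total b≤a (proj₂ (near c∈ ≢a ≢b))
... | no ≢a    | no ≢b    | no _     | yes refl rewrite same ≢a ≢b =
  close-below (trans (+-comm (x′ b) _) total) a≤b (proj₂ (near c∈ ≢a ≢b))
... | no ≢a    | no ≢b    | no ≢a′   | no ≢b′   rewrite same ≢a ≢b | same ≢a′ ≢b′ = others c∈ c′∈ ≢a ≢b ≢a′ ≢b′

-- Separates the prefixes of the old history, where balance is known, from the full history, the
-- only place where the new event matters.
take-∷ʳ : ∀ {A : Set} n (h : List A) e → (∃ λ k → take n (h ∷ʳ e) ≡ take k h) ⊎ take n (h ∷ʳ e) ≡ h ∷ʳ e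
take-∷ʳ zero    h       e = inj₁ (0 , refl)
take-∷ʳ (suc n) []      e = inj₂ (cong (e ∷_) (List.take-[] n))
take-∷ʳ (suc n) (x ∷ h) e with take-∷ʳ n h e
... | inj₁ (k , eq) = inj₁ (suc k , cong (x ∷_) eq)
... | inj₂ eq       = inj₂ (cong (x ∷_) eq)

take-all : ∀ {A : Set} (h : List A) → take (length h) h ≡ h
take-all []      = refl
take-all (x ∷ h) = cong (x ∷_) (take-all h)

hits-∷ʳ : ∀ col c h e → hits col c (h ∷ʳ e) ≡ hits col c h + bit (hit col c e)
hits-∷ʳ col c h e = trans (∑-++ h (e ∷ []) _) (cong (hits col c h +_) (+-identityʳ _))

module Step {pal col h} (balanced : Balanced pal col h) (col∈ : ∀ i → col i ∈ pal) (e : ⟦ Event ⟧)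
            (distinct : Distinct (h ∷ʳ e)) where

  open ≤-Reasoning

  i = proj₁ e
  s = proj₂ e
  h′ = h ∷ʳ e
  a = col i
  b = partner pal col h′ a
  x : ℕ → ℕ
  x c = hits col c h′

  whole : ∀ {c c′} → c ∈ pal → c′ ∈ pal → hits col c h ≤ suc (hits col c′ h)
  whole c∈ c′∈ = subst (λ g → hits col _ g ≤ suc (hits col _ g)) (take-all h) (balanced (length h) c∈ c′∈)

  others : ∀ {c c′} → c ∈ pal → c′ ∈ pal → c ≢ a → c′ ≢ a → x c ≤ suc (x c′)
  others {c} {c′} c∈ c′∈ c≢a c′≢a = begin
    x c                                     ≡⟨ hits-∷ʳ col c h e ⟩
    hits col c h + bit (hit col c e)        ≡⟨ cong (λ z → hits col c h + bit z) (hit-≢ {col} (c≢a ∘ sym)) ⟩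
    hits col c h + bit (not s)              ≤⟨ +-monoˡ-≤ (bit (not s)) (whole c∈ c′∈) ⟩
    suc (hits col c′ h + bit (not s))       ≡⟨ cong (λ z → suc (hits col c′ h + bit z)) (hit-≢ {col} (c′≢a ∘ sym)) ⟨
    suc (hits col c′ h + bit (hit col c′ e)) ≡⟨ cong suc (hits-∷ʳ col c′ h e) ⟨
    suc (x c′)                              ∎

  within-2 : ∀ {c c′} → c ∈ pal → c′ ∈ pal → x c ≤ 2 + x c′
  within-2 {c} {c′} c∈ c′∈ = begin
    x c                                     ≡⟨ hits-∷ʳ col c h e ⟩
    hits col c h + bit (hit col c e)        ≤⟨ +-mono-≤ (whole c∈ c′∈) (bit≤1 (hit col c e)) ⟩
    suc (hits col c′ h) + 1                 ≡⟨ +-comm (suc (hits col c′ h)) 1 ⟩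
    2 + hits col c′ h                       ≤⟨ +-monoʳ-≤ 2 (m≤m+n _ _) ⟩
    2 + (hits col c′ h + bit (hit col c′ e)) ≡⟨ cong (2 +_) (hits-∷ʳ col c′ h e) ⟨
    2 + x c′                                ∎

  -- Since `a` may be off by two and `b` by one on the same side, the sum could miss `x c + x c` by
  -- three. The gap between `a` and `b` excludes this: `x a` is within two of `x c`, so `x b` is
  -- equal to `x c` or on the other side of it.
  near : b ∈ pal → 2 + x b ≤ x a ⊎ 2 + x a ≤ x b → b ≢ a → ∀ {c} → c ∈ pal → c ≢ a →
         x a + x b ≤ 2 + (x c + x c) × x c + x c ≤ 2 + (x a + x b)
  near b∈ (inj₁ b≪a) b≢a {c} c∈ c≢a =
      (begin x a + x b ≤⟨ +-mono-≤ (within-2 (col∈ i) c∈) (≤-pred (≤-pred (≤-trans b≪a (within-2 (col∈ i) c∈)))) ⟩ 2 + (x c + x c) ∎)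
    , (begin
        x c + x c          ≤⟨ +-mono-≤ (others c∈ b∈ c≢a b≢a) (others c∈ b∈ c≢a b≢a) ⟩
        suc (x b) + suc (x b)  ≤⟨ +-monoˡ-≤ (suc (x b)) (≤-trans (n≤1+n _) b≪a) ⟩
        x a + suc (x b)    ≡⟨ +-suc (x a) (x b) ⟩
        suc (x a + x b)    ≤⟨ n≤1+n _ ⟩
        2 + (x a + x b)    ∎)
  near b∈ (inj₂ a≪b) b≢a {c} c∈ c≢a =
      (begin
        x a + x b          ≤⟨ +-mono-≤ (≤-pred (≤-pred (≤-trans a≪b (≤-trans (others b∈ c∈ b≢a c≢a) (n≤1+n _))))) (others b∈ c∈ b≢a c≢a) ⟩
        x c + suc (x c)    ≡⟨ +-suc (x c) (x c) ⟩
        suc (x c + x c)    ≤⟨ n≤1+n _ ⟩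
        2 + (x c + x c)    ∎)
    , (begin x c + x c ≤⟨ +-mono-≤ (within-2 c∈ (col∈ i)) (≤-trans (within-2 c∈ (col∈ i)) a≪b) ⟩ 2 + (x a + x b) ∎)

  balanced-near : ∀ n {c} → c ∈ pal → b ∈ pal → let y = λ c → hits col c (take n h) in
                  y a + y b ≤ 2 + (y c + y c) × y c + y c ≤ 2 + (y a + y b)
  balanced-near n {c} c∈ b∈ =
      (begin
        y a + y b              ≤⟨ +-mono-≤ (balanced n (col∈ i) c∈) (balanced n b∈ c∈) ⟩
        suc (y c) + suc (y c)  ≡⟨ cong suc (+-suc (y c) (y c)) ⟩
        2 + (y c + y c)        ∎)
    , (begin
        y c + y c              ≤⟨ +-mono-≤ (balanced n c∈ (col∈ i)) (balanced n c∈ b∈) ⟩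
        suc (y a) + suc (y b)  ≡⟨ cong suc (+-suc (y a) (y b)) ⟩
        2 + (y a + y b)        ∎)
    where
    y = λ c → hits col c (take n h)

  col′ : ℕ → ℕ
  col′ = split a b h′ col

  col′∈ : ∀ j → col′ j ∈ pal
  col′∈ j with select-view (λ c → far (x c) (x a)) a pal
  ... | v with is a b (col j) | proj₂ (pass (λ e → is a b (col (proj₁ e))) fresh [] h′ j)
  ...   | false | _     = col∈ j
  ...   | true  | false = col∈ i
  ...   | true  | true with v
  ...     | inj₁ (b≡a , _) = subst (_∈ pal) (sym b≡a) (col∈ i)
  ...     | inj₂ (b∈ , _)  = b∈

  trivial-split : b ≡ a → ∀ j → col′ j ≡ col j
  trivial-split b≡a j with is a b (col j) in eq | proj₂ (pass (λ e → is a b (col (proj₁ e))) fresh [] h′ j)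
  ... | false | _ = refl
  ... | true  | z with is-true a b (col j) eq | z
  ...   | inj₁ ≡a | true  = trans b≡a (sym ≡a)
  ...   | inj₁ ≡a | false = sym ≡a
  ...   | inj₂ ≡b | true  = sym ≡b
  ...   | inj₂ ≡b | false = sym (trans ≡b b≡a)

  unchanged : (∀ {c} → c ∈ pal → far (x c) (x a) ≡ false) → Balanced pal col h′
  unchanged none n {c} {c′} c∈ c′∈ with take-∷ʳ n h e
  ... | inj₁ (k , eq) rewrite eq = balanced k c∈ c′∈
  ... | inj₂ eq rewrite eq with c ≟ a | c′ ≟ a
  ...   | yes refl | _        = proj₂ (far-false (x c′) (x a) (none c′∈))
  ...   | no _     | yes refl = proj₁ (far-false (x c) (x a) (none c∈))
  ...   | no c≢a   | no c′≢a  = others c∈ c′∈ c≢a c′≢a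

  balanced′ : Balanced pal col′ h′
  balanced′ n {c} {c′} c∈ c′∈ with select-view (λ c → far (x c) (x a)) a pal
  ... | inj₁ (b≡a , none) = subst₂ (λ m n → m ≤ suc n) (same c) (same c′) (unchanged none n c∈ c′∈)
    where
    same : ∀ c → hits col c (take n h′) ≡ hits col′ c (take n h′)
    same c = hits-cong col col′ c c (take n h′) (λ e′ → cong (λ k → if k ≡ᵇ c then proj₂ e′ else not (proj₂ e′)) (sym (trivial-split b≡a (proj₁ e′))))
  ... | inj₂ (b∈ , b-far) =
    level {pal} {a} {b} {λ c → hits col c g} {λ c → hits col′ c g}
      (λ c≢a c≢b → R.hits-other c≢a c≢b g) (R.hits-sum g)
      (proj₁ (split-balances h′ col (b≢a ∘ sym) distinct n)) (proj₂ (split-balances h′ col (b≢a ∘ sym) distinct n))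
      near′ others′ c∈ c′∈
    where
    g = take n h′
    gap = far-true (x b) (x a) b-far
    b≢a : b ≢ a
    b≢a b≡a = excluded (subst (λ z → far (x z) (x a) ≡ true) b≡a b-far)
      where
      excluded : far (x a) (x a) ≡ true → _
      excluded eq with far-true (x a) (x a) eq
      ... | inj₁ lt = 1+n≰n (≤-trans (n≤1+n _) lt)
      ... | inj₂ lt = 1+n≰n (≤-trans (n≤1+n _) lt)
    module R = Recolour a b (b≢a ∘ sym) col (pass (λ e → is a b (col (proj₁ e))) fresh [] h′)
    near′ : ∀ {c} → c ∈ pal → c ≢ a → c ≢ b → _
    near′ {c} c∈ c≢a c≢b with take-∷ʳ n h e
    ... | inj₁ (k , eq) = subst (λ g → hits col a g + hits col b g ≤ 2 + (hits col c g + hits col c g) ×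
                                       hits col c g + hits col c g ≤ 2 + (hits col a g + hits col b g)) (sym eq) (balanced-near k c∈ b∈)
    ... | inj₂ eq = subst (λ g → hits col a g + hits col b g ≤ 2 + (hits col c g + hits col c g) ×
                                       hits col c g + hits col c g ≤ 2 + (hits col a g + hits col b g)) (sym eq) (near b∈ gap b≢a c∈ c≢a)
    others′ : ∀ {c c′} → c ∈ pal → c′ ∈ pal → c ≢ a → c ≢ b → c′ ≢ a → c′ ≢ b → hits col c g ≤ suc (hits col c′ g)
    others′ {c} {c′} c∈ c′∈ c≢a _ c′≢a _ with take-∷ʳ n h e
    ... | inj₁ (k , eq) = subst (λ g → hits col c g ≤ suc (hits col c′ g)) (sym eq) (balanced k c∈ c′∈)
    ... | inj₂ eq = subst (λ g → hits col c g ≤ suc (hits col c′ g)) (sym eq) (others c∈ c′∈ c≢a c′≢a)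

-- The whole sweep.

AllPairs-++ˡ : ∀ {A : Set} {R : A → A → Set} xs {ys} → AllPairs R (xs ++ ys) → AllPairs R xs
AllPairs-++ˡ []       _         = []
AllPairs-++ˡ (x ∷ xs) (rx ∷ rs) = All.++⁻ˡ xs rx ∷ AllPairs-++ˡ xs rs

-- The state holds the history with the latest event first, hence `reverse H`. Keys and distinctness
-- concern the complete list of events, from which they pass to every initial part.
balanceT-run : ∀ ids pal E H col → Keys ids (reverse H ++ E) → Distinct (reverse H ++ E) →
               Balanced pal col (reverse H) → (∀ i → col i ∈ pal) →
               ∃ λ col′ → proj₂ (foldl (stepT pal) (H , tab ids col) E) ≡ tab ids col′ ×
                          Balanced pal col′ (reverse H ++ E) × (∀ i → col′ i ∈ pal)
balanceT-run ids pal [] H col _ _ bal col∈ = col , refl , subst (Balanced pal col) (sym (List.++-identityʳ _)) bal , col∈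
balanceT-run ids pal (e ∷ E) H col keys distinct bal col∈ =
  let col″ , run , bal″ , col″∈ = balanceT-run ids pal E (e ∷ H) S.col′ (subst (Keys ids) shift keys) (subst Distinct shift distinct)
                                    (subst (Balanced pal S.col′) (sym rev) S.balanced′) S.col′∈
  in col″ , trans (cong (λ C → proj₂ (foldl (stepT pal) (e ∷ H , C) E)) step-tab) run
     , subst (Balanced pal col″) (sym shift) bal″ , col″∈
  where
  rev : reverse (e ∷ H) ≡ reverse H ∷ʳ e
  rev = List.unfold-reverse e H
  shift : reverse H ++ e ∷ E ≡ reverse (e ∷ H) ++ E
  shift = trans (sym (List.∷ʳ-++ (reverse H) e E)) (cong (_++ E) (sym rev))
  distinct′ : Distinct (reverse H ∷ʳ e)
  distinct′ = AllPairs-++ˡ (reverse H ∷ʳ e) (subst Distinct (sym (List.∷ʳ-++ (reverse H) e E)) distinct)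
  keys′ : Keys ids (reverse H ∷ʳ e)
  keys′ = All.++⁻ˡ (reverse H ∷ʳ e) (subst (Keys ids) (sym (List.∷ʳ-++ (reverse H) e E)) keys)
  module S = Step {pal} {col} bal col∈ e distinct′
  e∈ : proj₁ e ∈ ids
  e∈ = All.head (All.++⁻ʳ (reverse H) keys)
  hits-tab : ∀ c h → Keys ids h → hits (look 0 (tab ids col)) c h ≡ hits col c h
  hits-tab c []      []       = refl
  hits-tab c (x ∷ h) (x∈ ∷ k) rewrite look-tab 0 ids col x∈ = cong (_ +_) (hits-tab c h k)
  select-cong : ∀ (f g : ℕ → Bool) d xs → (∀ x → f x ≡ g x) → select f d xs ≡ select g d xs
  select-cong f g d []       eq = refl
  select-cong f g d (x ∷ xs) eq rewrite eq x = select-cong f g (if g x then x else d) xs eq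
  step-tab : proj₂ (stepT pal (H , tab ids col) e) ≡ tab ids S.col′
  step-tab = begin
    splitT a′ (partner pal (look 0 (tab ids col)) h₀ a′) h₀ (tab ids col)
      ≡⟨ cong (λ h → splitT a′ (partner pal (look 0 (tab ids col)) h a′) h (tab ids col)) rev ⟩
    splitT a′ (partner pal (look 0 (tab ids col)) h₁ a′) h₁ (tab ids col)
      ≡⟨ cong (λ a → splitT a (partner pal (look 0 (tab ids col)) h₁ a) h₁ (tab ids col)) (look-tab 0 ids col e∈) ⟩
    splitT S.a (partner pal (look 0 (tab ids col)) h₁ S.a) h₁ (tab ids col)
      ≡⟨ cong (λ b → splitT S.a b h₁ (tab ids col)) (select-cong _ _ S.a pal (λ c → cong₂ far (hits-tab c h₁ keys′) (hits-tab S.a h₁ keys′))) ⟩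
    splitT S.a S.b h₁ (tab ids col)
      ≡⟨ splitT-tab ids col S.a S.b h₁ keys′ ⟩
    tab ids S.col′ ∎
    where
    open ≡-Reasoning
    h₀ = reverse (e ∷ H)
    h₁ = reverse H ∷ʳ e
    a′ = look 0 (tab ids col) (proj₁ e)

balanceT-correct : ∀ ids pal E → Keys ids E → Distinct E → 0 ∈ pal →
                   ∃ λ col → balanceT pal E (tab ids (λ _ → 0)) ≡ tab ids col × Balanced pal col E × (∀ i → col i ∈ pal)
balanceT-correct ids pal E keys distinct 0∈ =
  balanceT-run ids pal E [] (λ _ → 0) keys distinct (λ n {c} {c′} _ _ → subst (λ g → hits (λ _ → 0) c g ≤ suc (hits (λ _ → 0) c′ g)) (sym (List.take-[] n)) z≤n) (λ _ → 0∈)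

-- Sums, lists and size classes

infixl 7 _when_

_when_ : ℕ → Bool → ℕ
w when b = if b then w else 0

when-true : ∀ {w b} → b ≡ true → w when b ≡ w
when-true refl = refl

when-≤ : ∀ w b → w when b ≤ w
when-≤ w true  = ≤-refl
when-≤ w false = z≤n

∑-cong : ∀ {A : Set} (xs : List A) {f g : A → ℕ} → (∀ x → f x ≡ g x) → ∑ xs f ≡ ∑ xs g
∑-cong xs eq = cong sum (List.map-cong eq xs)

∑-mono : ∀ {A : Set} (xs : List A) {f g : A → ℕ} → (∀ {x} → x ∈ xs → f x ≤ g x) → ∑ xs f ≤ ∑ xs g
∑-mono []       f≤g = z≤n
∑-mono (x ∷ xs) f≤g = +-mono-≤ (f≤g (here refl)) (∑-mono xs (f≤g ∘ there))

∑-mono-< : ∀ {A : Set} (xs : List A) {f g : A → ℕ} {x} → (∀ {y} → y ∈ xs → f y ≤ g y) → x ∈ xs → f x < g x → ∑ xs f < ∑ xs g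
∑-mono-< (x ∷ xs) f≤g (here refl) f<g = +-mono-<-≤ f<g (∑-mono xs (f≤g ∘ there))
∑-mono-< (x ∷ xs) f≤g (there i)   f<g = +-mono-≤-< (f≤g (here refl)) (∑-mono-< xs (f≤g ∘ there) i f<g)

∑-+ : ∀ {A : Set} (xs : List A) (f g : A → ℕ) → ∑ xs (λ x → f x + g x) ≡ ∑ xs f + ∑ xs g
∑-+ []       f g = refl
∑-+ (x ∷ xs) f g rewrite ∑-+ xs f g = interchange (f x) (g x) (∑ xs f) (∑ xs g)
  where
  interchange : ∀ a b c d → a + b + (c + d) ≡ a + c + (b + d)
  interchange = solve-∀

∑-*ˡ : ∀ {A : Set} k (xs : List A) f → ∑ xs (λ x → k * f x) ≡ k * ∑ xs f
∑-*ˡ k []       f = sym (*-zeroʳ k)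
∑-*ˡ k (x ∷ xs) f rewrite ∑-*ˡ k xs f = sym (*-distribˡ-+ k (f x) _)

∑-const : ∀ {A : Set} (xs : List A) k → ∑ xs (λ _ → k) ≡ length xs * k
∑-const []       k = refl
∑-const (x ∷ xs) k = cong (k +_) (∑-const xs k)

∑-swap : ∀ {A B : Set} (xs : List A) (ys : List B) (f : A → B → ℕ) →
         ∑ xs (λ x → ∑ ys (f x)) ≡ ∑ ys (λ y → ∑ xs (λ x → f x y))
∑-swap []       ys f = sym (trans (∑-const ys 0) (*-zeroʳ (length ys)))
∑-swap (x ∷ xs) ys f = trans (cong (∑ ys (f x) +_) (∑-swap xs ys f)) (sym (∑-+ ys (f x) _))

∑-map : ∀ {A B : Set} (g : A → B) xs f → ∑ (map g xs) f ≡ ∑ xs (f ∘ g)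
∑-map g xs f = cong sum (sym (List.map-∘ xs))

∑-concatMap : ∀ {A B : Set} (g : A → List B) xs f → ∑ (concatMap g xs) f ≡ ∑ xs (λ x → ∑ (g x) f)
∑-concatMap g []       f = refl
∑-concatMap g (x ∷ xs) f = trans (∑-++ (g x) (concatMap g xs) f) (cong (∑ (g x) f +_) (∑-concatMap g xs f))

∑-upTo-≡ : ∀ k t w → ∑ (upTo k) (λ u → w when (t ≡ᵇ u)) ≡ w when (t <ᵇ k)
∑-upTo-≡ zero    t       w = refl
∑-upTo-≡ (suc k) zero    w = trans (cong (λ us → w + ∑ us (λ u → w when (0 ≡ᵇ u))) (sym (List.map-upTo suc k)))
  (trans (cong (w +_) (trans (∑-map suc (upTo k) _) (trans (∑-const (upTo k) 0) (*-zeroʳ (length (upTo k)))))) (+-identityʳ w))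
∑-upTo-≡ (suc k) (suc t) w = trans (cong (λ us → ∑ us (λ u → w when (suc t ≡ᵇ u))) (sym (List.map-upTo suc k)))
  (trans (∑-map suc (upTo k) _) (∑-upTo-≡ k t w))

∑-filter : ∀ {A : Set} {P : A → Set} (P? : ∀ x → Dec (P x)) xs f →
           sum (map f (filter P? xs)) ≡ ∑ xs (λ x → f x when does (P? x))
∑-filter P? []       f = refl
∑-filter P? (x ∷ xs) f with does (P? x)
... | true  = cong (f x +_) (∑-filter P? xs f)
... | false = ∑-filter P? xs f

∑-member : ∀ {A : Set} (xs : List A) f {x} → x ∈ xs → f x ≤ ∑ xs f
∑-member (x ∷ xs) f (here refl) = m≤m+n _ _
∑-member (y ∷ xs) f (there i)   = ≤-trans (∑-member xs f i) (m≤n+m _ (f y))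

maxi-upper : ∀ {A : Set} (xs : List A) f {x} → x ∈ xs → f x ≤ maxi xs f
maxi-upper {A} xs f = go xs 0
  where
  start≤ : ∀ (xs : List A) m → m ≤ foldl (λ m x → if m ≤ᵇ f x then f x else m) m xs
  start≤ []       m = ≤-refl
  start≤ (x ∷ xs) m with m ≤ᵇ f x in eq
  ... | true  = ≤-trans (≤ᵇ⇒≤ m (f x) (subst T (sym eq) _)) (start≤ xs (f x))
  ... | false = start≤ xs m
  go : ∀ xs m {x} → x ∈ xs → f x ≤ foldl (λ m x → if m ≤ᵇ f x then f x else m) m xs
  go (x ∷ xs) m (there i) = go xs _ i
  go (x ∷ xs) m (here refl) with m ≤ᵇ f x in eq
  ... | true  = start≤ xs (f x)
  ... | false = ≤-trans (<⇒≤ (≰⇒> (λ m≤ → subst T eq (≤⇒≤ᵇ m≤)))) (start≤ xs m)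

maxi-least : ∀ {A : Set} (xs : List A) f k → (∀ {x} → x ∈ xs → f x ≤ k) → maxi xs f ≤ k
maxi-least {A} xs f k = go xs 0 z≤n
  where
  go : ∀ xs m → m ≤ k → (∀ {x} → x ∈ xs → f x ≤ k) → foldl (λ m x → if m ≤ᵇ f x then f x else m) m xs ≤ k
  go []       m m≤ f≤ = m≤
  go (x ∷ xs) m m≤ f≤ with m ≤ᵇ f x
  ... | true  = go xs (f x) (f≤ (here refl)) (f≤ ∘ there)
  ... | false = go xs m m≤ (f≤ ∘ there)

≤ᵇ-true : ∀ {m n} → m ≤ n → (m ≤ᵇ n) ≡ true
≤ᵇ-true {m} {n} m≤n with m ≤ᵇ n | ≤⇒≤ᵇ m≤n
... | true | _ = refl

≤ᵇ-false : ∀ {m n} → n < m → (m ≤ᵇ n) ≡ false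
≤ᵇ-false {m} {n} n<m with m ≤ᵇ n in eq
... | false = refl
... | true  = contradiction (≤ᵇ⇒≤ m n (subst T (sym eq) _)) (<⇒≱ n<m)

true-≤ᵇ : ∀ {m n} → (m ≤ᵇ n) ≡ true → m ≤ n
true-≤ᵇ {m} {n} eq = ≤ᵇ⇒≤ m n (subst T (sym eq) _)

false-≤ᵇ : ∀ {m n} → (m ≤ᵇ n) ≡ false → n < m
false-≤ᵇ eq = ≰⇒> (λ m≤n → subst T eq (≤⇒≤ᵇ m≤n))

<ᵇ-suc : ∀ m n → (m <ᵇ suc n) ≡ (m ≤ᵇ n)
<ᵇ-suc zero    n = refl
<ᵇ-suc (suc m) n = refl

∧-true : ∀ {b c} → b ∧ c ≡ true → b ≡ true × c ≡ true
∧-true {true} {true} _ = refl , refl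

idx-tabulate : ∀ {A : Set} k {n} (f : Fin n → A) → idx k (tabulate f) ≡ tabulate (λ j → k + toℕ j , f j)
idx-tabulate k {zero}  f = refl
idx-tabulate k {suc n} f = cong₂ _∷_ (cong (_, f Fin.zero) (sym (+-identityʳ k)))
  (trans (idx-tabulate (suc k) (f ∘ Fin.suc)) (List.tabulate-cong (λ j → cong (_, f (Fin.suc j)) (sym (+-suc k (toℕ j))))))

idx-keys : ∀ {A : Set} k (xs : List A) → map proj₁ (idx k xs) ≡ applyUpTo (k +_) (length xs)
idx-keys k []       = refl
idx-keys k (x ∷ xs) = cong₂ _∷_ (sym (+-identityʳ k)) (trans (idx-keys (suc k) xs)
  (trans (sym (List.map-upTo (suc k +_) (length xs))) (trans (List.map-cong (λ i → sym (+-suc k i)) (upTo (length xs)))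
    (List.map-upTo (λ i → k + suc i) (length xs)))))

upTo-++ : ∀ a b → ∃ λ us → upTo (a + b) ≡ upTo a ++ us
upTo-++ a b = go (λ i → i) a
  where
  go : ∀ (f : ℕ → ℕ) a → ∃ λ us → applyUpTo f (a + b) ≡ applyUpTo f a ++ us
  go f zero    = _ , refl
  go f (suc a) = let us , eq = go (f ∘ suc) a in us , cong (f 0 ∷_) eq

All-concatMap : ∀ {A B : Set} {P : B → Set} (f : A → List B) {xs} → All (λ x → All P (f x)) xs → All P (concatMap f xs)
All-concatMap f ps = All.concat⁺ (All.map⁺ ps)

AllPairs-concatMap : ∀ {A B : Set} {S : A → A → Set} {R : B → B → Set} (f : A → List B) {xs} →
                     (∀ x → AllPairs R (f x)) → (∀ {x y} → S x y → All (λ a → All (R a) (f y)) (f x)) →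
                     AllPairs S xs → AllPairs R (concatMap f xs)
AllPairs-concatMap f inner cross []                     = []
AllPairs-concatMap f inner cross (_∷_ {x} {xs} sx rest) =
  AllPairs.++⁺ (inner x) (AllPairs-concatMap f inner cross rest)
    (All.tabulate λ a∈ → All-concatMap f (All.map (λ s → All.lookup (cross s) a∈) sx))

∈-concatMap : ∀ {A B : Set} (f : A → List B) {xs x b} → x ∈ xs → b ∈ f x → b ∈ concatMap f xs
∈-concatMap f x∈ b∈ = ∈-concat⁺′ b∈ (∈-map⁺ f x∈)

palette-upTo : ∀ {A : Set} (fuel : List A) R → palette fuel R ≡ concatMap (λ c → if 1 + c ≤ᵇ R then c ∷ [] else []) (upTo (length fuel))
palette-upTo fuel R = cong (concatMap _) (idx-keys 0 fuel)

palette-< : ∀ {A : Set} (fuel : List A) R {c} → c ∈ palette fuel R → c < R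
palette-< fuel R c∈ = All.lookup (All-concatMap {P = _< R} _ {map proj₁ (idx 0 fuel)} (All.tabulate (λ {x} _ → each x))) c∈
  where
  each : ∀ x → All (_< R) (if 1 + x ≤ᵇ R then x ∷ [] else [])
  each x with 1 + x ≤ᵇ R in eq
  ... | true  = true-≤ᵇ eq ∷ []
  ... | false = []

<-palette : ∀ {A : Set} (fuel : List A) R {c} → R ≤ length fuel → c < R → c ∈ palette fuel R
<-palette fuel R {c} R≤ c<R rewrite palette-upTo fuel R =
  ∈-concatMap _ (∈-upTo⁺ (<-≤-trans c<R R≤)) (subst (λ b → c ∈ (if b then c ∷ [] else [])) (sym (≤ᵇ-true c<R)) (here refl))

balanced-prefix : ∀ {pal col h} g {g′} → Balanced pal col h → h ≡ g ++ g′ → ∀ {c c′} → c ∈ pal → c′ ∈ pal →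
                  hits col c g ≤ suc (hits col c′ g)
balanced-prefix {pal} {col} g {g′} bal refl {c} {c′} c∈ c′∈ =
  subst (λ z → hits col c z ≤ suc (hits col c′ z)) (take-++ g) (bal (length g) c∈ c′∈)
  where
  take-++ : ∀ (g : List ⟦ Event ⟧) → take (length g) (g ++ g′) ≡ g
  take-++ []      = refl
  take-++ (x ∷ g) = cong (x ∷_) (take-++ g)

inLevel : ℕ → ℕ → Bool
inLevel d x = (1 + x / 2 ≤ᵇ d) ∧ (d ≤ᵇ x)

half-≤ : ∀ x → x / 2 + x / 2 ≤ x
half-≤ x = ≤-trans (≤-reflexive (sym (trans (*-comm (x / 2) 2) (cong (x / 2 +_) (+-identityʳ _))))) (m/n*n≤m x 2)

half-< : ∀ {x d} → x / 2 < d → x ≤ d + d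
half-< {x} {d} h< = begin
  x                          ≡⟨ m≡m%n+[m/n]*n x 2 ⟩
  x % 2 + x / 2 * 2          ≤⟨ +-monoˡ-≤ _ (≤-pred (m%n<n x 2)) ⟩
  1 + x / 2 * 2              ≡⟨ ar (x / 2) ⟩
  suc (x / 2) + x / 2        ≤⟨ +-mono-≤ h< (<⇒≤ h<) ⟩
  d + d                      ∎
  where
  open ≤-Reasoning
  ar : ∀ h → 1 + h * 2 ≡ suc h + h
  ar = solve-∀

levels-≤ : ∀ k x → All (_≤ x) (levels k x)
levels-≤ zero    x       = []
levels-≤ (suc k) zero    = []
levels-≤ (suc k) (suc x) = ≤-refl ∷ All.map (λ y≤ → ≤-trans y≤ (m/n≤m (suc x) 2)) (levels-≤ k (suc x / 2))

levels-decrease : ∀ k x → AllPairs (λ x y → y ≤ x / 2) (levels k x)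
levels-decrease zero    x       = []
levels-decrease (suc k) zero    = []
levels-decrease (suc k) (suc x) = levels-≤ k (suc x / 2) ∷ levels-decrease k (suc x / 2)

-- A geometric series: what follows `x` sums to at most twice `x / 2`.
levels-sum : ∀ k x → ∑ (levels k x) (λ y → y) ≤ x + x
levels-sum zero    x          = z≤n
levels-sum (suc k) zero       = z≤n
levels-sum (suc k) x@(suc _) = +-monoʳ-≤ x (≤-trans (levels-sum k (x / 2)) (half-≤ x))

-- At most one term is nonzero, as the intervals `(y / 2 , y]` are disjoint: this is the demand `d`
-- rounded up to the end of its class. It is 0 if no class contains `d`.
levelled : ℕ → ℕ → ℕ → ℕ
levelled k x d = ∑ (levels k x) (λ y → y when inLevel d y)

levelled-> : ∀ k {x d} → x < d → levelled k x d ≡ 0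
levelled-> zero    x<d = refl
levelled-> (suc k) {zero}  x<d = refl
levelled-> (suc k) {x@(suc _)} {d} x<d rewrite ≤ᵇ-false x<d | Bool.∧-zeroʳ (1 + x / 2 ≤ᵇ d) =
  levelled-> k (≤-<-trans (m/n≤m x 2) x<d)

levelled-upper : ∀ k x d → levelled k x d ≤ d + d
levelled-upper zero    x d = z≤n
levelled-upper (suc k) zero d = z≤n
levelled-upper (suc k) x@(suc _) d with 1 + x / 2 ≤ᵇ d in eq
... | false = levelled-upper k (x / 2) d
... | true  rewrite levelled-> k {x / 2} {d} (true-≤ᵇ eq) =
  ≤-trans (≤-reflexive (+-identityʳ _)) (≤-trans (when-≤ x (d ≤ᵇ x)) (half-< {x} {d} (true-≤ᵇ eq)))

levelled-lower : ∀ k {x d} → x < 2 ^ k → 1 ≤ d → d ≤ x → d ≤ levelled k x d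
levelled-lower zero {zero} x< 1≤d d≤x = d≤x
levelled-lower zero {suc x} (s≤s ()) 1≤d d≤x
levelled-lower (suc k) {zero}  x< 1≤d d≤x = d≤x
levelled-lower (suc k) {x@(suc _)} {d} x< 1≤d d≤x with 1 + x / 2 ≤ᵇ d in eq
... | true  rewrite ≤ᵇ-true d≤x = ≤-trans d≤x (m≤m+n _ _)
... | false = levelled-lower k (x/2<2^k k x x<) 1≤d (≤-pred (false-≤ᵇ eq))

ceil-upper : ∀ l c → 1 ≤ c → l ≤ ceil l c * c
ceil-upper l (suc c) _ = +-cancelˡ-≤ c l _ (begin
  c + l                                              ≡⟨ +-comm c l ⟩
  l + c                                              ≡⟨ m≡m%n+[m/n]*n (l + c) (suc c) ⟩
  (l + c) % suc c + (l + c) / suc c * suc c          ≤⟨ +-monoˡ-≤ _ (≤-pred (m%n<n (l + c) (suc c))) ⟩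
  c + (l + c) / suc c * suc c                        ∎)
  where open ≤-Reasoning

ceil-least : ∀ {l c} k → l ≤ k * c → ceil l c ≤ k
ceil-least {l} {zero}  k l≤ = z≤n
ceil-least {l} {suc c} k l≤ = ≤-pred (m<n*o⇒m/o<n (begin-strict
  l + c              <⟨ +-mono-≤-< l≤ (n<1+n c) ⟩
  k * suc c + suc c  ≡⟨ +-comm (k * suc c) (suc c) ⟩
  suc k * suc c      ∎))
  where open ≤-Reasoning

quarter-< : ∀ {D d} → D / 4 < d → D ≤ 4 * d
quarter-< {D} {d} q< = begin
  D                     ≡⟨ m≡m%n+[m/n]*n D 4 ⟩
  D % 4 + D / 4 * 4     ≤⟨ +-monoˡ-≤ _ (<⇒≤ (m%n<n D 4)) ⟩
  suc (D / 4) * 4       ≤⟨ *-monoˡ-≤ 4 q< ⟩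
  d * 4                 ≡⟨ *-comm d 4 ⟩
  4 * d                 ∎
  where open ≤-Reasoning

-- Colour counts on the edges of an instance

module Analysis (I : Instance) where

  J = allFin (n I)

  d s t : Fin (n I) → ℕ
  d j = demand (job I j)
  s j = toℕ (source (job I j))
  t j = toℕ (sink (job I j))

  1≤d : ∀ j → 1 ≤ d j
  1≤d j = >-nonZero⁻¹ (d j) {{demand-positive (job I j)}}

  entry : Fin (n I) → ℕ × ℕ × ℕ × ℕ
  entry j = toℕ j , d j , s j , t j

  js = map entry J
  ids = map toℕ J

  active : ℕ → Fin (n I) → Bool
  active v j = (s j ≤ᵇ v) ∧ (1 + v ≤ᵇ t j)

  inC : ℕ → ℕ → Fin (n I) → Bool
  inC lo hi j = inClass lo hi (entry j)

  count : (ℕ → ℕ) → ℕ → ℕ → ℕ → ℕ → ℕ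
  count col c lo hi v = ∑ J (λ j → 1 when (inC lo hi j ∧ active v j) when (col (toℕ j) ≡ᵇ c))

  total finished : ℕ → ℕ → ℕ → ℕ
  total    lo hi v = ∑ J (λ j → 1 when (inC lo hi j ∧ active v j))
  finished lo hi v = ∑ J (λ j → 1 when (inC lo hi j ∧ (t j ≤ᵇ v)))

  -- Both events of a finished job together hit every colour exactly once.
  hits-block : ∀ col c lo hi v → hits col c (concatMap (eventsAt lo hi js) (upTo (suc v))) ≡
               finished lo hi v + count col c lo hi v
  hits-block col c lo hi v = begin
    ∑ (concatMap (eventsAt lo hi js) us) H                    ≡⟨ ∑-concatMap (eventsAt lo hi js) us H ⟩
    ∑ us (λ u → ∑ (eventsAt lo hi js u) H)                    ≡⟨ ∑-cong us at ⟩
    ∑ us (λ u → ∑ J (λ j → ends j u + starts j u))            ≡⟨ ∑-swap us J _ ⟩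
    ∑ J (λ j → ∑ us (λ u → ends j u + starts j u))            ≡⟨ ∑-cong J (λ j → trans (∑-+ us (ends j) (starts j))
                                                                  (cong₂ _+_ (until (inC lo hi j) (t j) _) (until (inC lo hi j) (s j) _))) ⟩
    ∑ J (λ j → H (toℕ j , false) when (inC lo hi j ∧ (t j ≤ᵇ v)) + H (toℕ j , true) when (inC lo hi j ∧ (s j ≤ᵇ v)))
                                                              ≡⟨ ∑-cong J per-job ⟩
    ∑ J (λ j → 1 when (inC lo hi j ∧ (t j ≤ᵇ v)) + 1 when (inC lo hi j ∧ active v j) when (col (toℕ j) ≡ᵇ c))
                                                              ≡⟨ ∑-+ J _ _ ⟩
    finished lo hi v + count col c lo hi v                    ∎
    where
    open ≡-Reasoning
    us = upTo (suc v)
    H : ⟦ Event ⟧ → ℕ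
    H e = bit (hit col c e)
    ends starts : Fin (n I) → ℕ → ℕ
    ends   j u = H (toℕ j , false) when (inC lo hi j ∧ (t j ≡ᵇ u))
    starts j u = H (toℕ j , true) when (inC lo hi j ∧ (s j ≡ᵇ u))
    single : ∀ b e → ∑ (if b then e ∷ [] else []) H ≡ H e when b
    single true  e = +-identityʳ _
    single false e = refl
    at : ∀ u → ∑ (eventsAt lo hi js u) H ≡ ∑ J (λ j → ends j u + starts j u)
    at u = trans (∑-++ (concatMap _ js) _ H) (trans (cong₂ _+_
             (trans (∑-concatMap _ js H) (trans (∑-map entry J _) (∑-cong J (λ j → single (inC lo hi j ∧ (t j ≡ᵇ u)) (toℕ j , false)))))
             (trans (∑-concatMap _ js H) (trans (∑-map entry J _) (∑-cong J (λ j → single (inC lo hi j ∧ (s j ≡ᵇ u)) (toℕ j , true))))))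
             (sym (∑-+ J _ _)))
    until : ∀ b x w → ∑ us (λ u → w when (b ∧ (x ≡ᵇ u))) ≡ w when (b ∧ (x ≤ᵇ v))
    until true  x w = trans (∑-upTo-≡ (suc v) x w) (cong (w when_) (<ᵇ-suc x v))
    until false x w = trans (∑-const us 0) (*-zeroʳ (length us))
    per-job : ∀ j → H (toℕ j , false) when (inC lo hi j ∧ (t j ≤ᵇ v)) + H (toℕ j , true) when (inC lo hi j ∧ (s j ≤ᵇ v)) ≡
                    1 when (inC lo hi j ∧ (t j ≤ᵇ v)) + 1 when (inC lo hi j ∧ active v j) when (col (toℕ j) ≡ᵇ c)
    per-job j with inC lo hi j | col (toℕ j) ≡ᵇ c | t j ≤ᵇ v in t≤
    ... | false | true  | _ = refl
    ... | false | false | _ = refl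
    ... | true  | q     | true  rewrite ≤ᵇ-true (≤-trans (<⇒≤ (source<sink (job I j))) (true-≤ᵇ {t j} t≤))
                                      | ≤ᵇ-false (s≤s (true-≤ᵇ {t j} t≤)) with q
    ...   | true  = refl
    ...   | false = refl
    per-job j | true  | q | false rewrite ≤ᵇ-true (false-≤ᵇ {t j} t≤) with s j ≤ᵇ v | q
    ...   | true  | true  = refl
    ...   | true  | false = refl
    ...   | false | true  = refl
    ...   | false | false = refl

  -- What is known of an event in a block. The vertex separates blocks of one class, the demand
  -- range separates classes.
  Ev : ℕ → ℕ → ℕ → ⟦ Event ⟧ → Set
  Ev lo hi v e = ∃ λ j → proj₁ e ≡ toℕ j × (lo < d j × d j ≤ hi) × v ≡ (if proj₂ e then s j else t j)

  pick : Bool → (Fin (n I) → Bool) → Fin (n I) → List ⟦ Event ⟧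
  pick σ p j = if p j then (toℕ j , σ) ∷ [] else []

  ends? starts? : ℕ → ℕ → ℕ → Fin (n I) → Bool
  ends?   lo hi v j = inC lo hi j ∧ (t j ≡ᵇ v)
  starts? lo hi v j = inC lo hi j ∧ (s j ≡ᵇ v)

  eventsAt-pick : ∀ lo hi v → eventsAt lo hi js v ≡
                  concatMap (pick false (ends? lo hi v)) J ++ concatMap (pick true (starts? lo hi v)) J
  eventsAt-pick lo hi v = cong₂ _++_ (List.concatMap-map _ entry J) (List.concatMap-map _ entry J)

  picked : ∀ σ p {P : ⟦ Event ⟧ → Set} → (∀ j → p j ≡ true → P (toℕ j , σ)) → All P (concatMap (pick σ p) J)
  picked σ p {P} Pj = All-concatMap (pick σ p) {J} (All.tabulate λ {j} _ → each j)
    where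
    each : ∀ j → All P (pick σ p j)
    each j with p j in eq
    ... | true  = Pj j eq ∷ []
    ... | false = []

  eventsAt-Ev : ∀ lo hi v → All (Ev lo hi v) (eventsAt lo hi js v)
  eventsAt-Ev lo hi v rewrite eventsAt-pick lo hi v = All.++⁺
    (picked false (ends? lo hi v) λ j eq → j , refl , bounds j (proj₁ (∧-true eq)) , same (proj₂ (∧-true {inC lo hi j} eq)))
    (picked true (starts? lo hi v) λ j eq → j , refl , bounds j (proj₁ (∧-true eq)) , same (proj₂ (∧-true {inC lo hi j} eq)))
    where
    bounds : ∀ j → inC lo hi j ≡ true → lo < d j × d j ≤ hi
    bounds j eq = let l , h = ∧-true {1 + lo ≤ᵇ d j} eq in true-≤ᵇ l , true-≤ᵇ h
    same : ∀ {x y} → (x ≡ᵇ y) ≡ true → y ≡ x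
    same {x} {y} eq = sym (≡ᵇ⇒≡ x y (subst T (sym eq) _))

  eventsAt-distinct : ∀ lo hi v → Distinct (eventsAt lo hi js v)
  eventsAt-distinct lo hi v rewrite eventsAt-pick lo hi v = AllPairs.++⁺
    (one-per-job false (ends? lo hi v)) (one-per-job true (starts? lo hi v))
    (picked false (ends? lo hi v) λ _ _ → picked true (starts? lo hi v) λ _ _ _ → refl)
    where
    one-per-job : ∀ σ p → Distinct (concatMap (pick σ p) J)
    one-per-job σ p = AllPairs-concatMap (pick σ p) inner cross (allFin⁺ (n I))
      where
      inner : ∀ j → Distinct (pick σ p j)
      inner j with p j
      ... | true  = [] ∷ []
      ... | false = []
      cross : ∀ {i j} → i ≢ j → All (λ x → All (λ y → proj₁ x ≡ proj₁ y → proj₂ x ≡ not (proj₂ y)) (pick σ p j)) (pick σ p i)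
      cross {i} {j} i≢j with p i | p j
      ... | true  | true  = ((λ eq → contradiction (Fin.toℕ-injective eq) i≢j) ∷ []) ∷ []
      ... | true  | false = [] ∷ []
      ... | false | _     = []

  vs = upTo (suc (m I))

  class-Ev : ∀ lo hi → All (λ e → ∃ λ v → Ev lo hi v e) (classEvents vs lo hi js)
  class-Ev lo hi = All-concatMap (eventsAt lo hi js) {vs} (All.tabulate λ {v} _ → All.map (v ,_) (eventsAt-Ev lo hi v))

  -- Two events of one job with the same sign would both lie at its source or both at its sink, so
  -- they cannot come from the blocks of different vertices.
  class-distinct : ∀ lo hi → Distinct (classEvents vs lo hi js)
  class-distinct lo hi = AllPairs-concatMap (eventsAt lo hi js) (eventsAt-distinct lo hi) cross (upTo⁺ (suc (m I)))
    where
    cross : ∀ {u v} → u ≢ v → All (λ x → All (λ y → proj₁ x ≡ proj₁ y → proj₂ x ≡ not (proj₂ y)) (eventsAt lo hi js v)) (eventsAt lo hi js u)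
    cross {u} {v} u≢v = All.map (λ x-ev → All.map (apart x-ev) (eventsAt-Ev lo hi v)) (eventsAt-Ev lo hi u)
      where
      apart : ∀ {x y} → Ev lo hi u x → Ev lo hi v y → proj₁ x ≡ proj₁ y → proj₂ x ≡ not (proj₂ y)
      apart {_ , σ} {_ , τ} (i , refl , _ , u≡) (j , refl , _ , v≡) eq with refl ← Fin.toℕ-injective eq with σ | τ
      ... | true  | false = refl
      ... | false | true  = refl
      ... | true  | true  = contradiction (trans u≡ (sym v≡)) u≢v
      ... | false | false = contradiction (trans u≡ (sym v≡)) u≢v

  -- Size classes (lo x , hi x] of decreasing demand.
  module Classes {A : Set} (lo hi : A → ℕ) where

    events : List A → List ⟦ Event ⟧
    events = concatMap (λ x → classEvents vs (lo x) (hi x) js)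

    keys : ∀ xs → Keys ids (events xs)
    keys xs = All-concatMap (λ x → classEvents vs (lo x) (hi x) js) {xs} (All.tabulate λ {x} _ → All.map key (class-Ev (lo x) (hi x)))
      where
      key : ∀ {x e} → (∃ λ v → Ev (lo x) (hi x) v e) → proj₁ e ∈ ids
      key (_ , j , refl , _) = ∈-map⁺ toℕ (∈-allFin j)

    distinct : ∀ {xs} → AllPairs (λ x y → hi y ≤ lo x) xs → Distinct (events xs)
    distinct = AllPairs-concatMap (λ x → classEvents vs (lo x) (hi x) js) (λ x → class-distinct (lo x) (hi x)) cross
      where
      cross : ∀ {x y} → hi y ≤ lo x → All (λ a → All (λ b → proj₁ a ≡ proj₁ b → proj₂ a ≡ not (proj₂ b)) (classEvents vs (lo y) (hi y) js)) (classEvents vs (lo x) (hi x) js)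
      cross {x} {y} hi≤lo = All.map (λ x-ev → All.map (apart x-ev) (class-Ev (lo y) (hi y))) (class-Ev (lo x) (hi x))
        where
        apart : ∀ {a b} → (∃ λ v → Ev (lo x) (hi x) v a) → (∃ λ v → Ev (lo y) (hi y) v b) → proj₁ a ≡ proj₁ b → proj₂ a ≡ not (proj₂ b)
        apart (_ , i , refl , (lo< , _) , _) (_ , j , refl , (_ , ≤hi) , _) eq with refl ← Fin.toℕ-injective eq =
          contradiction (<-≤-trans lo< (≤-trans ≤hi hi≤lo)) (<-irrefl refl)

    -- No job is active at the last vertex, so a completed class hits every colour equally often:
    -- the result does not mention `c`. This makes the classes of a single run independent.
    hits-class : ∀ col c xs → hits col c (events xs) ≡ ∑ xs (λ x → finished (lo x) (hi x) (m I))
    hits-class col c xs = trans (∑-concatMap (λ x → classEvents vs (lo x) (hi x) js) xs _)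
      (∑-cong xs λ x → trans (hits-block col c (lo x) (hi x) (m I))
        (trans (cong (finished (lo x) (hi x) (m I) +_) (trans (∑-cong J (none x)) (trans (∑-const J 0) (*-zeroʳ (length J))))) (+-identityʳ _)))
      where
      none : ∀ x j → 1 when (inC (lo x) (hi x) j ∧ active (m I) j) when (col (toℕ j) ≡ᵇ c) ≡ 0
      none x j rewrite ≤ᵇ-false {1 + m I} {t j} (Fin.toℕ<n (sink (job I j))) | Bool.∧-zeroʳ (s j ≤ᵇ m I) | Bool.∧-zeroʳ (inC (lo x) (hi x) j)
        with col (toℕ j) ≡ᵇ c
      ... | true  = refl
      ... | false = refl

    -- Balance is applied to the prefix formed by the classes before `x` and the events of `x` at
    -- the vertices up to `v`. The contributions `K₀` of earlier classes and `F` of finished jobs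
    -- are the same for all colours and cancel.
    count-balanced : ∀ {pal col xs x v c c′} → Balanced pal col (events xs) → x ∈ xs → v ≤ m I → c ∈ pal → c′ ∈ pal →
                     count col c (lo x) (hi x) v ≤ suc (count col c′ (lo x) (hi x) v)
    count-balanced {pal} {col} {xs} {x} {v} {c} {c′} bal x∈ v≤m c∈ c′∈ with us , ws , refl ← ∈-∃++ x∈ =
      +-cancelˡ-≤ (finished (lo x) (hi x) v) _ _ (+-cancelˡ-≤ K₀ _ _ (begin
        K₀ + (F + count col c (lo x) (hi x) v)                 ≡⟨ prefix c ⟨
        hits col c (events us ++ block)                        ≤⟨ balanced-prefix {pal} {col} (events us ++ block) bal split-events c∈ c′∈ ⟩
        suc (hits col c′ (events us ++ block))                 ≡⟨ cong suc (prefix c′) ⟩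
        suc (K₀ + (F + count col c′ (lo x) (hi x) v))          ≡⟨ ar K₀ F _ ⟩
        K₀ + (F + suc (count col c′ (lo x) (hi x) v))          ∎))
      where
      open ≤-Reasoning
      ar : ∀ a b c → suc (a + (b + c)) ≡ a + (b + suc c)
      ar = solve-∀
      F = finished (lo x) (hi x) v
      K₀ = ∑ us (λ x → finished (lo x) (hi x) (m I))
      block = concatMap (eventsAt (lo x) (hi x) js) (upTo (suc v))
      prefix : ∀ c → hits col c (events us ++ block) ≡ K₀ + (F + count col c (lo x) (hi x) v)
      prefix c = trans (∑-++ (events us) block _) (cong₂ _+_ (hits-class col c us) (hits-block col c (lo x) (hi x) v))
      later = proj₁ (upTo-++ (suc v) (m I ∸ v))
      class-split : classEvents vs (lo x) (hi x) js ≡ block ++ concatMap (eventsAt (lo x) (hi x) js) later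
      class-split = trans (cong (concatMap (eventsAt (lo x) (hi x) js)) (trans (cong (λ k → upTo (suc k)) (sym (m+[n∸m]≡n v≤m))) (proj₂ (upTo-++ (suc v) (m I ∸ v)))))
                          (List.concatMap-++ (eventsAt (lo x) (hi x) js) (upTo (suc v)) later)
      split-events : events (us ++ x ∷ ws) ≡ (events us ++ block) ++ (concatMap (eventsAt (lo x) (hi x) js) later ++ events ws)
      split-events = trans (List.concatMap-++ (λ x → classEvents vs (lo x) (hi x) js) us (x ∷ ws))
        (trans (cong (λ z → events us ++ (z ++ events ws)) class-split)
          (trans (cong (events us ++_) (List.++-assoc block _ (events ws))) (sym (List.++-assoc (events us) block _))))

  count-total : ∀ col R lo hi v → (∀ i → col i < R) → ∑ (upTo R) (λ c → count col c lo hi v) ≡ total lo hi v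
  count-total col R lo hi v col< = trans (∑-swap (upTo R) J _) (∑-cong J λ j →
    trans (∑-upTo-≡ R (col (toℕ j)) _) (when-true (lt (col< (toℕ j)))))
    where
    lt : ∀ {m n} → m < n → (m <ᵇ n) ≡ true
    lt {m} {n} m<n with m <ᵇ n | <⇒<ᵇ m<n
    ... | true | _ = refl

  -- Averaging: the count of `c` is compared with one plus the count of each colour, and these
  -- counts sum to the total. The comparison of `c` with itself is strict.
  count-bound : ∀ {col R lo hi v} → (∀ i → col i < R) →
                (∀ {c c′} → c < R → c′ < R → count col c lo hi v ≤ suc (count col c′ lo hi v)) →
                ∀ {c} → c < R → R * count col c lo hi v < total lo hi v + R
  count-bound {col} {R} {lo} {hi} {v} col< bal {c} c<R = begin-strict
    R * k                                               ≡⟨ cong (_* k) (List.length-upTo R) ⟨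
    length (upTo R) * k                                 ≡⟨ ∑-const (upTo R) k ⟨
    ∑ (upTo R) (λ _ → k)                                <⟨ ∑-mono-< (upTo R) (λ c′∈ → bal c<R (∈-upTo⁻ c′∈)) (∈-upTo⁺ c<R) (n<1+n k) ⟩
    ∑ (upTo R) (λ c′ → 1 + count col c′ lo hi v)        ≡⟨ ∑-+ (upTo R) (λ _ → 1) _ ⟩
    ∑ (upTo R) (λ _ → 1) + ∑ (upTo R) (λ c′ → count col c′ lo hi v)
                                                        ≡⟨ cong₂ _+_ (trans (∑-const (upTo R) 1) (trans (*-identityʳ _) (List.length-upTo R))) (count-total col R lo hi v col<) ⟩
    R + total lo hi v                                   ≡⟨ +-comm R _ ⟩
    total lo hi v + R                                   ∎
    where
    open ≤-Reasoning
    k = count col c lo hi v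

-- One job fits since D ≤ C. For k ≥ 2 the hypotheses give 8rD(k - 1) ≤ 4rC, so 2D(k - 1) ≤ C, and k
-- ≤ 2(k - 1). The factor 8 is what makes this last doubling affordable.
large-arith : ∀ {r C D k n L} → 1 ≤ r → 8 * r * k < n + 8 * r → D * n ≤ 4 * L → L ≤ r * C → D ≤ C → D * k ≤ C
large-arith {r} {C} {D} {zero}        1≤r _  _  _  D≤C = ≤-trans (≤-reflexive (*-zeroʳ D)) z≤n
large-arith {r} {C} {D} {suc zero}    1≤r _  _  _  D≤C = ≤-trans (≤-reflexive (*-identityʳ D)) D≤C
large-arith {r@(suc _)} {C} {D} {suc (suc k)} {n} {L} 1≤r k< n≤ L≤ D≤C = begin
  D * suc (suc k)                 ≤⟨ *-monoʳ-≤ D (m≤m+n (suc (suc k)) k) ⟩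
  D * (suc (suc k) + k)           ≤⟨ *-cancelˡ-≤ (4 * r) (+-cancelʳ-≤ (8 * r * D) _ _ (begin
      4 * r * (D * (suc (suc k) + k)) + 8 * r * D   ≡⟨ ar₁ r D k ⟩
      D * (8 * r * suc (suc k))                     ≤⟨ *-monoʳ-≤ D (<⇒≤ k<) ⟩
      D * (n + 8 * r)                               ≡⟨ ar₂ D n r ⟩
      D * n + 8 * r * D                             ≤⟨ +-monoˡ-≤ (8 * r * D) (≤-trans n≤ (*-monoʳ-≤ 4 L≤)) ⟩
      4 * (r * C) + 8 * r * D                       ≡⟨ cong (_+ 8 * r * D) (sym (*-assoc 4 r C)) ⟩
      4 * r * C + 8 * r * D                         ∎)) ⟩
  C                               ∎
  where
  open ≤-Reasoning
  ar₁ : ∀ r D k → 4 * r * (D * (suc (suc k) + k)) + 8 * r * D ≡ D * (8 * r * suc (suc k))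
  ar₁ = solve-∀
  ar₂ : ∀ D n r → D * (n + 8 * r) ≡ D * n + 8 * r * D
  ar₂ = solve-∀

-- `Λ` is the rounded load of one colour, `S` that of all small jobs and `Y` the sum of the class
-- ends. After division by 4r, the parts from `S` and `Y` take at most half of `C` each.
small-arith : ∀ {r C q Λ S Y L} → 1 ≤ r → 4 * r * Λ ≤ S + 4 * r * Y → S ≤ 2 * L → L ≤ r * C → Y ≤ q + q → q * 4 ≤ C → Λ ≤ C
small-arith {r@(suc _)} {C} {q} {Λ} {S} {Y} {L} 1≤r Λ≤ S≤ L≤ Y≤ q≤ = *-cancelˡ-≤ (4 * r) (begin
  4 * r * Λ                          ≤⟨ Λ≤ ⟩
  S + 4 * r * Y                      ≤⟨ +-mono-≤ (≤-trans S≤ (*-monoʳ-≤ 2 L≤)) (*-monoʳ-≤ (4 * r) Y≤) ⟩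
  2 * (r * C) + 4 * r * (q + q)      ≡⟨ ar₁ r C q ⟩
  2 * r * C + 2 * r * (q * 4)        ≤⟨ +-monoʳ-≤ (2 * r * C) (*-monoʳ-≤ (2 * r) q≤) ⟩
  2 * r * C + 2 * r * C              ≡⟨ ar₂ r C ⟩
  4 * r * C                          ∎)
  where
  open ≤-Reasoning
  ar₁ : ∀ r C q → 2 * (r * C) + 4 * r * (q + q) ≡ 2 * r * C + 2 * r * (q * 4)
  ar₁ = solve-∀
  ar₂ : ∀ r C → 2 * r * C + 2 * r * C ≡ 4 * r * C
  ar₂ = solve-∀

when-does : ∀ {P : Set} (p? : Dec P) {a w z} → (P → w when a ≤ z) → w when (does p? ∧ a) ≤ z
when-does (yes p) h = h p
when-does (no  _) h = z≤n

-- The second branch adds `R`, so a round below `R` can only come from the first.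
share-large : ∀ b {a w R i x y} → i < R → (if b then x else R + y) ≡ i → w when a ≤ w when (b ∧ a) when (x ≡ᵇ i)
share-large true  {x = x}     i<R refl = ≤-reflexive (sym (when-true (≡ᵇ-refl x)))
share-large false {R = R} {y = y} i<R refl = contradiction (<-≤-trans i<R (m≤m+n R y)) (<-irrefl refl)

share-small : ∀ b {a w R i x y} → x < R → R ≤ i → (if b then x else R + y) ≡ i → w when a ≤ w when (not b ∧ a) when (y ≡ᵇ i ∸ R)
share-small true  x<R R≤i refl = contradiction (<-≤-trans x<R R≤i) (<-irrefl refl)
share-small false {R = R} {y = y} x<R R≤i refl =
  ≤-reflexive (sym (when-true (trans (cong (y ≡ᵇ_) (m+n∸m≡n R y)) (≡ᵇ-refl y))))

-- Feasibility and approximation ratio.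

module Correctness (I : Instance) (nba : NBA I) where

  open Analysis I

  cap = capacity I
  caps = proj₁ (encode I)
  jobs = proj₂ (encode I)
  D = maxi jobs proj₁
  q = D / 4
  r = lower (encode I)

  d≤D : ∀ j → d j ≤ D
  d≤D j = maxi-upper jobs proj₁ (∈-tabulate⁺ j)

  D≤cap : ∀ e → D ≤ cap e
  D≤cap e = maxi-least jobs proj₁ (cap e) λ x∈ → small (∈-tabulate⁻ x∈)
    where
    small : ∀ {x} → (∃ λ j → x ≡ (d j , s j , t j)) → proj₁ x ≤ cap e
    small (j , refl) = nba j e

  L : ℕ → ℕ
  L v = ∑ J (λ j → d j when active v j)

  loadAt-L : ∀ v → loadAt v jobs ≡ L v
  loadAt-L v = trans (cong (loadAt v) (sym (List.map-tabulate (λ j → j) (λ j → d j , s j , t j)))) (∑-map (λ j → d j , s j , t j) J _)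

  edges : idx 0 caps ≡ tabulate (λ e → toℕ e , cap e)
  edges = idx-tabulate 0 cap

  ceil-≤ : ∀ e → ceil (L (toℕ e)) (cap e) ≤ r
  ceil-≤ e = subst (λ l → ceil l (cap e) ≤ r) (loadAt-L (toℕ e))
    (maxi-upper (idx 0 caps) (λ ec → ceil (loadAt (proj₁ ec) jobs) (proj₂ ec)) (subst ((toℕ e , cap e) ∈_) (sym edges) (∈-tabulate⁺ e)))

  lower-least : ∀ k → (∀ e → L (toℕ e) ≤ k * cap e) → r ≤ k
  lower-least k L≤ = maxi-least (idx 0 caps) (λ ec → ceil (loadAt (proj₁ ec) jobs) (proj₂ ec)) k
    λ {x} x∈ → small (∈-tabulate⁻ (subst (x ∈_) edges x∈))
    where
    small : ∀ {x} → (∃ λ e → x ≡ (toℕ e , cap e)) → ceil (loadAt (proj₁ x) jobs) (proj₂ x) ≤ k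
    small (e , refl) = ceil-least k (subst (_≤ k * cap e) (sym (loadAt-L (toℕ e))) (L≤ e))

  -- Each job alone fits on each edge by the NBA. The crude bound settles edges of capacity 0 and
  -- gives r ≤ n, on which the length of `fuel` rests.
  L≤n*cap : ∀ e → L (toℕ e) ≤ n I * cap e
  L≤n*cap e = begin
    L (toℕ e)              ≤⟨ ∑-mono J (λ {j} _ → ≤-trans (when-≤ (d j) (active (toℕ e) j)) (nba j e)) ⟩
    ∑ J (λ _ → cap e)      ≡⟨ ∑-const J (cap e) ⟩
    length J * cap e       ≡⟨ cong (_* cap e) (List.length-tabulate {n = n I} (λ j → j)) ⟩
    n I * cap e            ∎
    where open ≤-Reasoning

  L≤r*cap : ∀ e → L (toℕ e) ≤ r * cap e
  L≤r*cap e with cap e | ceil-≤ e | L≤n*cap e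
  ... | zero    | _  | l≤ = ≤-trans l≤ (≤-trans (≤-reflexive (*-zeroʳ (n I))) z≤n)
  ... | suc c   | c≤ | _  = ≤-trans (ceil-upper _ (suc c) (s≤s z≤n)) (*-monoˡ-≤ (suc c) c≤)

  -- The edge that leaves the source of the job carries positive load.
  job⇒1≤r : Fin (n I) → 1 ≤ r
  job⇒1≤r j with r | L≤r*cap e
    where
    e = Fin.fromℕ< (<-≤-trans (source<sink (job I j)) (≤-pred (Fin.toℕ<n (sink (job I j)))))
  ... | suc _ | _  = s≤s z≤n
  ... | zero  | L≤ = contradiction (≤-trans (1≤d j) (≤-trans (≤-reflexive (sym (when-true active-source))) (≤-trans (∑-member J _ (∈-allFin j)) L≤))) λ ()
    where
    e = Fin.fromℕ< (<-≤-trans (source<sink (job I j)) (≤-pred (Fin.toℕ<n (sink (job I j)))))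
    active-source : active (toℕ e) j ≡ true
    active-source rewrite Fin.toℕ-fromℕ< (<-≤-trans (source<sink (job I j)) (≤-pred (Fin.toℕ<n (sink (job I j)))))
                        | ≤ᵇ-true (≤-refl {s j}) = ≤ᵇ-true (source<sink (job I j))

  load-∑ : ∀ {k} (ρ : Fin (n I) → Fin k) i e →
           load I ρ i e ≡ ∑ J (λ j → d j when (does (ρ j Fin.≟ i) ∧ active (toℕ e) j))
  load-∑ ρ i e = trans (∑-filter (λ j → (ρ j Fin.≟ i) ×-dec (e ∈P? job I j)) J d)
    (∑-cong J λ j → cong (λ v → d j when (does (ρ j Fin.≟ i) ∧ ((s j ≤ᵇ v) ∧ (1 + toℕ e ≤ᵇ t j)))) (Fin.toℕ-inject₁ e))

  -- The load of an edge is spread over k rounds, each carrying at most its capacity; `r` is the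
  -- least number compatible with this on all edges.
  lower-bound : ∀ {k} → Solution I k → r ≤ k
  lower-bound {k} σ = lower-least k λ e → begin
    L (toℕ e)                                ≤⟨ ∑-mono J (λ {j} _ → own-round e j) ⟩
    ∑ J (λ j → ∑ (allFin k) (λ i → d j when (does (round σ j Fin.≟ i) ∧ active (toℕ e) j)))
                                             ≡⟨ ∑-swap (allFin k) J _ ⟨
    ∑ (allFin k) (λ i → ∑ J (λ j → d j when (does (round σ j Fin.≟ i) ∧ active (toℕ e) j)))
                                             ≤⟨ ∑-mono (allFin k) (λ {i} _ → ≤-trans (≤-reflexive (sym (load-∑ (round σ) i e))) (feasible σ i e)) ⟩
    ∑ (allFin k) (λ _ → cap e)               ≡⟨ ∑-const (allFin k) (cap e) ⟩
    length (allFin k) * cap e                ≡⟨ cong (_* cap e) (List.length-tabulate {n = k} (λ i → i)) ⟩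
    k * cap e                                ∎
    where
    open ≤-Reasoning
    own-round : ∀ e j → d j when active (toℕ e) j ≤ ∑ (allFin k) (λ i → d j when (does (round σ j Fin.≟ i) ∧ active (toℕ e) j))
    own-round e j = ≤-trans (≤-reflexive (cong (λ b → d j when (b ∧ active (toℕ e) j)) (sym (dec-true (round σ j Fin.≟ round σ j) refl))))
                            (∑-member (allFin k) _ (∈-allFin (round σ j)))

  fuel = double (double (double jobs))

  length-fuel : length fuel ≡ 8 * n I
  length-fuel = trans (length-double (double (double jobs))) (trans (cong₂ _+_ four four) (ar (n I)))
    where
    length-double : ∀ (xs : List (ℕ × ℕ × ℕ)) → length (double xs) ≡ length xs + length xs
    length-double xs = List.length-++ xs
    two : length (double jobs) ≡ n I + n I
    two = trans (length-double jobs) (cong₂ _+_ (List.length-tabulate (λ j → d j , s j , t j)) (List.length-tabulate (λ j → d j , s j , t j)))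
    four : length (double (double jobs)) ≡ (n I + n I) + (n I + n I)
    four = trans (length-double (double jobs)) (cong₂ _+_ two two)
    ar : ∀ m → (m + m + (m + m)) + (m + m + (m + m)) ≡ 8 * m
    ar = solve-∀

  r≤n : r ≤ n I
  r≤n = lower-least (n I) L≤n*cap

  8r≤fuel : 8 * r ≤ length fuel
  8r≤fuel = ≤-trans (*-monoʳ-≤ 8 r≤n) (≤-reflexive (sym length-fuel))

  4r≤fuel : 4 * r ≤ length fuel
  4r≤fuel = ≤-trans (*-monoˡ-≤ r {4} {8} (s≤s (s≤s (s≤s (s≤s z≤n))))) 8r≤fuel

  lv = levels (size nat q) q

  start = map (λ j → proj₁ j , 0) (idx 0 jobs)
  largeT = balanceT (palette fuel (8 * r)) (classEvents (vertices caps) q D (idx 0 jobs)) start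
  smallT = balanceT (palette fuel (4 * r)) (smallEvents (vertices caps) lv (idx 0 jobs)) start

  jobs-js : idx 0 jobs ≡ js
  jobs-js = trans (idx-tabulate 0 (λ j → d j , s j , t j)) (sym (List.map-tabulate (λ j → j) entry))

  start-tab : start ≡ tab ids (λ _ → 0)
  start-tab = trans (cong (map (λ j → proj₁ j , 0)) jobs-js) (trans (sym (List.map-∘ J)) (List.map-∘ J))

  vertices-vs : vertices caps ≡ vs
  vertices-vs = trans (idx-keys 0 (0 ∷ caps)) (cong (upTo ∘ suc) (List.length-tabulate cap))

  large? : Fin (n I) → Bool
  large? j = 1 + q ≤ᵇ d j

  value′ : Fin (n I) → ℕ
  value′ j = if large? j then look 0 largeT (toℕ j) else 8 * r + look 0 smallT (toℕ j)

  algorithm-value : algorithm (encode I) ≡ (8 * r + 4 * r , tabulate value′)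
  algorithm-value = cong (8 * r + 4 * r ,_) (trans (cong (map assign) (idx-tabulate 0 (λ j → d j , s j , t j))) (List.map-tabulate entry assign))
    where
    assign : ℕ × ℕ × ℕ × ℕ → ℕ
    assign j = if 1 + q ≤ᵇ proj₁ (proj₂ j) then look 0 largeT (proj₁ j) else 8 * r + look 0 smallT (proj₁ j)

  -- For r = 0 the palettes are empty and lack the initial colour 0. Wherever a colour is needed, a
  -- job or a round is at hand, and either forces r ≥ 1.
  module Nonempty (1≤r : 1 ≤ r) where

    module Large = Classes {ℕ} (λ _ → q) (λ x → x)
    module Small = Classes {ℕ} (λ x → x / 2) (λ x → x)

    Coloured : ℕ → List ⟦ Event ⟧ → List (ℕ × ℕ) → Set
    Coloured R E C = ∃ λ col → C ≡ tab ids col × Balanced (palette fuel R) col E × (∀ i → col i < R)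

    coloured : ∀ R E → 1 ≤ R → R ≤ length fuel → Keys ids E → Distinct E →
               Coloured R E (balanceT (palette fuel R) E (tab ids (λ _ → 0)))
    coloured R E 1≤R R≤ keys distinct =
      let col , eq , bal , col∈ = balanceT-correct ids (palette fuel R) E keys distinct (<-palette fuel R R≤ 1≤R)
      in col , eq , bal , λ i → palette-< fuel R (col∈ i)

    abstract

      large-run : Coloured (8 * r) (Large.events (D ∷ [])) largeT
      large-run = subst (Coloured (8 * r) (Large.events (D ∷ []))) (sym (cong₂ (balanceT (palette fuel (8 * r)))
        (trans (cong₂ (λ us xs → classEvents us q D xs) vertices-vs jobs-js) (sym (List.++-identityʳ (classEvents vs q D js)))) start-tab))
        (coloured (8 * r) (Large.events (D ∷ [])) (*-mono-≤ {1} {8} (s≤s z≤n) 1≤r) 8r≤fuel (Large.keys (D ∷ [])) (Large.distinct ([] ∷ [])))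

      small-run : Coloured (4 * r) (Small.events lv) smallT
      small-run = subst (Coloured (4 * r) (Small.events lv)) (sym (cong₂ (balanceT (palette fuel (4 * r)))
        (cong₂ (λ us xs → smallEvents us lv xs) vertices-vs jobs-js) start-tab))
        (coloured (4 * r) (Small.events lv) (*-mono-≤ {1} {4} (s≤s z≤n) 1≤r) 4r≤fuel (Small.keys lv) (Small.distinct (levels-decrease (size nat q) q)))

    colL = proj₁ large-run
    colS = proj₁ small-run

    colL< : ∀ i → colL i < 8 * r
    colL< = proj₂ (proj₂ (proj₂ large-run))

    colS< : ∀ i → colS i < 4 * r
    colS< = proj₂ (proj₂ (proj₂ small-run))

    value-col : ∀ j → value′ j ≡ (if large? j then colL (toℕ j) else 8 * r + colS (toℕ j))
    value-col j = cong₂ (λ x y → if large? j then x else 8 * r + y)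
      (trans (cong (λ C → look 0 C (toℕ j)) (proj₁ (proj₂ large-run))) (look-tab 0 ids colL j∈))
      (trans (cong (λ C → look 0 C (toℕ j)) (proj₁ (proj₂ small-run))) (look-tab 0 ids colS j∈))
      where
      j∈ = ∈-map⁺ toℕ (∈-allFin j)

    value-< : ∀ j → value′ j < 8 * r + 4 * r
    value-< j = subst (_< 8 * r + 4 * r) (sym (value-col j)) (bound (large? j))
      where
      bound : ∀ b → (if b then colL (toℕ j) else 8 * r + colS (toℕ j)) < 8 * r + 4 * r
      bound true  = <-≤-trans (colL< (toℕ j)) (m≤m+n _ _)
      bound false = +-monoʳ-< (8 * r) (colS< (toℕ j))

    large-fits : ∀ e {c} → c < 8 * r →
                 ∑ J (λ j → d j when (large? j ∧ active (toℕ e) j) when (colL (toℕ j) ≡ᵇ c)) ≤ cap e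
    large-fits e {c} c< = ≤-trans by-count (large-arith {r} {k = k} {n = total q D v} 1≤r
      (count-bound {colL} {8 * r} {q} {D} {v} colL< (λ c∈ c′∈ → Large.count-balanced {palette fuel (8 * r)} {colL} {D ∷ []} {D} {v} (proj₁ (proj₂ (proj₂ large-run))) (here refl) (<⇒≤ (Fin.toℕ<n e)) (in-palette c∈) (in-palette c′∈)) c<)
      total≤ (L≤r*cap e) (D≤cap e))
      where
      v = toℕ e
      k = count colL c q D v
      in-palette : ∀ {c} → c < 8 * r → c ∈ palette fuel (8 * r)
      in-palette = <-palette fuel (8 * r) 8r≤fuel
      open ≤-Reasoning
      by-count : ∑ J (λ j → d j when (large? j ∧ active v j) when (colL (toℕ j) ≡ᵇ c)) ≤ D * k
      by-count = ≤-trans (∑-mono J (λ {j} _ → each j)) (≤-reflexive (∑-*ˡ D J _))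
        where
        each : ∀ j → d j when (large? j ∧ active v j) when (colL (toℕ j) ≡ᵇ c) ≤ D * (1 when (inC q D j ∧ active v j) when (colL (toℕ j) ≡ᵇ c))
        each j with colL (toℕ j) ≡ᵇ c
        ... | false = z≤n
        -- No demand exceeds `D`, so membership in the class is just `large? j`.
        ... | true rewrite ≤ᵇ-true (d≤D j) | Bool.∧-identityʳ (large? j) with large? j ∧ active v j
        ...   | false = z≤n
        ...   | true  = ≤-trans (d≤D j) (≤-reflexive (sym (*-identityʳ D)))
      total≤ : D * total q D v ≤ 4 * L v
      total≤ = begin
        D * total q D v                                             ≡⟨ ∑-*ˡ D J _ ⟨
        ∑ J (λ j → D * (1 when (inC q D j ∧ active v j)))           ≤⟨ ∑-mono J (λ {j} _ → each j) ⟩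
        ∑ J (λ j → 4 * (d j when active v j))                       ≡⟨ ∑-*ˡ 4 J _ ⟩
        4 * L v                                                     ∎
        where
        each : ∀ j → D * (1 when (inC q D j ∧ active v j)) ≤ 4 * (d j when active v j)
        each j with large? j in eq | active v j
        ... | false | _     = ≤-trans (≤-reflexive (*-zeroʳ D)) z≤n
        ... | true  | false rewrite Bool.∧-zeroʳ (d j ≤ᵇ D) = ≤-trans (≤-reflexive (*-zeroʳ D)) z≤n
        ... | true  | true  rewrite ≤ᵇ-true (d≤D j) = ≤-trans (≤-reflexive (*-identityʳ D)) (quarter-< {D} {d j} (true-≤ᵇ eq))

    small-fits : ∀ e {c} → c < 4 * r →
                 ∑ J (λ j → d j when (not (large? j) ∧ active (toℕ e) j) when (colS (toℕ j) ≡ᵇ c)) ≤ cap e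
    small-fits e {c} c< = ≤-trans by-levels (small-arith {r} {q = q} 1≤r rounded totals≤ (L≤r*cap e) (levels-sum (size nat q) q)
                            (≤-trans (m/n*n≤m D 4) (D≤cap e)))
      where
      v = toℕ e
      open ≤-Reasoning
      in-palette : ∀ {c} → c < 4 * r → c ∈ palette fuel (4 * r)
      in-palette = <-palette fuel (4 * r) 4r≤fuel
      k : ℕ → ℕ
      k x = count colS c (x / 2) x v
      scaled : ∀ x b → x * (1 when (b ∧ true)) ≡ x when b
      scaled x true  = *-identityʳ x
      scaled x false = *-zeroʳ x
      none : ∀ x b → x * (1 when (b ∧ false)) ≡ 0
      none x true  = *-zeroʳ x
      none x false = *-zeroʳ x
      by-levels : ∑ J (λ j → d j when (not (large? j) ∧ active v j) when (colS (toℕ j) ≡ᵇ c)) ≤ ∑ lv (λ x → x * k x)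
      by-levels = begin
        _                                                           ≤⟨ ∑-mono J (λ {j} _ → each j) ⟩
        ∑ J (λ j → ∑ lv (λ x → x * (1 when (inC (x / 2) x j ∧ active v j) when (colS (toℕ j) ≡ᵇ c))))
                                                                    ≡⟨ ∑-swap lv J _ ⟨
        ∑ lv (λ x → ∑ J (λ j → x * (1 when (inC (x / 2) x j ∧ active v j) when (colS (toℕ j) ≡ᵇ c))))
                                                                    ≡⟨ ∑-cong lv (λ x → ∑-*ˡ x J _) ⟩
        ∑ lv (λ x → x * k x)                                        ∎
        where
        each : ∀ j → d j when (not (large? j) ∧ active v j) when (colS (toℕ j) ≡ᵇ c) ≤
                     ∑ lv (λ x → x * (1 when (inC (x / 2) x j ∧ active v j) when (colS (toℕ j) ≡ᵇ c)))
        each j with colS (toℕ j) ≡ᵇ c | active v j | large? j in eq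
        ... | false | _     | _     = z≤n
        ... | true  | _     | true  = z≤n
        ... | true  | false | false = z≤n
        -- A job that is not large has demand between 1 and `q`, so some class contains it.
        ... | true  | true  | false = ≤-trans (levelled-lower (size nat q) (x<2^size q) (1≤d j) (≤-pred (false-≤ᵇ eq)))
                                              (≤-reflexive (sym (∑-cong lv (λ x → scaled x (inLevel (d j) x)))))
      totals≤ : ∑ lv (λ x → x * total (x / 2) x v) ≤ 2 * L v
      totals≤ = begin
        ∑ lv (λ x → x * total (x / 2) x v)                                 ≡⟨ ∑-cong lv (λ x → ∑-*ˡ x J _) ⟨
        ∑ lv (λ x → ∑ J (λ j → x * (1 when (inC (x / 2) x j ∧ active v j)))) ≡⟨ ∑-swap lv J _ ⟩
        ∑ J (λ j → ∑ lv (λ x → x * (1 when (inC (x / 2) x j ∧ active v j)))) ≤⟨ ∑-mono J (λ {j} _ → each j) ⟩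
        ∑ J (λ j → 2 * (d j when active v j))                              ≡⟨ ∑-*ˡ 2 J _ ⟩
        2 * L v                                                            ∎
        where
        each : ∀ j → ∑ lv (λ x → x * (1 when (inC (x / 2) x j ∧ active v j))) ≤ 2 * (d j when active v j)
        each j with active v j
        ... | true  = ≤-trans (≤-reflexive (∑-cong lv (λ x → scaled x (inLevel (d j) x))))
                        (≤-trans (levelled-upper (size nat q) q (d j)) (≤-reflexive (cong (d j +_) (sym (+-identityʳ (d j))))))
        ... | false = ≤-reflexive (trans (∑-cong lv (λ x → none x (inLevel (d j) x))) (trans (∑-const lv 0) (*-zeroʳ (length lv))))
      rounded : 4 * r * ∑ lv (λ x → x * k x) ≤ ∑ lv (λ x → x * total (x / 2) x v) + 4 * r * ∑ lv (λ x → x)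
      rounded = begin
        4 * r * ∑ lv (λ x → x * k x)                              ≡⟨ ∑-*ˡ (4 * r) lv _ ⟨
        ∑ lv (λ x → 4 * r * (x * k x))                            ≤⟨ ∑-mono lv (λ {x} x∈ → each x x∈) ⟩
        ∑ lv (λ x → x * total (x / 2) x v + 4 * r * x)            ≡⟨ ∑-+ lv _ _ ⟩
        _                                                         ≡⟨ cong (∑ lv (λ x → x * total (x / 2) x v) +_) (∑-*ˡ (4 * r) lv (λ x → x)) ⟩
        ∑ lv (λ x → x * total (x / 2) x v) + 4 * r * ∑ lv (λ x → x) ∎
        where
        ar₁ : ∀ R x k → R * (x * k) ≡ x * (R * k)
        ar₁ = solve-∀
        ar₂ : ∀ R x k → x * (k + R) ≡ x * k + R * x
        ar₂ = solve-∀
        -- Rounding the count costs at most one job of size `x` per class and colour; these errors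
        -- add up to the sum of the class ends.
        each : ∀ x → x ∈ lv → 4 * r * (x * k x) ≤ x * total (x / 2) x v + 4 * r * x
        each x x∈ = begin
          4 * r * (x * k x)                         ≡⟨ ar₁ (4 * r) x (k x) ⟩
          x * (4 * r * k x)                         ≤⟨ *-monoʳ-≤ x (<⇒≤ (count-bound {colS} {4 * r} {x / 2} {x} {v} colS< (λ c∈ c′∈ → Small.count-balanced {palette fuel (4 * r)} {colS} {lv} {x} {v} (proj₁ (proj₂ (proj₂ small-run))) x∈ (<⇒≤ (Fin.toℕ<n e)) (in-palette c∈) (in-palette c′∈)) c<)) ⟩
          x * (total (x / 2) x v + 4 * r)           ≡⟨ ar₂ (4 * r) x _ ⟩
          x * total (x / 2) x v + 4 * r * x         ∎

  round′ : Fin (n I) → Fin (8 * r + 4 * r)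
  round′ j = Fin.fromℕ< (Nonempty.value-< (job⇒1≤r j) j)

  toℕ-round : ∀ j → toℕ (round′ j) ≡ value′ j
  toℕ-round j = Fin.toℕ-fromℕ< _

  fits : ∀ i e → load I round′ i e ≤ cap e
  fits i e = ≤-trans (≤-reflexive (load-∑ round′ i e)) (by (toℕ i <? 8 * r))
    where
    positive : ∀ k {x} → x < 8 * k + 4 * k → 1 ≤ k
    positive (suc _) _ = s≤s z≤n
    -- There may be no job to appeal to, but the round `i` exists, so `8 * r + 4 * r` is positive.
    1≤r : 1 ≤ r
    1≤r = positive r (Fin.toℕ<n i)
    open Nonempty 1≤r
    v = toℕ e
    value-col-i : ∀ {j} → round′ j ≡ i → (if large? j then colL (toℕ j) else 8 * r + colS (toℕ j)) ≡ toℕ i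
    value-col-i {j} eq = trans (sym (value-col j)) (trans (sym (toℕ-round j)) (cong toℕ eq))
    by : Dec (toℕ i < 8 * r) → ∑ J (λ j → d j when (does (round′ j Fin.≟ i) ∧ active v j)) ≤ cap e
    by (yes i<) = ≤-trans
      (∑-mono J λ {j} _ → when-does (round′ j Fin.≟ i) (share-large (large? j) i< ∘ value-col-i))
      (large-fits e i<)
    by (no i≮) = ≤-trans
      (∑-mono J λ {j} _ → when-does (round′ j Fin.≟ i) (share-small (large? j) (colL< (toℕ j)) (≮⇒≥ i≮) ∘ value-col-i))
      (small-fits e (+-cancelˡ-< (8 * r) _ _ (≤-trans (s≤s (≤-reflexive (m+[n∸m]≡n (≮⇒≥ i≮)))) (Fin.toℕ<n i))))

  solution : Solution I (8 * r + 4 * r)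
  solution = record { round = round′ ; feasible = fits }

  algorithm-encodes : algorithm (encode I) ≡ encodeSolution solution
  algorithm-encodes = trans algorithm-value (cong (8 * r + 4 * r ,_) (List.tabulate-cong (λ j → sym (toℕ-round j))))

  ratio : ∀ opt → IsOPT I opt → 8 * r + 4 * r ≤ 12 * opt
  ratio opt (σ , _) = ≤-trans (≤-reflexive (sym (*-distribʳ-+ r 8 4))) (*-monoʳ-≤ 12 (lower-bound σ))

polynomial-time : ∀ {C f} (e : Ex (Input ∷ []) Output f) → PolynomialTimeUnder C (Ex.tm e)
-- The environment consists of the input alone, and the empty environment has size 1; hence
-- `X ⊞ K 1`.
polynomial-time e = let c , k , bound = pol-bound (Ex.pol e ⊚ (X ⊞ K 1)) in c , k , λ I _ →
  let t , run , t≤ = Ex.run e (encode I ∷ []) in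
  _ , t , run , ≤-trans t≤ (bound (size Input (encode I)) (1≤size Input (encode I)))

approximation : (e : Ex (Input ∷ []) Output (λ ρ → algorithm (All.lookup ρ (here refl)))) → ApproximationUnder NBA 12 (Ex.tm e)
approximation e I nba =
  let t , run , _ = Ex.run e (encode I ∷ []) in
  _ , solution , (t , subst (λ v → Ex.tm e on I ⇓ v [ t ]) algorithm-encodes run) , ratio
  where open Correctness I nba

theorem36 : ∃ λ (A : Algorithm) → PolynomialTimeUnder NBA A × ApproximationUnder NBA 12 A
theorem36 = Ex.tm algorithmE , polynomial-time algorithmE , approximation algorithmE
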